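{- There exists a symbolic algorithm (in the set-based symbolic model of computation) that solves $(n,d)$-small parity games using $O(\lg d)$ symbolic set variables, $O(\log d\cdot\log n)$ bits of conventional space, and whose running time is polynomial if $d=O(\log n)$, and quasi-polynomial, namely $n^{2\lg(d/\lg n)+O(1)}$, if $d=\omega(\log n)$.
   Context: **Parity games.** A parity game consists of a finite directed graph $(V,E)$ in which every vertex has at least one outgoing edge, a partition $(V_{\mathrm{Even}},V_{\mathrm{Odd}})$ of $V$, and a function $\pi$ assigning to each vertex a non-negative integer, its priority. It is $(n,d)$-small if it has at most $n$ vertices and all priorities are at most $d$. A cycle is even if the highest priority on it is even, and odd otherwise. An Even strategy is a set $\sigma\subseteq E$ such that every $v\in V_{\mathrm{Even}}$ has an outgoing edge in $\sigma$ and every outgoing edge of every $v\in V_{\mathrm{Odd}}$ is in $\sigma$. A set $D$ is an Even dominion if there is an Even strategy $\sigma$ such that no edge of $\sigma$ leaves $D$ and every cycle in $(D,\sigma)$ is even. Odd dominia are defined dually. There is a largest Even dominion and a largest Odd dominion, and they partition $V$ (positional determinacy). Solving a parity game means computing these two sets. **Set-based symbolic model of computation.** Any standard computational operations on any standard data structures are allowed (conventional space is that used by these), and in addition the following symbolic resources are available: symbolic set variables, each of which can store a set of vertices of the graph of the parity game; and primitive symbolic operations, which are the basic set-theoretic operations on symbolic set variables and the controllable predecessor operations. The Even (resp. Odd) controllable predecessor, applied to a symbolic set variable $X$, returns the set of vertices from which Even (resp. Odd) can force a move into $X$ by taking just one outgoing edge. $\lg$ denotes the base-2 logarithm. -}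

module Defs where

open import Data.Bool using (Bool; true; false)
open import Data.Fin using (Fin)
open import Data.Fin.Subset
  using (Subset; _∈_; _⊆_; _∪_; _∩_; _─_; Nonempty) renaming (⊥ to ∅; ⊤ to full)
open import Data.Fin.Subset.Properties using (_⊆?_; nonempty?)
open import Data.List using (List; []; _∷_; length; map)
open import Data.Nat
  using (ℕ; zero; suc; _+_; _*_; _∸_; _≤_; _<_; _⊔_; _<?_; _/_; _%_; parity)
  renaming (_≟_ to _≟ⁿ_)
open import Data.Nat.ListAction using (sum)
open import Data.Nat.Logarithm using (⌊log₂_⌋)
open import Data.Parity using (Parity; 0ℙ; 1ℙ; _⁻¹; _≟_)
open import Data.Product using (∃; _×_)
open import Data.Vec using (tabulate)
open import Relation.Binary.PropositionalEquality using (_≡_)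
open import Relation.Nullary using (does; yes; no)
open import Relation.Unary using (Decidable)

-- A player is identified with the parity of the cycles that it wins; the
-- opponent of p is p ⁻¹.
Player : Set
Player = Parity

pattern Even = 0ℙ
pattern Odd  = 1ℙ

record ParityGame : Set where
  field
    size  : ℕ
    owner : Fin size → Player
    succs : Fin size → Subset size
    total : ∀ v → Nonempty (succs v)
    π     : Fin size → ℕ

  Vertex : Set
  Vertex = Fin size

  VertexSet : Set
  VertexSet = Subset size

open ParityGame

Small : ℕ → ℕ → ParityGame → Set
Small n d G = size G ≤ n × (∀ v → π G v ≤ d)

module _ (G : ParityGame) where

  -- A set of edges is given by its successor sets.
  record Strategy (p : Player) (σ : Vertex G → VertexSet G) : Set where
    field
      edges    : ∀ v → σ v ⊆ succs G v
      own      : ∀ v → owner G v ≡ p → Nonempty (σ v)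
      opponent : ∀ v → owner G v ≡ p ⁻¹ → succs G v ⊆ σ v

  data Walk (D : VertexSet G) (σ : Vertex G → VertexSet G) : Vertex G → Vertex G → Set where
    edge : ∀ {u v} → u ∈ D → v ∈ D → v ∈ σ u → Walk D σ u v
    cons : ∀ {u v w} → u ∈ D → v ∈ σ u → Walk D σ v w → Walk D σ u w

  highest : ∀ {D σ u v} → Walk D σ u v → ℕ
  highest (edge {u} {v} _ _ _) = π G u ⊔ π G v
  highest (cons {u} _ _ w)     = π G u ⊔ highest w

  -- Cycles are closed walks, possibly with repeated vertices.  Asking only
  -- for simple cycles gives the same dominia: a closed walk splits into simple
  -- cycles, one of which contains its highest priority.
  record Dominion (p : Player) (D : VertexSet G) : Set where
    field
      σ        : Vertex G → VertexSet G
      strategy : Strategy p σ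
      closed   : ∀ v → v ∈ D → σ v ⊆ D
      winning  : ∀ {v} (cycle : Walk D σ v v) → parity (highest cycle) ≡ p

  LargestDominion : Player → VertexSet G → Set
  LargestDominion p D = Dominion p D × (∀ D′ → Dominion p D′ → D′ ⊆ D)

  comprehension : {P : Vertex G → Set} → Decidable P → VertexSet G
  comprehension P? = tabulate (λ v → does (P? v))

  ownedBy : Player → VertexSet G
  ownedBy p = comprehension (λ v → owner G v ≟ p)

  withPriority : ℕ → VertexSet G
  withPriority k = comprehension (λ v → π G v ≟ⁿ k)

  cpre : Player → VertexSet G → VertexSet G
  cpre p X = tabulate forces
    where
    forces : Vertex G → Bool
    forces v with owner G v ≟ p
    ... | yes _ = does (nonempty? (succs G v ∩ X))
    ... | no  _ = does (succs G v ⊆? X)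

-- A random-access machine, with structured control flow, that works on
-- conventional cells M[0], M[1], … holding natural numbers and on symbolic set
-- variables X[0], X[1], … holding sets of vertices.  A program is a fixed
-- finite text: it is the same for all n, d and all games, and set variables
-- are therefore addressed through cells.

data Op : Set where
  plus monus times quotient remainder : Op

data SetOp : Set where
  union intersection difference : SetOp

data NumExp : Set where
  lit  : (k : ℕ) → NumExp                 -- k
  copy : (a : ℕ) → NumExp                 -- M[a]
  load : (a : ℕ) → NumExp                 -- M[M[a]]
  op   : Op → (a b : ℕ) → NumExp          -- M[a] ∘ M[b]

-- The game itself is read-only input, available to a program only through
-- controllable predecessors, the two sets of the partition of the vertices and
-- the sets of vertices of a given priority.
data SetExp : Set where
  none all : SetExp
  owned    : Player → SetExp
  priority : (a : ℕ) → SetExp             -- vertices of priority M[a]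
  setOp    : SetOp → (a b : ℕ) → SetExp   -- X[M[a]] ∘ X[M[b]]
  control  : Player → (a : ℕ) → SetExp    -- controllable predecessor of X[M[a]]

data Test : Set where
  less   : (a b : ℕ) → Test               -- M[a] < M[b]
  subset : (a b : ℕ) → Test               -- X[M[a]] ⊆ X[M[b]]

data Instruction : Set where
  assign    : (a : ℕ) → NumExp → Instruction   -- M[a] := e
  store     : (a b : ℕ) → Instruction          -- M[M[a]] := M[b]
  assignSet : (a : ℕ) → SetExp → Instruction   -- X[M[a]] := e

infixr 4 _⨾_

data Program : Set where
  skip          : Program
  instr         : Instruction → Program
  _⨾_           : Program → Program → Program
  if_then_else_ : Test → Program → Program → Program
  while_loop_   : Test → Program → Program

-- A memory is the list of contents up to the highest address written so far.
-- Writing beyond its end allocates (and so pays for) all addresses in between.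
read : {A : Set} → A → List A → ℕ → A
read default []       _       = default
read default (x ∷ xs) zero    = x
read default (x ∷ xs) (suc i) = read default xs i

write : {A : Set} → A → ℕ → A → List A → List A
write default zero    y []       = y ∷ []
write default zero    y (x ∷ xs) = y ∷ xs
write default (suc i) y []       = default ∷ write default i y []
write default (suc i) y (x ∷ xs) = x ∷ write default i y xs

infixl 7 _div_ _mod_

_div_ : ℕ → ℕ → ℕ
m div zero  = 0
m div suc n = m / suc n

_mod_ : ℕ → ℕ → ℕ
m mod zero  = m
m mod suc n = m % suc n

⟦_⟧ : Op → ℕ → ℕ → ℕ
⟦ plus ⟧      = _+_
⟦ monus ⟧     = _∸_
⟦ times ⟧     = _*_
⟦ quotient ⟧  = _div_
⟦ remainder ⟧ = _mod_

bitLength : ℕ → ℕ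
bitLength k = suc ⌊log₂ k ⌋

module _ (G : ParityGame) where

  ⟦_⟧ˢ : SetOp → VertexSet G → VertexSet G → VertexSet G
  ⟦ union ⟧ˢ        = _∪_
  ⟦ intersection ⟧ˢ = _∩_
  ⟦ difference ⟧ˢ   = _─_

  record State : Set where
    constructor ⟨_,_⟩
    field
      cells : List ℕ
      sets  : List (VertexSet G)

  open State

  M : State → ℕ → ℕ
  M s = read 0 (cells s)

  X : State → ℕ → VertexSet G
  X s = read ∅ (sets s)

  evalNum : State → NumExp → ℕ
  evalNum s (lit k)    = k
  evalNum s (copy a)   = M s a
  evalNum s (load a)   = M s (M s a)
  evalNum s (op ∘ a b) = ⟦ ∘ ⟧ (M s a) (M s b)

  evalSet : State → SetExp → VertexSet G
  evalSet s none          = ∅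
  evalSet s all           = full
  evalSet s (owned p)     = ownedBy G p
  evalSet s (priority a)  = withPriority G (M s a)
  evalSet s (setOp ∘ a b) = ⟦ ∘ ⟧ˢ (X s (M s a)) (X s (M s b))
  evalSet s (control p a) = cpre G p (X s (M s a))

  evalTest : State → Test → Bool
  evalTest s (less a b)   = does (M s a <? M s b)
  evalTest s (subset a b) = does (X s (M s a) ⊆? X s (M s b))

  execute : Instruction → State → State
  execute (assign a e)    s = ⟨ write 0 a (evalNum s e) (cells s) , sets s ⟩
  execute (store a b)     s = ⟨ write 0 (M s a) (M s b) (cells s) , sets s ⟩
  execute (assignSet a e) s = ⟨ cells s , write ∅ (M s a) (evalSet s e) (sets s) ⟩

  data Run : Program → State → State → Set where
    skip   : ∀ {s} → Run skip s s
    instr  : ∀ {i s} → Run (instr i) s (execute i s)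
    _⨾_    : ∀ {P Q s s′ s″} → Run P s s′ → Run Q s′ s″ → Run (P ⨾ Q) s s″
    ifTrue : ∀ {t P Q s s′} → evalTest s t ≡ true →
             Run P s s′ → Run (if t then P else Q) s s′
    ifFalse : ∀ {t P Q s s′} → evalTest s t ≡ false →
              Run Q s s′ → Run (if t then P else Q) s s′
    stop   : ∀ {t P s} → evalTest s t ≡ false → Run (while t loop P) s s
    repeat : ∀ {t P s s′ s″} → evalTest s t ≡ true →
             Run P s s′ → Run (while t loop P) s′ s″ → Run (while t loop P) s s″

  -- Every instruction, conventional or symbolic, and every test takes one step.
  time : ∀ {P s s′} → Run P s s′ → ℕ
  time skip          = 1
  time instr         = 1
  time (r ⨾ r′)      = time r + time r′
  time (ifTrue _ r)  = suc (time r)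
  time (ifFalse _ r) = suc (time r)
  time (stop _)      = 1
  time (repeat _ r r′) = suc (time r + time r′)

  -- The maximum of a quantity over all states that a run goes through.
  peak : (State → ℕ) → ∀ {P s s′} → Run P s s′ → ℕ
  peak f {s = s} skip              = f s
  peak f {s = s} {s′ = s′} instr   = f s ⊔ f s′
  peak f (r ⨾ r′)                  = peak f r ⊔ peak f r′
  peak f (ifTrue _ r)              = peak f r
  peak f (ifFalse _ r)             = peak f r
  peak f {s = s} (stop _)          = f s
  peak f (repeat _ r r′)           = peak f r ⊔ peak f r′

  conventionalSpace : ∀ {P s s′} → Run P s s′ → ℕ
  conventionalSpace = peak (λ s → sum (map bitLength (cells s)))

  setVariables : ∀ {P s s′} → Run P s s′ → ℕ
  setVariables = peak (λ s → length (sets s))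

  initial : ℕ → ℕ → State
  initial n d = ⟨ n ∷ d ∷ [] , [] ⟩

-- The result is left in the set variables X[0] and X[1].
SolvesSmallGames : Program → Set
SolvesSmallGames P = ∀ n d G → Small n d G →
  ∃ λ s → Run G P (initial G n d) s
        × LargestDominion G Even (X G s 0)
        × LargestDominion G Odd  (X G s 1)

Resource : Set
Resource = ∀ G {P s s′} → Run G P s s′ → ℕ

Uses[_]≤ : Resource → Program → ℕ → ℕ → ℕ → Set
Uses[ ρ ]≤ P n d b = ∀ G → Small n d G →
  ∀ {s} (r : Run G P (initial G n d) s) → ρ G r ≤ b

-- Rounding lg x down costs at most a factor 2 for x ≥ 2, which every use
-- inside O or ω absorbs.
lg : ℕ → ℕ
lg = ⌊log₂_⌋

Eventually : (ℕ → Set) → Set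
Eventually P = ∃ λ n₀ → ∀ n → n₀ ≤ n → P n

_∈O_ : (ℕ → ℕ) → (ℕ → ℕ) → Set
f ∈O g = ∃ λ c → Eventually (λ n → f n ≤ c * g n)

_∈ω_ : (ℕ → ℕ) → (ℕ → ℕ) → Set
f ∈ω g = ∀ c → Eventually (λ n → c * g n < f n)

{-# OPTIONS --safe #-}
module Submission where

-- The witness is the attractor-decomposition recursion driven by two succinct universal trees.
-- On a level h of parity p with opponent q, a call with q-precision b runs twice with precision
-- b − 1, and in between removes the q-attractor of what q wins below h at precision b.  A closed
-- part of a q-dominion of size < 2 ^ b that avoids h is caught in the middle as soon as the
-- parts before it exceed 2 ^ (b − 1), so that less than 2 ^ (b − 1) vertices remain for the
-- second half; a p-dominion loses nothing.  With n < 2 ^ b, positional determinacy identifies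
-- the result with the winning regions.
--
-- The residual games of the suspended levels form a chain, which is stored as a binary mark on
-- every vertex: the depth at which it was suspended.  The control stack only records the halves
-- that are under way, at most 2 lg n + 2 of them, as digits of one number.  A call on k levels
-- with precisions of sum L takes time F(k, L) = 2 F(k, L − 1) + F(k − 1, L) + O(1), where levels
-- without any vertex are skipped, so that k ≤ min(n, d + 1).

open import Defs
open import Data.Bool using (Bool; true; false; T)
open import Data.Empty using (⊥)
open import Data.Fin using (Fin)
open import Data.Fin.Induction using (spo-wellFounded)
open import Data.Fin.Properties using (any?)
open import Data.Fin.Subset
  using (Subset; _∈_; _∉_; _⊆_; _∪_; _∩_; _─_; ⁅_⁆; ∣_∣; Nonempty)
  renaming (⊥ to ∅; ⊤ to full)
open import Data.Fin.Subset.Properties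
open import Data.List using (List; []; _∷_; length; map; replicate) renaming (_++_ to _++ˡ_)
open import Data.List.Properties using (++-assoc; length-replicate)
open import Data.List.Relation.Unary.All using (All; []; _∷_)
open import Data.Nat hiding (_≟_)
open import Data.Nat using () renaming (_≟_ to _≟ⁿ_)
open import Data.Nat.Divisibility using (n∣m*n)
open import Data.Nat.DivMod hiding (_div_; _mod_)
open import Data.Nat.Induction using (<-wellFounded)
open import Data.Nat.ListAction using (sum)
open import Data.Nat.Logarithm
open import Data.Nat.Properties hiding (_≟_)
open import Data.Nat.Tactic.RingSolver using (solve-∀)
open import Data.Parity using (0ℙ; 1ℙ; _⁻¹; _≟_)
open import Data.Product using (∃; _×_; _,_; proj₁; proj₂)
open import Data.Sum using (_⊎_; inj₁; inj₂; [_,_]′; swap)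
open import Data.Unit using (⊤; tt)
open import Data.Vec using ([]; _∷_; here; there; lookup; tabulate)
open import Data.Vec.Properties using (lookup∘tabulate; []=⇒lookup; lookup⇒[]=)
open import Function using (_∘_; id; case_of_)
open import Induction.WellFounded using (Acc; acc; WellFounded)
open import Relation.Binary.PropositionalEquality
open import Relation.Nullary using (Dec; does; yes; no; ¬_; ¬?; _×-dec_; _⊎-dec_; contradiction)

open ParityGame

-- With `O(lg d)` set variables, neither the residual games of suspended levels nor the subgame
-- below a level can be kept as sets during a recursive call. The marks suffice because the residual
-- games are nested: overwriting the marks on one game is undone by marking it again with the outer
-- depth. The subgame below a level is a greatest trap, hence unique, and is computed a second time
-- on the way up. The suspended level is the next non-empty one above and is found by scanning.
--
-- It only separates the small dominions of the two players (`Approx`), a property that restricts to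
-- traps and leaves open which parity the next level has.
--
-- Up to a constant, the recurrence is bounded by `2 ^ (k / y) * (4 * y) ^ L` for every block length
-- `y`. Length 1 gives the polynomial bound, a length of order `d / lg n` the quasi-polynomial one.
-- For `d` far beyond polynomial in `n`, the `d` steps of a scan alone exceed a fixed power of `n`;
-- then one block covers the at most `n` non-empty levels, and the scan is paid for by the exponent
-- `2 lg (d / lg n)`.

⁻¹-involutive : ∀ p → p ⁻¹ ⁻¹ ≡ p
⁻¹-involutive 0ℙ = refl
⁻¹-involutive 1ℙ = refl

p≢p⁻¹ : ∀ {p} → p ≢ p ⁻¹
p≢p⁻¹ {0ℙ} ()
p≢p⁻¹ {1ℙ} ()

sameOrOpponent : ∀ p q → q ≡ p ⊎ q ≡ p ⁻¹
sameOrOpponent 0ℙ 0ℙ = inj₁ refl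
sameOrOpponent 0ℙ 1ℙ = inj₂ refl
sameOrOpponent 1ℙ 0ℙ = inj₂ refl
sameOrOpponent 1ℙ 1ℙ = inj₁ refl

-- Finite subsets and saturation

─⇒∉ : ∀ {n} (p q : Subset n) {x} → x ∈ p ─ q → x ∉ q
─⇒∉ (_ ∷ p) (_ ∷ q) (there x∈p─q) (there x∈q) = ─⇒∉ p q x∈p─q x∈q
─⇒∉ (_ ∷ p) (_ ∷ q) () here

∈∅-elim : ∀ {n} {x : Fin n} {A : Set} → x ∈ ∅ → A
∈∅-elim x∈∅ = contradiction x∈∅ ∉⊥

module _ {n} {p q : Subset n} where

  ─⁺ : ∀ {x} → x ∈ p → x ∉ q → x ∈ p ─ q
  ─⁺ = x∈p∧x∉q⇒x∈p─q

  ∩⁻ˡ : ∀ {x} → x ∈ p ∩ q → x ∈ p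
  ∩⁻ˡ = proj₁ ∘ x∈p∩q⁻ p q

  ∩⁻ʳ : ∀ {x} → x ∈ p ∩ q → x ∈ q
  ∩⁻ʳ = proj₂ ∘ x∈p∩q⁻ p q

  ∩⁺ : ∀ {x} → x ∈ p → x ∈ q → x ∈ p ∩ q
  ∩⁺ x∈p x∈q = x∈p∩q⁺ (x∈p , x∈q)

  ∪⁺ˡ : ∀ {x} → x ∈ p → x ∈ p ∪ q
  ∪⁺ˡ = x∈p∪q⁺ ∘ inj₁

  ∪⁺ʳ : ∀ {x} → x ∈ q → x ∈ p ∪ q
  ∪⁺ʳ = x∈p∪q⁺ ∘ inj₂

  ∪⁻ : ∀ {x} → x ∈ p ∪ q → x ∈ p ⊎ x ∈ q
  ∪⁻ = x∈p∪q⁻ p q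

∪⁅⁆⁻ : ∀ {n} {p : Subset n} {x y} → x ∈ p ∪ ⁅ y ⁆ → x ∈ p ⊎ x ≡ y
∪⁅⁆⁻ {y = y} x∈ with ∪⁻ x∈
... | inj₁ x∈p = inj₁ x∈p
... | inj₂ x∈y = inj₂ (x∈⁅y⁆⇒x≡y y x∈y)

∣p─q∣+∣q∣≤∣p∣ : ∀ {n} {p q : Subset n} → q ⊆ p → ∣ p ─ q ∣ + ∣ q ∣ ≤ ∣ p ∣
∣p─q∣+∣q∣≤∣p∣ {p = []}    {[]}          q⊆p = z≤n
∣p─q∣+∣q∣≤∣p∣ {p = false ∷ p} {true ∷ q}  q⊆p = case q⊆p here of λ ()
∣p─q∣+∣q∣≤∣p∣ {p = true ∷ p} {true ∷ q}  q⊆p =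
  subst (_≤ suc ∣ p ∣) (sym (+-suc ∣ p ─ q ∣ ∣ q ∣)) (s≤s (∣p─q∣+∣q∣≤∣p∣ {p = p} {q} (drop-∷-⊆ q⊆p)))
∣p─q∣+∣q∣≤∣p∣ {p = true ∷ p} {false ∷ q} q⊆p = s≤s (∣p─q∣+∣q∣≤∣p∣ {p = p} {q} (drop-∷-⊆ q⊆p))
∣p─q∣+∣q∣≤∣p∣ {p = false ∷ p} {false ∷ q} q⊆p = ∣p─q∣+∣q∣≤∣p∣ {p = p} {q} (drop-∷-⊆ q⊆p)

∣p─q∣<∣p─r∣ : ∀ {n} {p q r : Subset n} → r ⊆ q → ∀ {x} → x ∈ p → x ∈ q → x ∉ r →
              ∣ p ─ q ∣ < ∣ p ─ r ∣
∣p─q∣<∣p─r∣ {p = p} {q} {r} r⊆q {x} x∈p x∈q x∉r = p⊂q⇒∣p∣<∣q∣ {p = p ─ q} {p ─ r}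
  ( (λ y∈ → ─⁺ (p─q⊆p p q y∈) (─⇒∉ p q y∈ ∘ r⊆q))
  , x , ─⁺ x∈p x∉r , λ x∈p─q → ─⇒∉ p q x∈p─q x∈q)

-- The fixpoint construction behind both attractors and backward reachability. The invariant `I`
-- carries the evidence for the collected vertices, a strategy or a witness walk, so that it grows
-- along with the set; every addition shrinks the complement.
saturate : ∀ {n} (I : Subset n → Set) (P : Subset n → Fin n → Set) (P? : ∀ S v → Dec (P S v)) →
           (∀ S v → I S → v ∉ S → P S v → I (S ∪ ⁅ v ⁆)) →
           ∀ S → I S → ∃ λ S′ → S ⊆ S′ × I S′ × (∀ v → v ∉ S′ → ¬ P S′ v)
saturate {n} I P P? grow S IS = go _ S IS ≤-refl
  where
  go : ∀ m S → I S → ∣ full ─ S ∣ ≤ m →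
       ∃ λ S′ → S ⊆ S′ × I S′ × (∀ v → v ∉ S′ → ¬ P S′ v)
  go m S IS ∣∁S∣≤m with any? (λ v → ¬? (v ∈? S) ×-dec P? S v)
  ... | no ¬∃ = S , id , IS , λ v v∉S Pv → ¬∃ (v , v∉S , Pv)
  go zero S IS ∣∁S∣≤m | yes (v , v∉S , Pv) = contradiction
    (≤-trans (∣p─q∣<∣p─r∣ {p = full} {S ∪ ⁅ v ⁆} {S} ∪⁺ˡ ∈⊤ (∪⁺ʳ (x∈⁅x⁆ v)) v∉S) ∣∁S∣≤m) λ ()
  go (suc m) S IS ∣∁S∣≤m | yes (v , v∉S , Pv) =
    let S′ , S⊆ , rest = go m (S ∪ ⁅ v ⁆) (grow S v IS v∉S Pv) (≤-pred
          (≤-trans (∣p─q∣<∣p─r∣ {p = full} {S ∪ ⁅ v ⁆} {S} ∪⁺ˡ ∈⊤ (∪⁺ʳ (x∈⁅x⁆ v)) v∉S) ∣∁S∣≤m))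
    in S′ , S⊆ ∘ ∪⁺ˡ , rest

∈-comprehension⁺ : ∀ {n} {f : Fin n → Bool} {v} → f v ≡ true → v ∈ tabulate f
∈-comprehension⁺ {f = f} {v} fv = lookup⇒[]= v _ (trans (lookup∘tabulate f v) fv)

∈-comprehension⁻ : ∀ {n} {f : Fin n → Bool} {v} → v ∈ tabulate f → f v ≡ true
∈-comprehension⁻ {f = f} {v} v∈ = trans (sym (lookup∘tabulate f v)) ([]=⇒lookup v∈)

does⁺ : ∀ {A : Set} (A? : Dec A) → A → does A? ≡ true
does⁺ (yes _) _ = refl
does⁺ (no ¬a) a = contradiction a ¬a

does⁻ : ∀ {A : Set} (A? : Dec A) → does A? ≡ true → A
does⁻ (yes a) _ = a

does-no : ∀ {A : Set} (A? : Dec A) → ¬ A → does A? ≡ false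
does-no (yes a) ¬a = contradiction a ¬a
does-no (no _)  _  = refl

choose : ∀ {A B : Set} → Dec A → B → B → B
choose (yes _) x _ = x
choose (no _)  _ y = y

-- Dominions of subgames

module Game (G : ParityGame) where

  ∈-withPriority⁺ : ∀ {k v} → π G v ≡ k → v ∈ withPriority G k
  ∈-withPriority⁺ {k} {v} πv = ∈-comprehension⁺ (does⁺ (π G v ≟ⁿ k) πv)

  ∈-withPriority⁻ : ∀ {k v} → v ∈ withPriority G k → π G v ≡ k
  ∈-withPriority⁻ {k} {v} v∈ = does⁻ (π G v ≟ⁿ k) (∈-comprehension⁻ v∈)

  owned-by : ∀ p v → owner G v ≡ p ⊎ owner G v ≡ p ⁻¹
  owned-by p v = sameOrOpponent p (owner G v)

  Subgame : VertexSet G → Set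
  Subgame Z = ∀ {v} → v ∈ Z → ∃ λ w → w ∈ succs G v × w ∈ Z

  -- The index is the player who cannot get out. Such sets are what is left of `Z` once an attractor
  -- of `p` has been removed.
  record Trap (p : Player) (Z Y : VertexSet G) : Set where
    field
      sub   : Y ⊆ Z
      stuck : ∀ {v w} → v ∈ Y → owner G v ≡ p → w ∈ succs G v → w ∈ Z → w ∈ Y
      stay  : ∀ {v} → v ∈ Y → owner G v ≡ p ⁻¹ → ∃ λ w → w ∈ succs G v × w ∈ Y

  trap-refl : ∀ {p Z} → Subgame Z → Trap p Z Z
  trap-refl sg = record { sub = id ; stuck = λ _ _ _ w∈ → w∈ ; stay = λ v∈ _ → sg v∈ }

  trap-trans : ∀ {p Z Y X} → Trap p Z Y → Trap p Y X → Trap p Z X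
  trap-trans t t′ = record
    { sub   = Trap.sub t ∘ Trap.sub t′
    ; stuck = λ v∈ o w∈s w∈ → Trap.stuck t′ v∈ o w∈s (Trap.stuck t (Trap.sub t′ v∈) o w∈s w∈)
    ; stay  = Trap.stay t′ }

  trap-subgame : ∀ {p Z Y} → Subgame Z → Trap p Z Y → Subgame Y
  trap-subgame {p} sg t {v} v∈ with owned-by p v
  ... | inj₁ o = let w , w∈s , w∈Z = sg (Trap.sub t v∈) in w , w∈s , Trap.stuck t v∈ o w∈s w∈Z
  ... | inj₂ o = Trap.stay t v∈ o

  source : ∀ {D σ u v} → Walk G D σ u v → u ∈ D
  source (edge u∈ _ _) = u∈
  source (cons u∈ _ _) = u∈

  target : ∀ {D σ u v} → Walk G D σ u v → v ∈ D
  target (edge _ v∈ _) = v∈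
  target (cons _ _ c)  = target c

  _++_ : ∀ {D σ u v w} → Walk G D σ u v → Walk G D σ v w → Walk G D σ u w
  edge u∈ _ e ++ c′ = cons u∈ e c′
  cons u∈ e c ++ c′ = cons u∈ e (c ++ c′)

  π-source≤highest : ∀ {D σ u v} (c : Walk G D σ u v) → π G u ≤ highest G c
  π-source≤highest (edge _ _ _) = m≤m⊔n _ _
  π-source≤highest (cons _ _ _) = m≤m⊔n _ _

  highest≤ : ∀ {D σ u v h} → (∀ {v} → v ∈ D → π G v ≤ h) → (c : Walk G D σ u v) → highest G c ≤ h
  highest≤ π≤h (edge u∈ v∈ _) = ⊔-lub (π≤h u∈) (π≤h v∈)
  highest≤ π≤h (cons u∈ _ c)  = ⊔-lub (π≤h u∈) (highest≤ π≤h c)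

  Same : ∀ {D σ D′ σ′ u v} → Walk G D σ u v → Set
  Same {D′ = D′} {σ′} {u} {v} c = ∃ λ (c′ : Walk G D′ σ′ u v) → highest G c′ ≡ highest G c

  map-walk : ∀ {D σ D′ σ′ u v} → D ⊆ D′ →
             (∀ {u w} → u ∈ D → w ∈ D → w ∈ σ u → w ∈ σ′ u) →
             (c : Walk G D σ u v) → Same {D′ = D′} {σ′} c
  map-walk D⊆ σ⊆ (edge u∈ v∈ e) = edge (D⊆ u∈) (D⊆ v∈) (σ⊆ u∈ v∈ e) , refl
  map-walk D⊆ σ⊆ (cons u∈ e c) =
    let c′ , eq = map-walk D⊆ σ⊆ c
    in cons (D⊆ u∈) (σ⊆ u∈ (source c) e) c′ , cong (_ ⊔_) eq

  -- A winning strategy of p on D inside the subgame Z, where plays may also leave D into E.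
  record WinsOr (p : Player) (Z E D : VertexSet G) : Set where
    field
      σ    : Vertex G → VertexSet G
      sub  : D ⊆ Z
      edges : ∀ {v w} → v ∈ D → w ∈ σ v → w ∈ succs G v
      exits : ∀ {v w} → v ∈ D → w ∈ σ v → w ∈ D ⊎ w ∈ E
      own  : ∀ {v} → v ∈ D → owner G v ≡ p → Nonempty (σ v)
      opp  : ∀ {v w} → v ∈ D → owner G v ≡ p ⁻¹ → w ∈ succs G v → w ∈ Z → w ∈ σ v
      win  : ∀ {v} (c : Walk G D σ v v) → parity (highest G c) ≡ p

  open WinsOr

  Wins : Player → VertexSet G → VertexSet G → Set
  Wins p Z D = WinsOr p Z ∅ D

  closed : ∀ {p Z D} (x : Wins p Z D) → ∀ {v w} → v ∈ D → w ∈ σ x v → w ∈ D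
  closed x v∈ w∈ with exits x v∈ w∈
  ... | inj₁ w∈D = w∈D
  ... | inj₂ w∈∅ = ∈∅-elim w∈∅

  wins-trap : ∀ {p Z D} → Wins p Z D → Trap (p ⁻¹) Z D
  wins-trap {p} x = record
    { sub   = sub x
    ; stuck = λ v∈ o w∈s w∈Z → closed x v∈ (opp x v∈ o w∈s w∈Z)
    ; stay  = λ v∈ o → let w , w∈σ = own x v∈ (trans o (⁻¹-involutive p))
                       in w , edges x v∈ w∈σ , closed x v∈ w∈σ }

  wins-trap⁻¹ : ∀ {p Z D} → Wins (p ⁻¹) Z D → Trap p Z D
  wins-trap⁻¹ {p} {Z} {D} x = subst (λ r → Trap r Z D) (⁻¹-involutive p) (wins-trap x)

  wins-shrink : ∀ {p Z Z′ D} → Wins p Z D → D ⊆ Z′ → Z′ ⊆ Z → Wins p Z′ D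
  wins-shrink x D⊆ Z′⊆ = record
    { σ = σ x ; sub = D⊆ ; edges = edges x ; exits = exits x ; own = own x
    ; opp = λ v∈ o w∈s w∈ → opp x v∈ o w∈s (Z′⊆ w∈) ; win = win x }

  wins-closed-part : ∀ {p Z D S} (x : Wins p Z D) → S ⊆ D →
                     (∀ {v w} → v ∈ S → w ∈ σ x v → w ∈ S) → Wins p Z S
  wins-closed-part x S⊆ cl = record
    { σ = σ x ; sub = sub x ∘ S⊆ ; edges = edges x ∘ S⊆ ; exits = λ v∈ w∈ → inj₁ (cl v∈ w∈)
    ; own = own x ∘ S⊆ ; opp = opp x ∘ S⊆
    ; win = λ c → let c′ , eq = map-walk S⊆ (λ _ _ e → e) c
                  in trans (cong parity (sym eq)) (win x c′) }

  -- The moves that the strategy chooses for `p` cannot leave a trap for `p`, and the opponent has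
  -- no more moves in `Y` than in `Z`; so cutting the strategy down to `Y` keeps it winning.
  wins-∩-trap : ∀ {p Z Y D} → Wins p Z D → Trap p Z Y → Wins p Y (D ∩ Y)
  wins-∩-trap {Y = Y} x t = record
    { σ     = λ v → σ x v ∩ Y
    ; sub   = ∩⁻ʳ
    ; edges = λ v∈ w∈ → edges x (∩⁻ˡ v∈) (∩⁻ˡ w∈)
    ; exits = λ v∈ w∈ → inj₁ (∩⁺ (closed x (∩⁻ˡ v∈) (∩⁻ˡ w∈)) (∩⁻ʳ w∈))
    ; own   = λ v∈ o → let w , w∈σ = own x (∩⁻ˡ v∈) o
                           w∈D = closed x (∩⁻ˡ v∈) w∈σ
                       in w , ∩⁺ w∈σ (Trap.stuck t (∩⁻ʳ v∈) o (edges x (∩⁻ˡ v∈) w∈σ) (sub x w∈D))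
    ; opp   = λ v∈ o w∈s w∈Y → ∩⁺ (opp x (∩⁻ˡ v∈) o w∈s (Trap.sub t w∈Y)) w∈Y
    ; win   = λ c → let c′ , eq = map-walk ∩⁻ˡ (λ _ _ e → ∩⁻ˡ e) c
                    in trans (cong parity (sym eq)) (win x c′) }

  -- The opponent's moves that exist in Z but not in Z′ are added to the strategy.
  wins-lift : ∀ {p Z Z′ E D} → Wins p Z′ D → Z′ ⊆ Z →
              (∀ {v w} → v ∈ D → owner G v ≡ p ⁻¹ → w ∈ succs G v → w ∈ Z → w ∈ Z′ ⊎ w ∈ E) →
              WinsOr p Z E D
  wins-lift {p} {Z} {Z′} {E} {D} x Z′⊆ out = record
    { σ = τ ; sub = Z′⊆ ∘ sub x
    ; edges = τ-edges ; exits = τ-exits ; own = τ-own ; opp = τ-opp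
    ; win = λ c → let c′ , eq = map-walk id τ-inside c in trans (cong parity (sym eq)) (win x c′) }
    where
    τ : Vertex G → VertexSet G
    τ v = choose (owner G v ≟ p) (σ x v) (succs G v ∩ Z)
    τ-edges : ∀ {v w} → v ∈ D → w ∈ τ v → w ∈ succs G v
    τ-edges {v} v∈ w∈ with owner G v ≟ p
    ... | yes _ = edges x v∈ w∈
    ... | no  _ = ∩⁻ˡ w∈
    ¬own : ∀ {v} → owner G v ≢ p → owner G v ≡ p ⁻¹
    ¬own {v} v≢p = [ (λ e → contradiction e v≢p) , id ]′ (owned-by p v)
    τ-exits : ∀ {v w} → v ∈ D → w ∈ τ v → w ∈ D ⊎ w ∈ E
    τ-exits {v} v∈ w∈ with owner G v ≟ p
    ... | yes _ = inj₁ (closed x v∈ w∈)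
    ... | no ¬o with out v∈ (¬own ¬o) (∩⁻ˡ w∈) (∩⁻ʳ w∈)
    ...   | inj₁ w∈Z′ = inj₁ (closed x v∈ (opp x v∈ (¬own ¬o) (∩⁻ˡ w∈) w∈Z′))
    ...   | inj₂ w∈E  = inj₂ w∈E
    τ-own : ∀ {v} → v ∈ D → owner G v ≡ p → Nonempty (τ v)
    τ-own {v} v∈ o with owner G v ≟ p
    ... | yes _ = own x v∈ o
    ... | no ¬o = contradiction o ¬o
    τ-opp : ∀ {v w} → v ∈ D → owner G v ≡ p ⁻¹ → w ∈ succs G v → w ∈ Z → w ∈ τ v
    τ-opp {v} v∈ o w∈s w∈Z with owner G v ≟ p
    ... | yes o′ = contradiction (trans (sym o′) o) p≢p⁻¹
    ... | no _ = ∩⁺ w∈s w∈Z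
    τ-inside : ∀ {u w} → u ∈ D → w ∈ D → w ∈ τ u → w ∈ σ x u
    τ-inside {u} u∈ w∈D w∈ with owner G u ≟ p
    ... | yes _ = w∈
    ... | no ¬o = opp x u∈ (¬own ¬o) (∩⁻ˡ w∈) (sub x w∈D)

  -- The opponent is confined to `Y`, so the larger game offers no further moves against the
  -- strategy.
  wins-trap-lift : ∀ {p Z Y D} → Wins p Y D → Trap (p ⁻¹) Z Y → Wins p Z D
  wins-trap-lift x t = wins-lift x (Trap.sub t) λ v∈ o w∈s w∈Z →
    inj₁ (Trap.stuck t (sub x v∈) o w∈s w∈Z)

  -- A cycle of the combined strategy cannot leave B once it has entered it.
  wins-compose : ∀ {p Z E B C} → WinsOr p Z E B → WinsOr p Z (B ∪ E) C →
                 (∀ {v} → v ∈ C → v ∉ B) → (∀ {v} → v ∈ C → v ∉ E) → WinsOr p Z E (B ∪ C)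
  wins-compose {p} {Z} {E} {B} {C} x y C∉B C∉E = record
    { σ = τ
    ; sub = λ v∈ → [ sub x , sub y ]′ (∪⁻ v∈)
    ; edges = λ v∈ → cases v∈ (λ v∈B e → edges x v∈B e) (λ v∈C e → edges y v∈C e)
    ; exits = λ v∈ → cases v∈
        (λ v∈B e → [ inj₁ ∘ ∪⁺ˡ , inj₂ ]′ (exits x v∈B e))
        (λ v∈C e → [ inj₁ ∘ ∪⁺ʳ , [ inj₁ ∘ ∪⁺ˡ , inj₂ ]′ ∘ ∪⁻ ]′ (exits y v∈C e))
    ; own = τ-own
    ; opp = τ-opp
    ; win = τ-win }
    where
    τ : Vertex G → VertexSet G
    τ v = choose (v ∈? B) (σ x v) (σ y v)
    cases : ∀ {v w} {P : Set} → v ∈ B ∪ C → (v ∈ B → w ∈ σ x v → P) → (v ∈ C → w ∈ σ y v → P) →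
            w ∈ τ v → P
    cases {v} v∈ f g with v ∈? B
    ... | yes v∈B = f v∈B
    ... | no v∉B = g ([ (λ v∈B → contradiction v∈B v∉B) , id ]′ (∪⁻ v∈))
    τ-own : ∀ {v} → v ∈ B ∪ C → owner G v ≡ p → Nonempty (τ v)
    τ-own {v} v∈ with v ∈? B
    ... | yes v∈B = own x v∈B
    ... | no v∉B = own y ([ (λ v∈B → contradiction v∈B v∉B) , id ]′ (∪⁻ v∈))
    τ-opp : ∀ {v w} → v ∈ B ∪ C → owner G v ≡ p ⁻¹ → w ∈ succs G v → w ∈ Z → w ∈ τ v
    τ-opp {v} v∈ with v ∈? B
    ... | yes v∈B = opp x v∈B
    ... | no v∉B = opp y ([ (λ v∈B → contradiction v∈B v∉B) , id ]′ (∪⁻ v∈))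
    edgeB : ∀ {u v} → u ∈ B → v ∈ B ∪ C → v ∈ τ u → v ∈ B × v ∈ σ x u
    edgeB u∈B v∈ = cases (∪⁺ˡ u∈B)
      (λ u∈ e → [ id , (λ v∈E → [ id , (λ v∈C → contradiction v∈E (C∉E v∈C)) ]′ (∪⁻ v∈)) ]′
                (exits x u∈B e) , e)
      (λ u∈C → contradiction u∈B (C∉B u∈C))
    stayB : ∀ {u v} (c : Walk G (B ∪ C) τ u v) → u ∈ B → Same {D′ = B} {σ x} c
    stayB (edge _ v∈ e) u∈B = let v∈B , e′ = edgeB u∈B v∈ e in edge u∈B v∈B e′ , refl
    stayB (cons _ e c) u∈B =
      let v∈B , e′ = edgeB u∈B (source c) e
          c′ , eq = stayB c v∈B
      in cons u∈B e′ c′ , cong (_ ⊔_) eq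
    edgeC : ∀ {u v} → u ∈ B ∪ C → u ∉ B → v ∈ τ u → u ∈ C × v ∈ σ y u
    edgeC u∈ u∉B = cases u∈ (λ u∈B → contradiction u∈B u∉B) _,_
    -- A walk that ends outside `B` has never visited `B`, since `stayB` would place its end in `B`.
    stayC : ∀ {u v} (c : Walk G (B ∪ C) τ u v) → v ∉ B → Same {D′ = C} {σ y} c
    stayC c@(edge u∈ v∈ e) v∉B =
      let u∈C , e′ = edgeC u∈ (λ u∈B → v∉B (target (proj₁ (stayB c u∈B)))) e
      in edge u∈C ([ (λ v∈B → contradiction v∈B v∉B) , id ]′ (∪⁻ v∈)) e′ , refl
    stayC c₀@(cons u∈ e c) v∉B =
      let u∈C , e′ = edgeC u∈ (λ u∈B → v∉B (target (proj₁ (stayB c₀ u∈B)))) e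
          c′ , eq = stayC c v∉B
      in cons u∈C e′ c′ , cong (_ ⊔_) eq
    τ-win : ∀ {v} (c : Walk G (B ∪ C) τ v v) → parity (highest G c) ≡ p
    τ-win {v} c with v ∈? B
    ... | yes v∈B = let c′ , eq = stayB c v∈B in trans (cong parity (sym eq)) (win x c′)
    ... | no v∉B = let c′ , eq = stayC c v∉B in trans (cong parity (sym eq)) (win y c′)

  -- Separating small dominions

  -- Precision `a` concerns dominions of `p`, precision `b` those of the opponent. Vertices outside
  -- all small dominions may end up on either side. The trap condition makes the output a subgame
  -- again and allows dominions of the opponent to be restricted to it.
  record Approx (p : Player) (a b : ℕ) (Z Z′ : VertexSet G) : Set where
    field
      trap  : Trap (p ⁻¹) Z Z′
      keeps : ∀ {D} → Wins p Z D → ∣ D ∣ < 2 ^ a → D ⊆ Z′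
      drops : ∀ {D} → Wins (p ⁻¹) Z D → ∣ D ∣ < 2 ^ b → ∀ {v} → v ∈ D → v ∉ Z′

  -- The interface between a level and the one below, independent of the parity of the latter: `U`
  -- is the part to be removed, whether it was the output of the lower call or the complement of
  -- that output.
  record Separates (p : Player) (a b : ℕ) (H U : VertexSet G) : Set where
    field
      inside  : U ⊆ H
      avoids  : ∀ {D} → Wins p H D → ∣ D ∣ < 2 ^ a → ∀ {v} → v ∈ D → v ∉ U
      catches : ∀ {D} → Wins (p ⁻¹) H D → ∣ D ∣ < 2 ^ b → D ⊆ U

  -- For `Y₀ = Z ─ T` this is `Z` without the attractor of `p` to `T`. The characterisation by
  -- maximality is what a greatest-fixpoint iteration yields, and it makes the set unique.
  record MaxTrap (p : Player) (Z Y₀ Y : VertexSet G) : Set where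
    field
      trap     : Trap p Z Y
      below    : Y ⊆ Y₀
      greatest : ∀ {Y′} → Trap p Z Y′ → Y′ ⊆ Y₀ → Y′ ⊆ Y

  -- The part D ∖ S of a dominion that cannot reach the priority h, together with the
  -- dead ends of D ∖ S, extends a closed part S; if D ∖ S had neither, then the relation
  -- "reachable" would have no minimal element.
  module Peel {p : Player} {Z D : VertexSet G} {h : ℕ} (x : Wins p Z D) (p≢h : parity h ≢ p)
              (π≤h : ∀ {v} → v ∈ D → π G v ≤ h) where

    module _ (S : VertexSet G) where

      Q : VertexSet G
      Q = D ─ S

      Q⁻ : ∀ {v} → v ∈ Q → v ∈ D
      Q⁻ = p─q⊆p D S

      Reaching : VertexSet G → Set
      Reaching R = ∀ {v} → v ∈ R → π G v ≡ h ⊎ (∃ λ u → π G u ≡ h × Walk G Q (σ x) v u)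

      _⊏_ : Vertex G → Vertex G → Set
      u ⊏ v = π G u ≡ h × Walk G Q (σ x) v u

      -- A walk from `u` to itself follows the winning strategy, yet its highest priority would be
      -- `h`, which has the wrong parity.
      ⊏-irrefl : ∀ {u} → ¬ (u ⊏ u)
      ⊏-irrefl (πu , c) = p≢h (begin
          parity h              ≡⟨ cong parity (≤-antisym (≤-trans (≤-reflexive (sym πu)) (π-source≤highest c))
                                                          (highest≤ (π≤h ∘ Q⁻) c)) ⟩
          parity (highest G c)  ≡⟨ cong parity eq ⟨
          parity (highest G c′) ≡⟨ win x c′ ⟩
          p                     ∎)
        where
        open ≡-Reasoning
        lifted = map-walk {D′ = D} {σ x} Q⁻ (λ _ _ e → e) c
        c′ = proj₁ lifted
        eq = proj₂ lifted

      ⊏-wellFounded : WellFounded _⊏_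
      ⊏-wellFounded = spo-wellFounded (record
        { isEquivalence = isEquivalence
        ; irrefl = λ { refl → ⊏-irrefl }
        ; trans = λ { (πu , c) (_ , c′) → πu , (c′ ++ c) }
        ; <-resp-≈ = (λ { refl → id }) , (λ { refl → id }) })

      -- Moving on from one vertex of priority `h` to the next descends in `⊏`. The descent must
      -- stop, and it can only stop where no successor remains in `Q`.
      dead-end : (∀ {v} → v ∈ Q → π G v ≡ h ⊎ (∃ λ u → π G u ≡ h × Walk G Q (σ x) v u)) →
                 ∀ {v} → v ∈ Q → ∃ λ u → u ∈ Q × ¬ Nonempty (σ x u ∩ Q)
      dead-end reach {v} v∈ = go v∈ (⊏-wellFounded v)
        where
        go : ∀ {v} → v ∈ Q → Acc _⊏_ v → ∃ λ u → u ∈ Q × ¬ Nonempty (σ x u ∩ Q)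
        go {v} v∈ (acc rec) with nonempty? (σ x v ∩ Q)
        ... | no ¬succ = v , v∈ , ¬succ
        ... | yes (w , w∈) with reach (∩⁻ʳ w∈)
        ...   | inj₁ πw = go (∩⁻ʳ w∈) (rec (πw , edge v∈ (∩⁻ʳ w∈) (∩⁻ˡ w∈)))
        ...   | inj₂ (u , πu , c) = go (target c) (rec (πu , cons v∈ (∩⁻ˡ w∈) c))

      private
        -- Backward reachability inside `Q` from the vertices of priority `h`; the invariant keeps a
        -- witness walk for every vertex that is added.
        saturated = saturate (λ R → R ⊆ Q × Reaching R) (λ R v → v ∈ Q × Nonempty (σ x v ∩ R))
          (λ R v → v ∈? Q ×-dec nonempty? (σ x v ∩ R))
          (λ { R v (R⊆Q , reach) _ (v∈Q , w , w∈) →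
               (λ u∈ → [ R⊆Q , (λ { refl → v∈Q }) ]′ (∪⁅⁆⁻ u∈))
             , (λ u∈ → [ reach
                       , (λ { refl → case reach (∩⁻ʳ w∈) of λ
                            { (inj₁ πw) → inj₂ (w , πw , edge v∈Q (R⊆Q (∩⁻ʳ w∈)) (∩⁻ˡ w∈))
                            ; (inj₂ (u , πu , c)) → inj₂ (u , πu , cons v∈Q (∩⁻ˡ w∈) c) } })
                       ]′ (∪⁅⁆⁻ u∈)) })
          (Q ∩ withPriority G h) (∩⁻ˡ , λ v∈ → inj₁ (∈-withPriority⁻ (∩⁻ʳ v∈)))

      R : VertexSet G
      R = proj₁ saturated

      R-reaching : Reaching R
      R-reaching = proj₂ (proj₁ (proj₂ (proj₂ saturated)))

      D′ : VertexSet G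
      D′ = Q ─ R

      D′-avoids-h : ∀ {v} → v ∈ D′ → π G v ≢ h
      D′-avoids-h v∈ πv = ─⇒∉ Q R v∈
        (proj₁ (proj₂ saturated) (∩⁺ (p─q⊆p Q R v∈) (∈-withPriority⁺ πv)))

      D′-closed : ∀ {v w} → v ∈ D′ → w ∈ σ x v → w ∈ S ∪ D′
      D′-closed {v} {w} v∈ w∈σ with w ∈? S
      ... | yes w∈S = ∪⁺ˡ w∈S
      ... | no w∉S = ∪⁺ʳ (─⁺ w∈Q λ w∈R →
          proj₂ (proj₂ (proj₂ saturated)) v (─⇒∉ Q R v∈) (p─q⊆p Q R v∈ , w , ∩⁺ w∈σ w∈R))
        where
        w∈Q : w ∈ Q
        w∈Q = ─⁺ (closed x (Q⁻ (p─q⊆p Q R v∈)) w∈σ) w∉S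

      peel : Nonempty Q → Nonempty D′ ⊎ (∃ λ u → u ∈ Q × (∀ {w} → w ∈ σ x u → w ∈ S))
      peel (v , v∈) with nonempty? D′
      ... | yes ne = inj₁ ne
      ... | no ¬ne =
        let u , u∈ , dead = dead-end
              (λ {w} w∈ → R-reaching (case w ∈? R of λ
                { (yes w∈R) → w∈R
                ; (no w∉R) → contradiction (w , ─⁺ w∈ w∉R) ¬ne }))
              v∈
        in inj₂ (u , u∈ , λ {w} w∈ → case w ∈? S of λ
             { (yes w∈S) → w∈S
             ; (no w∉S) → contradiction
                 (w , ∩⁺ w∈ (─⁺ (closed x (Q⁻ u∈) w∈) w∉S)) dead })

  -- The induction step of the correctness proof, on sets alone: a level of parity `p` raises the
  -- opponent's precision from `b` to `suc b`. The middle call already runs at `suc b`, because a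
  -- single peeled part of a dominion may be almost as large as the dominion.
  module _ {p : Player} {a b h : ℕ} {Z Z₁ H U Z₂ Z₃ : VertexSet G}
           (sg : Subgame Z) (π≤h : ∀ {v} → v ∈ Z → π G v ≤ h) (h≡p : parity h ≡ p)
           (first  : Approx p a b Z Z₁)
           (low    : MaxTrap p Z₁ (Z₁ ─ withPriority G h) H)
           (middle : Separates p a (suc b) H U)
           (rest   : MaxTrap (p ⁻¹) Z₁ (Z₁ ─ U) Z₂)
           (last   : Approx p a b Z₂ Z₃) where

    private
      module A₁ = Approx first
      module A₃ = Approx last
      module H  = MaxTrap low
      module U  = Separates middle
      module Z₂ = MaxTrap rest

      trap₂ : Trap (p ⁻¹) Z Z₂
      trap₂ = trap-trans A₁.trap Z₂.trap

      -- After the first half, `D ∩ H` is a small dominion of `p` in `H` and therefore misses `U`.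
      -- So `D` is a trap for the opponent inside `Z₁ ─ U` and lies in the greatest one, `Z₂`.
      keeps : ∀ {D} → Wins p Z D → ∣ D ∣ < 2 ^ a → D ⊆ Z₃
      keeps {D} x ∣D∣ = A₃.keeps (wins-shrink x D⊆Z₂ (Trap.sub trap₂)) ∣D∣
        where
        D⊆Z₁ : D ⊆ Z₁
        D⊆Z₁ = A₁.keeps x ∣D∣
        x₁ : Wins p Z₁ D
        x₁ = wins-shrink x D⊆Z₁ (Trap.sub A₁.trap)
        D∩H : Wins p H (D ∩ H)
        D∩H = wins-∩-trap x₁ H.trap
        D⊆Z₂ : D ⊆ Z₂
        D⊆Z₂ = Z₂.greatest (wins-trap x₁) λ v∈D → ─⁺ (D⊆Z₁ v∈D) λ v∈U →
          U.avoids D∩H (≤-<-trans (∣p∩q∣≤∣p∣ D H) ∣D∣) (∩⁺ v∈D (U.inside v∈U)) v∈U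

      module Drop {D} (x : Wins (p ⁻¹) Z D) (∣D∣ : ∣ D ∣ < 2 ^ suc b) where

        open Peel {h = h} x (λ h≡q → p≢p⁻¹ (trans (sym h≡p) h≡q)) (λ v∈ → π≤h (sub x v∈))

        Closed : VertexSet G → Set
        Closed S = S ⊆ D × (∀ {v w} → v ∈ S → w ∈ σ x v → w ∈ S)

        Avoids : VertexSet G → VertexSet G → Set
        Avoids S Y = ∀ {v} → v ∈ S → v ∉ Y

        small-avoids : ∀ {S} → Closed S → ∣ S ∣ < 2 ^ b → Avoids S Z₁
        small-avoids (S⊆D , cl) ∣S∣ = A₁.drops (wins-closed-part x S⊆D cl) ∣S∣

        -- In `Z₁` the vertex `u` would have a `σ`-successor inside `Z₁`: if `p` owns it because
        -- `Z₁` is a subgame, and otherwise because the opponent cannot leave `Z₁`. All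
        -- `σ`-successors lie in `S`, which misses `Z₁`.
        dead-end-avoids : ∀ {S u} → Avoids S Z₁ → u ∈ D → (∀ {w} → w ∈ σ x u → w ∈ S) → u ∉ Z₁
        dead-end-avoids {u = u} S∉ u∈D ⊆S u∈Z₁ with owned-by p u
        ... | inj₁ o = let w , w∈s , w∈Z₁ = trap-subgame sg A₁.trap u∈Z₁
                       in S∉ (⊆S (opp x u∈D (trans o (sym (⁻¹-involutive p))) w∈s (Trap.sub A₁.trap w∈Z₁))) w∈Z₁
        ... | inj₂ o = let w , w∈σ = own x u∈D o
                       in S∉ (⊆S w∈σ) (Trap.stuck A₁.trap u∈Z₁ o (edges x u∈D w∈σ) (sub x (closed x u∈D w∈σ)))

        -- Inside `Z₁` only vertices of `D′ S` are left of the enlarged part, and none of them has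
        -- priority `h`. It is thus a trap without `h`, contained in the greatest one `H`, and
        -- caught there by `U`.
        low-avoids : ∀ S → Closed S → Avoids S Z₁ → Closed (S ∪ D′ S) → Avoids (S ∪ D′ S) Z₂
        low-avoids S (S⊆D , _) S∉ (S′⊆D , cl) {v} v∈S′ v∈Z₂ =
          proj₂ (x∈p─q Z₁ U (Z₂.below v∈Z₂)) (U.catches y∩H ∣S∩∣ (∩⁺ v∈S′ v∈Z₁))
          where
          x∈p─q : ∀ (p q : VertexSet G) → v ∈ p ─ q → v ∈ p × v ∉ q
          x∈p─q p q v∈ = p─q⊆p p q v∈ , ─⇒∉ p q v∈
          S′ = S ∪ D′ S
          v∈Z₁ : v ∈ Z₁
          v∈Z₁ = Trap.sub Z₂.trap v∈Z₂
          y : Wins (p ⁻¹) Z₁ (S′ ∩ Z₁)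
          y = wins-∩-trap (wins-closed-part x S′⊆D cl) A₁.trap
          ⊆H : S′ ∩ Z₁ ⊆ H
          ⊆H = H.greatest (wins-trap⁻¹ y) λ u∈ → ─⁺ (∩⁻ʳ u∈) λ u∈h →
            [ (λ u∈S → S∉ u∈S (∩⁻ʳ u∈)) , (λ u∈D′ → D′-avoids-h S u∈D′ (∈-withPriority⁻ u∈h)) ]′ (∪⁻ (∩⁻ˡ u∈))
          y∩H : Wins (p ⁻¹) H (S′ ∩ Z₁)
          y∩H = wins-shrink y ⊆H (Trap.sub H.trap)
          ∣S∩∣ : ∣ S′ ∩ Z₁ ∣ < 2 ^ suc b
          ∣S∩∣ = ≤-<-trans (≤-trans (∣p∩q∣≤∣p∣ S′ Z₁) (p⊆q⇒∣p∣≤∣q∣ S′⊆D)) ∣D∣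

        remainder-small : ∀ {S} → S ⊆ D → 2 ^ b ≤ ∣ S ∣ → ∣ D ─ S ∣ < 2 ^ b
        remainder-small {S} S⊆D 2^b≤ = +-cancelʳ-< (2 ^ b) ∣ D ─ S ∣ (2 ^ b) (begin-strict
          ∣ D ─ S ∣ + 2 ^ b   ≤⟨ +-monoʳ-≤ ∣ D ─ S ∣ 2^b≤ ⟩
          ∣ D ─ S ∣ + ∣ S ∣   ≤⟨ ∣p─q∣+∣q∣≤∣p∣ {p = D} {S} S⊆D ⟩
          ∣ D ∣               <⟨ ∣D∣ ⟩
          2 ^ b + (2 ^ b + 0) ≡⟨ cong (2 ^ b +_) (+-identityʳ (2 ^ b)) ⟩
          2 ^ b + 2 ^ b       ∎)
          where open ≤-Reasoning

        Half : Set
        Half = ∃ λ S → S ⊆ D × Avoids S Z₂ × ∣ D ─ S ∣ < 2 ^ b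

        enlarge : ∀ S → Closed S → ∣ S ∣ < 2 ^ b → Nonempty (D ─ S) →
                  ∃ λ S′ → Closed S′ × Avoids S′ Z₂ × ∣ D ─ S′ ∣ < ∣ D ─ S ∣
        enlarge S cS@(S⊆D , cl) ∣S∣ ne with peel S ne
        ... | inj₁ (v , v∈) =
            S ∪ D′ S , cS′ , low-avoids S cS (small-avoids cS ∣S∣) cS′
          , ∣p─q∣<∣p─r∣ {p = D} {S ∪ D′ S} {S} ∪⁺ˡ (Q⁻ S v∈Q) (∪⁺ʳ v∈) (─⇒∉ D S v∈Q)
          where
          v∈Q = p─q⊆p (Q S) (R S) v∈
          cS′ : Closed (S ∪ D′ S)
          cS′ = (λ w∈ → [ S⊆D , (λ w∈D′ → Q⁻ S (p─q⊆p (Q S) (R S) w∈D′)) ]′ (∪⁻ w∈))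
              , λ u∈ w∈σ → [ (λ u∈S → ∪⁺ˡ (cl u∈S w∈σ)) , (λ u∈D′ → D′-closed S u∈D′ w∈σ) ]′ (∪⁻ u∈)
        ... | inj₂ (u , u∈ , dead) =
            S ∪ ⁅ u ⁆
          , ( (λ w∈ → [ S⊆D , (λ { refl → Q⁻ S u∈ }) ]′ (∪⁅⁆⁻ w∈))
            , (λ v∈ w∈σ → [ (λ v∈S → ∪⁺ˡ (cl v∈S w∈σ)) , (λ { refl → ∪⁺ˡ (dead w∈σ) }) ]′ (∪⁅⁆⁻ v∈)))
          , (λ v∈ v∈Z₂ → [ (λ v∈S → S∉Z₁ v∈S (Trap.sub Z₂.trap v∈Z₂))
                         , (λ { refl → dead-end-avoids S∉Z₁ (Q⁻ S u∈) dead (Trap.sub Z₂.trap v∈Z₂) })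
                         ]′ (∪⁅⁆⁻ v∈))
          , ∣p─q∣<∣p─r∣ {p = D} {S ∪ ⁅ u ⁆} {S} ∪⁺ˡ (Q⁻ S u∈) (∪⁺ʳ (x∈⁅x⁆ u)) (─⇒∉ D S u∈)
          where
          S∉Z₁ : Avoids S Z₁
          S∉Z₁ = small-avoids cS ∣S∣

        -- A step of `enlarge` only ensures that the new part misses `Z₂`. If the part is smaller
        -- than `2 ^ b`, it is a dominion that the first half removes, so it misses `Z₁` as well and
        -- peeling can go on. Once it is larger, fewer than `2 ^ b` vertices of `D` remain.
        half : ∀ S → Closed S → ∣ S ∣ < 2 ^ b → Acc _<_ ∣ D ─ S ∣ → Half
        half S cS ∣S∣ (acc rec) with nonempty? (D ─ S)
        ... | no empty = S , proj₁ cS , (λ v∈S v∈Z₂ → small-avoids cS ∣S∣ v∈S (Trap.sub Z₂.trap v∈Z₂))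
                       , subst (_< 2 ^ b) (sym (trans (cong ∣_∣ (Empty-unique empty)) (∣⊥∣≡0 (size G)))) (m^n>0 2 b)
        ... | yes ne with enlarge S cS ∣S∣ ne
        ...   | S′ , cS′ , S′∉Z₂ , smaller with ∣ S′ ∣ <? 2 ^ b
        ...     | yes small = half S′ cS′ small (rec smaller)
        ...     | no big    = S′ , proj₁ cS′ , S′∉Z₂ , remainder-small (proj₁ cS′) (≮⇒≥ big)

        drop : ∀ {v} → v ∈ D → v ∉ Z₃
        drop v∈D v∈Z₃ =
          let S , S⊆D , S∉Z₂ , ∣D─S∣ = half ∅ (∈∅-elim , ∈∅-elim)
                (subst (_< 2 ^ b) (sym (∣⊥∣≡0 (size G))) (m^n>0 2 b)) (<-wellFounded _)
              D∩Z₂⊆D─S : D ∩ Z₂ ⊆ D ─ S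
              D∩Z₂⊆D─S u∈ = ─⁺ (∩⁻ˡ u∈) λ u∈S → S∉Z₂ u∈S (∩⁻ʳ u∈)
          in A₃.drops (wins-∩-trap x trap₂)
               (≤-<-trans (p⊆q⇒∣p∣≤∣q∣ D∩Z₂⊆D─S) ∣D─S∣) (∩⁺ v∈D (Trap.sub A₃.trap v∈Z₃)) v∈Z₃

    approx-step : Approx p a (suc b) Z Z₃
    approx-step = record
      { trap  = trap-trans trap₂ A₃.trap
      ; keeps = keeps
      ; drops = λ x ∣D∣ → Drop.drop x ∣D∣ }

  ∣D∣<1⇒v∉D : ∀ {D : VertexSet G} → ∣ D ∣ < 1 → ∀ {v} → v ∉ D
  ∣D∣<1⇒v∉D {D} ∣D∣ {v} v∈D = contradiction (≤-trans (≤-reflexive (sym (∣⁅x⁆∣≡1 v)))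
    (p⊆q⇒∣p∣≤∣q∣ {p = ⁅ v ⁆} {D} λ u∈ → subst (_∈ D) (sym (x∈⁅y⁆⇒x≡y v u∈)) v∈D)) (<⇒≱ ∣D∣)

  approx-zero : ∀ {p a Z} → Subgame Z → Approx p a 0 Z Z
  approx-zero sg = record
    { trap  = trap-refl sg
    ; keeps = λ x _ → sub x
    ; drops = λ x ∣D∣ v∈D _ → ∣D∣<1⇒v∉D ∣D∣ v∈D }

  -- For a lower level of the opponent's parity: the output is what the opponent keeps, so it is
  -- removed as it stands, and the precisions change places.
  separates-same : ∀ {p a b H R} → Approx (p ⁻¹) b a H R → Separates p a b H R
  separates-same {p} x = record
    { inside  = Trap.sub (Approx.trap x)
    ; avoids  = λ y → Approx.drops x (subst (λ r → Wins r _ _) (sym (⁻¹-involutive p)) y)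
    ; catches = Approx.keeps x }

  -- For a lower level of parity `p` again, which occurs when the levels in between are empty: the
  -- output is what `p` keeps, so the complement is removed.
  separates-rest : ∀ {p a b H R} → Approx p a b H R → Separates p a b H (H ─ R)
  separates-rest {H = H} {R} x = record
    { inside  = p─q⊆p H R
    ; avoids  = λ y ∣D∣ v∈D v∈U → ─⇒∉ H R v∈U (Approx.keeps x y ∣D∣ v∈D)
    ; catches = λ y ∣D∣ v∈D → ─⁺ (sub y v∈D) (Approx.drops x y ∣D∣ v∈D) }

  -- Attractors and positional determinacy

  wins-or-∅ : ∀ {p Z E} → WinsOr p Z E ∅
  wins-or-∅ = record
    { σ = λ _ → ∅ ; sub = ∈∅-elim ; edges = ∈∅-elim
    ; exits = ∈∅-elim ; own = ∈∅-elim
    ; opp = ∈∅-elim ; win = λ c → contradiction (source c) ∉⊥ }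

  Attractable : Player → (Z E D : VertexSet G) → Vertex G → Set
  Attractable p Z E D v = v ∈ Z × v ∉ E ×
    ((owner G v ≡ p × Nonempty (succs G v ∩ (D ∪ E))) ⊎ (owner G v ≡ p ⁻¹ × (succs G v ∩ Z) ⊆ (D ∪ E)))

  attractable? : ∀ p Z E D v → Dec (Attractable p Z E D v)
  attractable? p Z E D v = v ∈? Z ×-dec ¬? (v ∈? E) ×-dec
    ((owner G v ≟ p ×-dec nonempty? _) ⊎-dec (owner G v ≟ p ⁻¹ ×-dec (_ ⊆? _)))

  -- The new vertex closes no cycle of its own: its strategy moves all lead into `D ∪ E`, which does
  -- not contain it. Cycles of the union are then handled by `wins-compose`.
  wins-add : ∀ {p Z E D v} → WinsOr p Z E D → v ∉ D → Attractable p Z E D v → WinsOr p Z E (D ∪ ⁅ v ⁆)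
  wins-add {p} {Z} {E} {D} {v} x v∉D (v∈Z , v∉E , how) = wins-compose x
    (record
      { σ     = τ
      ; sub   = λ u∈ → only (_∈ Z) u∈ v∈Z
      ; edges = λ _ → ∩⁻ˡ
      ; exits = λ _ → inj₂ ∘ ∩⁻ʳ
      ; own   = λ u∈ o → only (λ u → owner G u ≡ p → Nonempty (τ u)) u∈
                  ([ (λ { (_ , ne) _ → ne }) , (λ { (o′ , _) o → contradiction (trans (sym o) o′) p≢p⁻¹ }) ]′ how) o
      ; opp   = λ {_} {w} u∈ o w∈s w∈Z →
                  only (λ u → owner G u ≡ p ⁻¹ → w ∈ succs G u → w ∈ τ u) u∈
                  ([ (λ { (o′ , _) o _ → contradiction (trans (sym o′) o) p≢p⁻¹ })
                  , (λ { (_ , all⊆) _ w∈s → ∩⁺ w∈s (all⊆ (∩⁺ w∈s w∈Z)) }) ]′ how) o w∈s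
      ; win   = λ c → contradiction c no-walk })
    (λ u∈ → only (_∉ D) u∈ v∉D) (λ u∈ → only (_∉ E) u∈ v∉E)
    where
    τ : Vertex G → VertexSet G
    τ u = succs G u ∩ (D ∪ E)
    only : (P : Vertex G → Set) → ∀ {u} → u ∈ ⁅ v ⁆ → P v → P u
    only P u∈ = subst P (sym (x∈⁅y⁆⇒x≡y v u∈))
    v∉D∪E : v ∉ D ∪ E
    v∉D∪E = [ v∉D , v∉E ]′ ∘ ∪⁻
    no-walk : ∀ {u w} → ¬ Walk G ⁅ v ⁆ τ u w
    no-walk (edge _ w∈ e) = only (_∉ D ∪ E) w∈ v∉D∪E (∩⁻ʳ e)
    no-walk (cons _ e c)  = only (_∉ D ∪ E) (source c) v∉D∪E (∩⁻ʳ e)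

  -- With `D = ∅` this is the attractor to `E`, with `E = ∅` the attractor to a dominion. `E` stays
  -- separate from `D′` because no strategy is fixed on it.
  attract : ∀ {p Z E D} → WinsOr p Z E D →
            ∃ λ D′ → D ⊆ D′ × WinsOr p Z E D′ × Trap p Z (Z ─ (D′ ∪ E))
  attract {p} {Z} {E} {D} x with saturate (WinsOr p Z E) (Attractable p Z E) (attractable? p Z E)
                                  (λ _ _ → wins-add) D x
  ... | D′ , D⊆D′ , x′ , stable = D′ , D⊆D′ , x′ , record
      { sub   = p─q⊆p Z (D′ ∪ E)
      ; stuck = λ {v} {w} v∈ o w∈s w∈Z → ─⁺ w∈Z λ w∈ →
          stable v (out v∈ ∘ ∪⁺ˡ) (p─q⊆p Z (D′ ∪ E) v∈ , out v∈ ∘ ∪⁺ʳ , inj₁ (o , w , ∩⁺ w∈s w∈))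
      ; stay  = stay }
    where
    Y : VertexSet G
    Y = Z ─ (D′ ∪ E)
    out : ∀ {v} → v ∈ Y → v ∉ D′ ∪ E
    out = ─⇒∉ Z (D′ ∪ E)
    stay : ∀ {v} → v ∈ Y → owner G v ≡ p ⁻¹ → ∃ λ w → w ∈ succs G v × w ∈ Y
    stay {v} v∈ o with nonempty? (succs G v ∩ Y)
    ... | yes (w , w∈) = w , ∩⁻ˡ w∈ , ∩⁻ʳ w∈
    ... | no absent = contradiction
      (p─q⊆p Z (D′ ∪ E) v∈ , out v∈ ∘ ∪⁺ʳ , inj₂ (o , λ {w} w∈ → case w ∈? (D′ ∪ E) of λ
        { (yes w∈D′) → w∈D′
        ; (no w∉D′) → contradiction (w , ∩⁺ (∩⁻ˡ w∈) (─⁺ (∩⁻ʳ w∈) w∉D′)) absent }))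
      (stable v (out v∈ ∘ ∪⁺ˡ))

  -- At priority `h` any move inside `Z` will do: a cycle either meets `h`, which is then its
  -- highest priority, or stays in `D` and follows the strategy there.
  wins-all : ∀ {p Z D h} → parity h ≡ p → (∀ {v} → v ∈ Z → π G v ≤ h) → Subgame Z →
             WinsOr p Z (Z ∩ withPriority G h) D → (∀ {v} → v ∈ Z → π G v ≢ h → v ∈ D) → Wins p Z Z
  wins-all {p} {Z} {D} {h} h≡p π≤h sg x Z⊆D = record
    { σ = τ ; sub = id ; edges = τ-edges ; exits = τ-exits ; own = τ-own ; opp = τ-opp
    ; win = λ c → [ (λ h≤ → trans (cong parity (≤-antisym (highest≤ π≤h c) h≤)) h≡p)
                  , (λ { (c′ , eq) → trans (cong parity (sym eq)) (win x c′) }) ]′ (split c) }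
    where
    τ : Vertex G → VertexSet G
    τ v = choose (π G v ≟ⁿ h) (succs G v ∩ Z) (σ x v)
    τ-edges : ∀ {v w} → v ∈ Z → w ∈ τ v → w ∈ succs G v
    τ-edges {v} v∈ w∈ with π G v ≟ⁿ h
    ... | yes _ = ∩⁻ˡ w∈
    ... | no ¬h = edges x (Z⊆D v∈ ¬h) w∈
    τ-exits : ∀ {v w} → v ∈ Z → w ∈ τ v → w ∈ Z ⊎ w ∈ ∅
    τ-exits {v} v∈ w∈ with π G v ≟ⁿ h
    ... | yes _ = inj₁ (∩⁻ʳ w∈)
    ... | no ¬h = inj₁ ([ sub x , ∩⁻ˡ ]′ (exits x (Z⊆D v∈ ¬h) w∈))
    τ-own : ∀ {v} → v ∈ Z → owner G v ≡ p → Nonempty (τ v)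
    τ-own {v} v∈ o with π G v ≟ⁿ h
    ... | yes _ = let w , w∈s , w∈Z = sg v∈ in w , ∩⁺ w∈s w∈Z
    ... | no ¬h = own x (Z⊆D v∈ ¬h) o
    τ-opp : ∀ {v w} → v ∈ Z → owner G v ≡ p ⁻¹ → w ∈ succs G v → w ∈ Z → w ∈ τ v
    τ-opp {v} v∈ o w∈s w∈Z with π G v ≟ⁿ h
    ... | yes _ = ∩⁺ w∈s w∈Z
    ... | no ¬h = opp x (Z⊆D v∈ ¬h) o w∈s w∈Z
    split : ∀ {u v} (c : Walk G Z τ u v) → h ≤ highest G c ⊎ Same {D′ = D} {σ x} c
    split (edge {u} {v} u∈ v∈ e) with π G u ≟ⁿ h | π G v ≟ⁿ h
    ... | yes πu | _ = inj₁ (≤-trans (≤-reflexive (sym πu)) (m≤m⊔n _ _))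
    ... | no _ | yes πv = inj₁ (≤-trans (≤-reflexive (sym πv)) (m≤n⊔m _ _))
    ... | no ¬u | no ¬v = inj₂ (edge (Z⊆D u∈ ¬u) (Z⊆D v∈ ¬v) e , refl)
    split (cons {u} u∈ e c) with π G u ≟ⁿ h | split c
    ... | yes πu | _ = inj₁ (≤-trans (≤-reflexive (sym πu)) (m≤m⊔n _ _))
    ... | no _ | inj₁ h≤ = inj₁ (≤-trans h≤ (m≤n⊔m _ _))
    ... | no ¬u | inj₂ (c′ , eq) = inj₂ (cons (Z⊆D u∈ ¬u) e c′ , cong (_ ⊔_) eq)

  Split : Player → VertexSet G → Set
  Split p Z = ∃ λ B → ∃ λ C → Wins p Z B × Wins (p ⁻¹) Z C × (∀ {v} → v ∈ Z → v ∈ B ⊎ v ∈ C)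

  split-flip : ∀ {p q Z} → Split p Z → Split q Z
  split-flip {p} {q} (B , C , x , y , cover) with sameOrOpponent p q
  ... | inj₁ refl = B , C , x , y , cover
  ... | inj₂ refl = C , B , y , subst (λ r → Wins r _ B) (sym (⁻¹-involutive p)) x , swap ∘ cover

  highest-priority : ∀ {Z} d → (∀ {v} → v ∈ Z → π G v ≤ d) → Nonempty Z →
                     ∃ λ v → v ∈ Z × (∀ {u} → u ∈ Z → π G u ≤ π G v)
  highest-priority {Z} d π≤d ne with any? (λ v → v ∈? Z ×-dec (π G v ≟ⁿ d))
  ... | yes (v , v∈ , refl) = v , v∈ , π≤d
  highest-priority zero π≤d (u , u∈) | no absent = contradiction (u , u∈ , n≤0⇒n≡0 (π≤d u∈)) absent
  highest-priority (suc d) π≤d ne | no absent =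
    highest-priority d (λ {v} v∈ → ≤-pred (≤∧≢⇒< (π≤d v∈) λ πv → absent (v , v∈ , πv))) ne

  ∣p─q∣<∣p∣ : ∀ {Z Y : VertexSet G} {v} → v ∈ Z → v ∈ Y → ∣ Z ─ Y ∣ < ∣ Z ∣
  ∣p─q∣<∣p∣ {Z} {Y} v∈Z v∈Y = p∩q≢∅⇒∣p─q∣<∣p∣ Z Y (_ , ∩⁺ v∈Z v∈Y)

  wins-beyond : ∀ {p Z E A B} → WinsOr p Z E A → Wins p (Z ─ (A ∪ E)) B → WinsOr p Z E (A ∪ B)
  wins-beyond {Z = Z} {E} {A} x y = wins-compose x
    (wins-lift y (p─q⊆p Z (A ∪ E)) λ {_} {w} _ _ _ w∈Z → case w ∈? (A ∪ E) of λ
      { (yes w∈) → inj₂ w∈ ; (no w∉) → inj₁ (─⁺ w∈Z w∉) })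
    (λ u∈ → outside u∈ ∘ ∪⁺ˡ) (λ u∈ → outside u∈ ∘ ∪⁺ʳ)
    where
    outside : ∀ {u} → u ∈ _ → u ∉ A ∪ E
    outside u∈ = ─⇒∉ Z (A ∪ E) (sub y u∈)

  split-beyond : ∀ {p Z C} → Wins p Z C → Trap p Z (Z ─ (C ∪ ∅)) → Split p (Z ─ (C ∪ ∅)) → Split p Z
  split-beyond {p} {Z} {C} x t (B′ , C′ , y , z , cover) =
    C ∪ B′ , C′ , wins-beyond x y
    , wins-trap-lift z (subst (λ r → Trap r Z (Z ─ (C ∪ ∅))) (sym (⁻¹-involutive p)) t)
    , cover′
    where
    cover′ : ∀ {w} → w ∈ Z → w ∈ C ∪ B′ ⊎ w ∈ C′
    cover′ {w} w∈Z with w ∈? C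
    ... | yes w∈C = inj₁ (∪⁺ˡ w∈C)
    ... | no w∉C = [ inj₁ ∘ ∪⁺ʳ , inj₂ ]′ (cover
            (─⁺ w∈Z ([ w∉C , ∈∅-elim ]′ ∘ ∪⁻)))

  -- Zielonka's recursion. The attractor of `p` to the top priority is set aside and the rest is
  -- split. If the opponent wins nothing there, `p` wins everywhere; otherwise the opponent's
  -- attractor to its share is won for good, and what lies beyond it is split by induction.
  split-step : ∀ {p h Z} → parity h ≡ p → (∀ {v} → v ∈ Z → π G v ≤ h) → Subgame Z →
               Nonempty (Z ∩ withPriority G h) →
               (∀ q Y → ∣ Y ∣ < ∣ Z ∣ → Subgame Y → Split q Y) → Split p Z
  split-step {p} {h} {Z} h≡p π≤h sg (v , v∈N) split
    with attract {p} {Z} {Z ∩ withPriority G h} {∅} wins-or-∅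
  ... | A , _ , a , trapH
    with split p (Z ─ (A ∪ (Z ∩ withPriority G h))) (∣p─q∣<∣p∣ (∩⁻ˡ v∈N) (∪⁺ʳ v∈N)) (trap-subgame sg trapH)
  ... | B , C , b , c , cover with nonempty? C
  ... | no empty = Z , ∅ , wins-all h≡p π≤h sg (wins-beyond a b) A∪B , wins-or-∅ , inj₁
    where
    A∪B : ∀ {u} → u ∈ Z → π G u ≢ h → u ∈ A ∪ B
    A∪B {u} u∈Z ¬h with u ∈? A
    ... | yes u∈A = ∪⁺ˡ u∈A
    ... | no u∉A = ∪⁺ʳ ([ id , (λ u∈C → contradiction (u , u∈C) empty) ]′ (cover
            (─⁺ u∈Z ([ u∉A , (λ u∈N → ¬h (∈-withPriority⁻ (∩⁻ʳ u∈N))) ]′ ∘ ∪⁻))))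
  ... | yes (u , u∈C) with attract {p ⁻¹} {Z} {∅} {C}
    (wins-trap-lift c (subst (λ r → Trap r Z _) (sym (⁻¹-involutive p)) trapH))
  ... | C′ , C⊆C′ , c′ , trapY = split-flip (split-beyond c′ trapY (split (p ⁻¹) (Z ─ (C′ ∪ ∅))
    (∣p─q∣<∣p∣ (p─q⊆p Z (A ∪ (Z ∩ withPriority G h)) (sub c u∈C)) (∪⁺ˡ (C⊆C′ u∈C))) (trap-subgame sg trapY)))

  module _ (d : ℕ) (π≤d : ∀ v → π G v ≤ d) where

    private
      splitting : ∀ p Z → Acc _<_ ∣ Z ∣ → Subgame Z → Split p Z
      splitting p Z (acc rec) sg with nonempty? Z
      ... | no empty = ∅ , ∅ , wins-or-∅ , wins-or-∅ , λ v∈ → contradiction (_ , v∈) empty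
      ... | yes ne with highest-priority d (λ {v} _ → π≤d v) ne
      ... | v , v∈Z , π≤h = split-flip (split-step refl π≤h sg (v , ∩⁺ v∈Z (∈-withPriority⁺ refl))
              λ q Y smaller → splitting q Y (rec smaller))

    determinacy : ∀ p {Z} → Subgame Z → Split p Z
    determinacy p {Z} sg = splitting p Z (<-wellFounded _) sg

  subgame-full : Subgame full
  subgame-full {v} _ = let w , w∈ = total G v in w , w∈ , ∈⊤

  dominion⇒wins : ∀ {p D} → Dominion G p D → Wins p full D
  dominion⇒wins x = record
    { σ = x.σ ; sub = λ _ → ∈⊤
    ; edges = λ {v} _ → Strategy.edges x.strategy v
    ; exits = λ {v} v∈ w∈ → inj₁ (x.closed v v∈ w∈)
    ; own = λ {v} _ → Strategy.own x.strategy v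
    ; opp = λ {v} _ o w∈ _ → Strategy.opponent x.strategy v o w∈
    ; win = x.winning }
    where module x = Dominion x

  wins⇒dominion : ∀ {p D} → Wins p full D → Dominion G p D
  wins⇒dominion {p} {D} x = record
    { σ = τ
    ; strategy = record { edges = τ-edges ; own = τ-own ; opponent = τ-opp }
    ; closed = λ v v∈ {w} w∈ → closed x v∈ (τ-inside v∈ w∈)
    ; winning = λ c → let c′ , eq = map-walk id (λ u∈ _ e → τ-inside u∈ e) c
                      in trans (cong parity (sym eq)) (win x c′) }
    where
    τ : Vertex G → VertexSet G
    τ v = choose (v ∈? D) (σ x v) (succs G v)
    τ-inside : ∀ {v w} → v ∈ D → w ∈ τ v → w ∈ σ x v
    τ-inside {v} v∈ w∈ with v ∈? D
    ... | yes _ = w∈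
    ... | no v∉ = contradiction v∈ v∉
    τ-edges : ∀ v → τ v ⊆ succs G v
    τ-edges v w∈ with v ∈? D
    ... | yes v∈ = edges x v∈ w∈
    ... | no _ = w∈
    τ-own : ∀ v → owner G v ≡ p → Nonempty (τ v)
    τ-own v o with v ∈? D
    ... | yes v∈ = own x v∈ o
    ... | no _ = total G v
    τ-opp : ∀ v → owner G v ≡ p ⁻¹ → succs G v ⊆ τ v
    τ-opp v o w∈ with v ∈? D
    ... | yes v∈ = opp x v∈ o w∈ ∈⊤
    ... | no _ = w∈

  -- Positional determinacy identifies the two approximations with the winning regions.
  approx⇒largest : ∀ {p a d W} → (∀ v → π G v ≤ d) → size G < 2 ^ a → Approx p a a full W →
                   LargestDominion G p W × LargestDominion G (p ⁻¹) (full ─ W)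
  approx⇒largest {p} {a} {d} {W} π≤d n< x with determinacy d π≤d p subgame-full
  ... | B , C , b , c , cover =
      (wins⇒dominion (subst (Wins p full) B≡W b) , λ D y → keeps (dominion⇒wins y))
    , (wins⇒dominion (subst (Wins (p ⁻¹) full) C≡∁W c)
      , λ D y v∈D → ─⁺ ∈⊤ (drops (dominion⇒wins y) v∈D))
    where
    small : ∀ {D : VertexSet G} → ∣ D ∣ < 2 ^ a
    small {D} = ≤-<-trans (∣p∣≤n D) n<
    keeps : ∀ {D} → Wins p full D → D ⊆ W
    keeps {D} y = Approx.keeps x y (small {D})
    drops : ∀ {D} → Wins (p ⁻¹) full D → ∀ {v} → v ∈ D → v ∉ W
    drops {D} y = Approx.drops x y (small {D})
    B≡W : B ≡ W
    B≡W = ⊆-antisym (keeps b) λ v∈W →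
      [ id , (λ v∈C → contradiction v∈W (drops c v∈C)) ]′ (cover ∈⊤)
    C≡∁W : C ≡ full ─ W
    C≡∁W = ⊆-antisym (λ v∈C → ─⁺ ∈⊤ (drops c v∈C)) λ v∈ →
      [ (λ v∈B → contradiction (keeps b v∈B) (─⇒∉ full W v∈)) , id ]′ (cover ∈⊤)

  -- Greatest traps from controllable predecessors

  ∈-ownedBy⁺ : ∀ {p v} → owner G v ≡ p → v ∈ ownedBy G p
  ∈-ownedBy⁺ {p} {v} o = ∈-comprehension⁺ (does⁺ (owner G v ≟ p) o)

  ∈-ownedBy⁻ : ∀ {p v} → v ∈ ownedBy G p → owner G v ≡ p
  ∈-ownedBy⁻ {p} {v} v∈ = does⁻ (owner G v ≟ p) (∈-comprehension⁻ v∈)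

  private
    lookup-cpre : ∀ p X v → lookup (cpre G p X) v ≡ _
    lookup-cpre p X v = lookup∘tabulate _ v

  cpre-own : ∀ {p v} → owner G v ≡ p → ∀ X → lookup (cpre G p X) v ≡ does (nonempty? (succs G v ∩ X))
  cpre-own {p} {v} o X rewrite lookup-cpre p X v with owner G v ≟ p
  ... | yes _ = refl
  ... | no ¬o = contradiction o ¬o

  cpre-opp : ∀ {p v} → owner G v ≢ p → ∀ X → lookup (cpre G p X) v ≡ does (succs G v ⊆? X)
  cpre-opp {p} {v} ¬o X rewrite lookup-cpre p X v with owner G v ≟ p
  ... | yes o = contradiction o ¬o
  ... | no _  = refl

  ∈-cpre-own⁺ : ∀ {p X v w} → owner G v ≡ p → w ∈ succs G v → w ∈ X → v ∈ cpre G p X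
  ∈-cpre-own⁺ {X = X} {v} {w} o w∈s w∈X =
    lookup⇒[]= v _ (trans (cpre-own o X) (does⁺ (nonempty? (succs G v ∩ X)) (w , ∩⁺ w∈s w∈X)))

  ∈-cpre-own⁻ : ∀ {p X v} → owner G v ≡ p → v ∈ cpre G p X → ∃ λ w → w ∈ succs G v × w ∈ X
  ∈-cpre-own⁻ {X = X} {v} o v∈ =
    let w , w∈ = does⁻ (nonempty? (succs G v ∩ X)) (trans (sym (cpre-own o X)) ([]=⇒lookup v∈))
    in w , ∩⁻ˡ w∈ , ∩⁻ʳ w∈

  ∈-cpre-opp⁺ : ∀ {p X v} → owner G v ≢ p → succs G v ⊆ X → v ∈ cpre G p X
  ∈-cpre-opp⁺ {X = X} {v} ¬o s⊆X =
    lookup⇒[]= v _ (trans (cpre-opp ¬o X) (does⁺ (succs G v ⊆? X) s⊆X))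

  ∈-cpre-opp⁻ : ∀ {p X v} → owner G v ≢ p → v ∈ cpre G p X → succs G v ⊆ X
  ∈-cpre-opp⁻ {X = X} {v} ¬o v∈ =
    does⁻ (succs G v ⊆? X) (trans (sym (cpre-opp ¬o X)) ([]=⇒lookup v∈))

  -- `cpre` looks at the whole graph, not at the subgame. Where `p` moves, the complement `C` of the
  -- subgame is therefore added to the target, so that only successors inside the subgame are
  -- constrained; where the opponent moves, a successor in `Y` itself is demanded.
  restriction : Player → (C Y : VertexSet G) → VertexSet G
  restriction p C Y =
    Y ∩ ((cpre G (p ⁻¹) (Y ∪ C) ∩ ownedBy G p) ∪ (cpre G (p ⁻¹) Y ∩ ownedBy G (p ⁻¹)))

  restrictions : Player → VertexSet G → ℕ → VertexSet G → VertexSet G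
  restrictions p C zero    Y = Y
  restrictions p C (suc k) Y = restrictions p C k (restriction p C Y)

  module _ {p : Player} {Z : VertexSet G} where

    private
      C = full ─ Z

    restriction-greatest : ∀ {Y Y′} → Trap p Z Y′ → Y′ ⊆ Y → Y′ ⊆ restriction p C Y
    restriction-greatest {Y} {Y′} t Y′⊆Y {v} v∈ with owned-by p v
    ... | inj₁ o = ∩⁺ (Y′⊆Y v∈) (∪⁺ˡ (∩⁺ (∈-cpre-opp⁺ (λ o′ → p≢p⁻¹ (trans (sym o) o′)) all⊆) (∈-ownedBy⁺ o)))
      where
      all⊆ : succs G v ⊆ Y ∪ C
      all⊆ {w} w∈s with w ∈? Z
      ... | yes w∈Z = ∪⁺ˡ (Y′⊆Y (Trap.stuck t v∈ o w∈s w∈Z))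
      ... | no w∉Z = ∪⁺ʳ (─⁺ ∈⊤ w∉Z)
    ... | inj₂ o = let w , w∈s , w∈Y′ = Trap.stay t v∈ o
                   in ∩⁺ (Y′⊆Y v∈) (∪⁺ʳ (∩⁺ (∈-cpre-own⁺ o w∈s (Y′⊆Y w∈Y′)) (∈-ownedBy⁺ o)))

    stable-trap : ∀ {Y} → Y ⊆ Z → Y ⊆ restriction p C Y → Trap p Z Y
    stable-trap {Y} Y⊆Z stable = record { sub = Y⊆Z ; stuck = stuck ; stay = stay }
      where
      stuck : ∀ {v w} → v ∈ Y → owner G v ≡ p → w ∈ succs G v → w ∈ Z → w ∈ Y
      stuck v∈ o w∈s w∈Z with ∪⁻ (∩⁻ʳ {p = Y} (stable v∈))
      ... | inj₂ v∈q = contradiction (trans (sym o) (∈-ownedBy⁻ (∩⁻ʳ v∈q))) p≢p⁻¹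
      ... | inj₁ v∈p with ∪⁻ (∈-cpre-opp⁻ (λ o′ → p≢p⁻¹ (trans (sym o) o′)) (∩⁻ˡ v∈p) w∈s)
      ...   | inj₁ w∈Y = w∈Y
      ...   | inj₂ w∈C = contradiction w∈Z (─⇒∉ full Z w∈C)
      stay : ∀ {v} → v ∈ Y → owner G v ≡ p ⁻¹ → ∃ λ w → w ∈ succs G v × w ∈ Y
      stay v∈ o with ∪⁻ (∩⁻ʳ {p = Y} (stable v∈))
      ... | inj₁ v∈p = contradiction (trans (sym (∈-ownedBy⁻ (∩⁻ʳ v∈p))) o) p≢p⁻¹
      ... | inj₂ v∈q = ∈-cpre-own⁻ o (∩⁻ˡ v∈q)

    restrictions-⊆ : ∀ k Y → restrictions p C k Y ⊆ Y
    restrictions-⊆ zero    Y v∈ = v∈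
    restrictions-⊆ (suc k) Y v∈ = ∩⁻ˡ {p = Y} (restrictions-⊆ k _ v∈)

    restrictions-max : ∀ k {Y Y′} → Trap p Z Y′ → Y′ ⊆ Y → Y′ ⊆ restrictions p C k Y
    restrictions-max zero    t Y′⊆Y = Y′⊆Y
    restrictions-max (suc k) {Y} {Y′} t Y′⊆Y =
      restrictions-max k {Y′ = Y′} t (restriction-greatest {Y} {Y′} t Y′⊆Y)

    -- A round that changes anything removes a vertex, and a round that changes nothing is followed
    -- only by such rounds.
    restrictions-progress : ∀ k Y → (restrictions p C k Y ⊆ restriction p C (restrictions p C k Y))
                                  ⊎ ∣ restrictions p C k Y ∣ + k ≤ ∣ Y ∣
    restrictions-progress zero Y = inj₂ (≤-reflexive (+-identityʳ _))
    restrictions-progress (suc k) Y with Y ⊆? restriction p C Y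
    ... | yes Y⊆ = inj₁ (subst (λ Y′ → Y′ ⊆ restriction p C Y′) (sym (constant (suc k))) Y⊆)
      where
      constant : ∀ k → restrictions p C k Y ≡ Y
      constant zero    = refl
      constant (suc k) = trans (cong (restrictions p C k) (⊆-antisym (∩⁻ˡ {p = Y}) Y⊆)) (constant k)
    ... | no Y⊈ with restrictions-progress k (restriction p C Y)
    ...   | inj₁ stable = inj₁ stable
    ...   | inj₂ small = inj₂ (subst (_≤ ∣ Y ∣) (sym (+-suc _ k)) (≤-<-trans small shrinks))
      where
      shrinks : ∣ restriction p C Y ∣ < ∣ Y ∣
      shrinks = ≤∧≢⇒< (p⊆q⇒∣p∣≤∣q∣ (∩⁻ˡ {p = Y})) λ eq → Y⊈ λ {v} v∈ → case v ∈? restriction p C Y of λ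
        { (yes v∈′) → v∈′
        ; (no v∉) → contradiction eq (<⇒≢ (p⊂q⇒∣p∣<∣q∣ (∩⁻ˡ {p = Y} , v , v∈ , v∉))) }

    restrictions-trap : ∀ {n Y} → size G ≤ n → Y ⊆ Z → MaxTrap p Z Y (restrictions p C n Y)
    restrictions-trap {n} {Y} size≤ Y⊆Z = record
      { trap     = stable-trap (Y⊆Z ∘ restrictions-⊆ n Y) stable
      ; below    = restrictions-⊆ n Y
      ; greatest = λ {Y′} t → restrictions-max n {Y} {Y′} t }
      where
      stable : restrictions p C n Y ⊆ restriction p C (restrictions p C n Y)
      stable with restrictions-progress n Y
      ... | inj₁ st = st
      -- Without a fixed point after `n` rounds no vertex is left, and the empty set is stable.
      ... | inj₂ small = λ v∈ → contradiction v∈ (∣D∣<1⇒v∉D (s≤s (+-cancelʳ-≤ n _ 0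
                           (≤-trans small (≤-trans (∣p∣≤n Y) size≤)))))

-- The program

block : Instruction → List Instruction → Program
block i []       = instr i
block i (j ∷ js) = instr i ⨾ block j js

-- Cells: 0 n, 1 d, 2 level, 3 depth, 4 stack, 5 and 6 precisions of Even and Odd, 7 mode
-- (0 call, 1 return, 2 halt), 8 base of the stack, 9 end of the mark bits, 10–12 scratch,
-- and M[13 + k] = k for k < 8.
-- A stack digit 2 h or 2 h + 1 says that the first or the second half on level h is under way; the
-- initial stack is the digit of the level d + 1, which is never entered.
-- Sets: 0 residual game, 1 ambient game, 2–6 scratch, 7 empty, and the mark bits from 8 on.

pattern level  = 2
pattern depth  = 3
pattern stack  = 4
pattern mode   = 7
pattern base   = 8
pattern limit  = 9
pattern pointer     = 10
pattern value     = 11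
pattern digit     = 12
pattern c0 = 13
pattern c1 = 14
pattern c2 = 15
pattern c3 = 16
pattern c4 = 17
pattern c5 = 18
pattern c6 = 19
pattern c7 = 20

precision : Player → ℕ
precision Even = 5
precision Odd  = 6

cells₀ : ℕ
cells₀ = 21

-- X[2] holds the complement of the ambient game and X[3] the shrinking candidate; the increment of
-- `pointer` counts the rounds.
restrict-step : Player → Instruction × List Instruction
restrict-step p =
    assignSet c4 (setOp union c3 c2)
  , assignSet c4 (control (p ⁻¹) c4)
  ∷ assignSet c5 (owned p)
  ∷ assignSet c4 (setOp intersection c4 c5)
  ∷ assignSet c5 (control (p ⁻¹) c3)
  ∷ assignSet c6 (owned (p ⁻¹))
  ∷ assignSet c5 (setOp intersection c5 c6)
  ∷ assignSet c4 (setOp union c4 c5)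
  ∷ assignSet c3 (setOp intersection c3 c4)
  ∷ assign pointer (op plus c1 pointer)
  ∷ []

restrict : Player → Program
restrict p = block (proj₁ (restrict-step p)) (proj₂ (restrict-step p))

restrictTo : Player → Program
restrictTo p =
    block (assignSet c2 all) (assignSet c2 (setOp difference c2 c1) ∷ assign pointer (lit 0) ∷ [])
  ⨾ while less pointer 0 loop restrict p

-- `value` is consumed digit by digit, lowest first, while `pointer` runs over the addresses of the
-- mark bits.
overBits : Instruction → Instruction → Program
overBits one zer =
  while less pointer limit loop
    ( (instr (assign digit (op remainder value c2)) ⨾ (if less c0 digit then instr one else instr zer))
    ⨾ block (assign value (op quotient value c2)) (assign pointer (op plus c1 pointer) ∷ []))

mark : Program
mark = instr (assign pointer (lit 8)) ⨾ overBits (assignSet pointer (setOp union pointer c1)) (assignSet pointer (setOp difference pointer c1))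

marked : Program
marked = block (assign pointer (lit 8)) (assignSet c1 all ∷ [])
  ⨾ overBits (assignSet c1 (setOp intersection c1 pointer)) (assignSet c1 (setOp difference c1 pointer))

moveTo : NumExp → Program
moveTo e = block (assign level e) (assignSet c3 (priority level) ∷ [])

scan : NumExp → Program
scan e = moveTo e ⨾ while subset c3 c7 loop moveTo e

pushRight : Player → Program
pushRight p = block (assign stack (op times stack base))
  ( assign value (op plus level level) ∷ assign value (op plus c1 value) ∷ assign stack (op plus value stack)
  ∷ assign (precision (p ⁻¹)) (op monus (precision (p ⁻¹)) c1) ∷ assign mode (lit 0) ∷ [])

pushLeft : Player → Program
pushLeft p = block (assign stack (op times stack base))
  ( assign value (op plus level level) ∷ assign stack (op plus value stack)
  ∷ assign (precision (p ⁻¹)) (op monus (precision (p ⁻¹)) c1) ∷ [])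

call : Player → Program
call p = if less c0 (precision (p ⁻¹)) then pushLeft p else instr (assign mode (lit 1))

deepen : Program
deepen = block (assignSet c0 (setOp union c3 c3)) (assign depth (op plus c1 depth) ∷ assign value (copy depth) ∷ [])

enter : Program
enter = deepen
  ⨾ mark
  ⨾ scan (op monus level c1)
  ⨾ instr (assign mode (lit 0))

dropLevel : Program
dropLevel = block (assignSet c1 (setOp union c0 c0))
                  (assignSet c3 (priority level) ∷ assignSet c3 (setOp difference c1 c3) ∷ [])

-- With an empty subgame below there is nothing to remove, so the second half starts on the same
-- residual game.
descend : Player → Program
descend p =
    dropLevel
  ⨾ restrictTo p
  ⨾ (if subset c3 c7 then pushRight p else enter)

separated : Player → Player → SetExp
separated Even Even = setOp difference c3 c0
separated Odd  Odd  = setOp difference c3 c0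
separated _    _    = setOp union c0 c0

separate : Player → Player → Program
separate p p′ = block (assignSet c3 (separated p p′)) (assignSet c3 (setOp difference c1 c3) ∷ [])

-- On entry X[1] is the resumed residual game, X[3] its priority class as left by `scan`, and X[0]
-- the output of the lower call, whose level has parity `p`. The subgame below is recomputed because
-- the loss may have to be formed relative to it.
conclude : Player → Player → Program
conclude p p′ =
    instr (assignSet c3 (setOp difference c1 c3))
  ⨾ restrictTo p′
  ⨾ separate p p′
  ⨾ restrictTo (p′ ⁻¹)
  ⨾ instr (assignSet c0 (setOp union c3 c3))
  ⨾ pushRight p′

byParity : (Player → Program) → Program
byParity P = instr (assign digit (op remainder level c2)) ⨾ (if less c0 digit then P Odd else P Even)

-- The depth selects the suspended game, and marking it with the depth minus one undoes the marking
-- in `enter`. The upward scan ends at the right level, since `enter` went down to the first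
-- non-empty one.
ascend : Player → Program
ascend p =
    instr (assign value (copy depth))
  ⨾ marked
  ⨾ block (assign depth (op monus depth c1)) (assign value (copy depth) ∷ [])
  ⨾ mark
  ⨾ scan (op plus c1 level)
  ⨾ byParity (conclude p)

pop : Player → Program
pop p = block (assign stack (op quotient stack base))
              (assign (precision (p ⁻¹)) (op plus c1 (precision (p ⁻¹))) ∷ assign digit (op monus digit c1) ∷ [])

readTop : Program
readTop = block (assign value (op remainder stack base)) (assign digit (op plus level level) ∷ assign digit (op plus c2 digit) ∷ [])

-- `digit` starts as `2 h + 2` on the current level `h`. Digits of lower levels have been popped, so
-- a smaller top digit belongs to `h`, and after `pop` the value `2 h + 1` tells its two halves
-- apart. Any other top digit means that the call on `h` is finished.
return : Player → Program
return p =
    readTop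
  ⨾ (if less value digit
     then (pop p ⨾ (if less value digit then descend p else skip))
     else (if less c0 depth then ascend p else instr (assign mode (lit 2))))

body : Program
body = if less mode c1 then byParity call else byParity return

halve : ℕ → Program
halve a = while less c0 value loop block (assign value (op quotient value c2)) (assign a (op plus c1 a) ∷ [])

-- The highest address comes first, so that all cells exist from then on and later writes only
-- change contents.
constants : Program
constants = block (assign c7 (lit 7))
  ( assign c1 (lit 1) ∷ assign c2 (lit 2) ∷ assign c3 (lit 3) ∷ assign c4 (lit 4)
  ∷ assign c5 (lit 5) ∷ assign c6 (lit 6) ∷ assign value (copy 0) ∷ [])

initialise : Program
initialise =
    constants
  ⨾ halve 5
  ⨾ block (assign 6 (copy 5)) (assign limit (lit 8) ∷ assign value (op plus c1 1) ∷ [])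
  ⨾ halve limit
  -- Writing the last set variable first allocates all of them, empty.
  ⨾ block (assign value (op monus limit c1))
      ( assignSet value none ∷ assignSet c0 all
      ∷ assign base (op plus 1 1) ∷ assign stack (op plus c2 base) ∷ assign base (op plus c2 stack)
      ∷ assign level (op plus c1 1) ∷ [])

orient : Player → Program
orient Even = skip
orient Odd  = block (assignSet c2 (setOp union c0 c0))
                    (assignSet c0 (setOp union c1 c1) ∷ assignSet c1 (setOp union c2 c2) ∷ [])

output : Program
output = block (assignSet c1 all) (assignSet c1 (setOp difference c1 c0) ∷ [])
  ⨾ byParity orient

-- On a graph without vertices the downward scan would stay at level 0 forever.
search : Program
search = if subset c0 c7 then skip else (scan (op monus level c1) ⨾ while less mode c2 loop body)

solver : Program
solver = initialise
  ⨾ search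
  ⨾ output

-- Runs with bounded resources

module Execution (G : ParityGame) (V L : ℕ) where

  open State

  OK : State G → Set
  OK s = length (cells s) ≤ cells₀ × All (_≤ V) (cells s) × length (sets s) ≤ L

  -- `safe` quantifies over all measures of states, so that one run gives the bounds on conventional
  -- space and on set variables alike.
  record Exec (P : Program) (s s′ : State G) (t : ℕ) : Set where
    constructor exec
    field
      run  : Run G P s s′
      fast : time G run ≤ t
      safe : ∀ f b → (∀ s → OK s → f s ≤ b) → peak G f run ≤ b
      ok   : OK s′

  open Exec public

  weaken : ∀ {P s s′ t t₁} → t ≤ t₁ → Exec P s s′ t → Exec P s s′ t₁
  weaken t≤ (exec r f s o) = exec r (≤-trans f t≤) s o

  infixr 4 _then_

  _then_ : ∀ {P Q s s′ s″ t t₁} → Exec P s s′ t → Exec Q s′ s″ t₁ → Exec (P ⨾ Q) s s″ (t + t₁)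
  exec r f s _ then exec r′ f′ s′ o′ =
    exec (r ⨾ r′) (+-mono-≤ f f′) (λ g b bound → ⊔-lub (s g b bound) (s′ g b bound)) o′

  exec-skip : ∀ {s} → OK s → Exec skip s s 1
  exec-skip o = exec skip ≤-refl (λ f b bound → bound _ o) o

  exec-true : ∀ {c P Q s s′ t} → evalTest G s c ≡ true → Exec P s s′ t →
              Exec (if c then P else Q) s s′ (suc t)
  exec-true c (exec r f s o) = exec (ifTrue c r) (s≤s f) s o

  exec-false : ∀ {c P Q s s′ t} → evalTest G s c ≡ false → Exec Q s s′ t →
               Exec (if c then P else Q) s s′ (suc t)
  exec-false c (exec r f s o) = exec (ifFalse c r) (s≤s f) s o

  exec-stop : ∀ {c P s} → OK s → evalTest G s c ≡ false → Exec (while c loop P) s s 1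
  exec-stop o c = exec (stop c) ≤-refl (λ f b bound → bound _ o) o

  exec-repeat : ∀ {c P s s′ s″ t t₁} → evalTest G s c ≡ true → Exec P s s′ t →
                Exec (while c loop P) s′ s″ t₁ → Exec (while c loop P) s s″ (suc (t + t₁))
  exec-repeat c (exec r f s _) (exec r′ f′ s′ o) =
    exec (repeat c r r′) (s≤s (+-mono-≤ f f′)) (λ g b bound → ⊔-lub (s g b bound) (s′ g b bound)) o

  -- The checks of addresses are Boolean, so that they compute to the unit type for literal
  -- addresses.
  Fits : Instruction → State G → Set
  Fits (assign a e)    s = T (a <ᵇ cells₀) × evalNum G s e ≤ V
  Fits (store _ _)     _ = ⊥
  Fits (assignSet a e) s = T (M G s a <ᵇ L)

  length-write : ∀ {A : Set} (x : A) i y xs k → i < k → length xs ≤ k → length (write x i y xs) ≤ k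
  length-write x zero    y []       (suc k) i<k       len       = s≤s z≤n
  length-write x zero    y (_ ∷ xs) (suc k) i<k       len       = len
  length-write x (suc i) y []       (suc k) (s≤s i<k) len       = s≤s (length-write x i y [] k i<k z≤n)
  length-write x (suc i) y (_ ∷ xs) (suc k) (s≤s i<k) (s≤s len) = s≤s (length-write x i y xs k i<k len)

  all-write : ∀ i {y xs} → y ≤ V → All (_≤ V) xs → All (_≤ V) (write 0 i y xs)
  all-write zero    y≤ []        = y≤ ∷ []
  all-write zero    y≤ (_ ∷ xs≤) = y≤ ∷ xs≤
  all-write (suc i) y≤ []        = z≤n ∷ all-write i y≤ []
  all-write (suc i) y≤ (x≤ ∷ xs≤) = x≤ ∷ all-write i y≤ xs≤

  ok-execute : ∀ i s → OK s → Fits i s → OK (execute G i s)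
  ok-execute (assign a e) s (len , small , slen) (a< , e≤) =
    length-write 0 a _ (cells s) cells₀ (<ᵇ⇒< a cells₀ a<) len , all-write a e≤ small , slen
  ok-execute (assignSet a e) s (len , small , slen) a< =
    len , small , length-write ∅ _ _ (sets s) L (<ᵇ⇒< _ L a<) slen

  exec-instr : ∀ i {s} → OK s → Fits i s → Exec (instr i) s (execute G i s) 1
  exec-instr i {s} o fits = exec instr ≤-refl
    (λ f b bound → ⊔-lub (bound _ o) (bound _ (ok-execute i s o fits))) (ok-execute i s o fits)

  AllFit : Instruction → List Instruction → State G → Set
  AllFit i []       s = Fits i s
  AllFit i (j ∷ js) s = Fits i s × AllFit j js (execute G i s)

  executeAll : Instruction → List Instruction → State G → State G
  executeAll i []       s = execute G i s
  executeAll i (j ∷ js) s = executeAll j js (execute G i s)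

  exec-block : ∀ i js {s} → OK s → AllFit i js s → Exec (block i js) s (executeAll i js s) (suc (length js))
  exec-block i []       o fit        = exec-instr i o fit
  exec-block i (j ∷ js) o (fit , fits) =
    exec-instr i o fit then exec-block j js (ok-execute i _ o fit) fits

-- A vertex v is marked k if its membership in the list of sets spells k in binary, lowest bit first.
module Marks {N : ℕ} where

  odd? : ℕ → Bool
  odd? k = does (0 <? k % 2)

  HasBit : Bool → Fin N → Subset N → Set
  HasBit true  v B = v ∈ B
  HasBit false v B = v ∉ B

  Marked : Fin N → ℕ → List (Subset N) → Set
  Marked v k []       = ⊤
  Marked v k (B ∷ Bs) = HasBit (odd? k) v B × Marked v (k / 2) Bs

  setBit : Bool → Subset N → Subset N → Subset N
  setBit true  B S = B ∪ S
  setBit false B S = B ─ S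

  setMarks : Subset N → ℕ → List (Subset N) → List (Subset N)
  setMarks S k []       = []
  setMarks S k (B ∷ Bs) = setBit (odd? k) B S ∷ setMarks S (k / 2) Bs

  selectBit : Bool → Subset N → Subset N → Subset N
  selectBit true  A B = A ∩ B
  selectBit false A B = A ─ B

  selectMarked : Subset N → ℕ → List (Subset N) → Subset N
  selectMarked A k []       = A
  selectMarked A k (B ∷ Bs) = selectMarked (selectBit (odd? k) A B) (k / 2) Bs

  length-setMarks : ∀ S k Bs → length (setMarks S k Bs) ≡ length Bs
  length-setMarks S k []       = refl
  length-setMarks S k (B ∷ Bs) = cong suc (length-setMarks S (k / 2) Bs)

  selectBit⁺ : ∀ b {A B v} → v ∈ A → HasBit b v B → v ∈ selectBit b A B
  selectBit⁺ true  v∈A v∈B = ∩⁺ v∈A v∈B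
  selectBit⁺ false v∈A v∉B = ─⁺ v∈A v∉B

  selectBit⁻ : ∀ b {A B v} → v ∈ selectBit b A B → v ∈ A × HasBit b v B
  selectBit⁻ true          v∈ = ∩⁻ˡ v∈ , ∩⁻ʳ v∈
  selectBit⁻ false {A} {B} v∈ = p─q⊆p A B v∈ , ─⇒∉ A B v∈

  selectMarked⁺ : ∀ k Bs {A v} → v ∈ A → Marked v k Bs → v ∈ selectMarked A k Bs
  selectMarked⁺ k []       v∈A _         = v∈A
  selectMarked⁺ k (B ∷ Bs) v∈A (bit , m) = selectMarked⁺ (k / 2) Bs (selectBit⁺ (odd? k) v∈A bit) m

  selectMarked⁻ : ∀ k Bs {A v} → v ∈ selectMarked A k Bs → v ∈ A × Marked v k Bs
  selectMarked⁻ k []       v∈ = v∈ , tt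
  selectMarked⁻ k (B ∷ Bs) v∈ =
    let v∈′ , m = selectMarked⁻ (k / 2) Bs v∈
        v∈A , bit = selectBit⁻ (odd? k) v∈′
    in v∈A , bit , m

  setBit-inside : ∀ b {B S v} → v ∈ S → HasBit b v (setBit b B S)
  setBit-inside true          v∈S = ∪⁺ʳ v∈S
  setBit-inside false {B} {S} v∈S = λ v∈ → ─⇒∉ B S v∈ v∈S

  setBit-outside⁻ : ∀ b b′ {B S v} → v ∉ S → HasBit b′ v (setBit b B S) → HasBit b′ v B
  setBit-outside⁻ true  true          v∉S v∈ = [ id , (λ v∈S → contradiction v∈S v∉S) ]′ (∪⁻ v∈)
  setBit-outside⁻ true  false         v∉S v∉ = v∉ ∘ ∪⁺ˡ
  setBit-outside⁻ false true  {B} {S} v∉S v∈ = p─q⊆p B S v∈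
  setBit-outside⁻ false false         v∉S v∉ = λ v∈B → v∉ (─⁺ v∈B v∉S)

  bit-unique : ∀ b b′ {v B} → HasBit b v B → HasBit b′ v B → b ≡ b′
  bit-unique true  true  _  _  = refl
  bit-unique true  false v∈ v∉ = contradiction v∈ v∉
  bit-unique false true  v∉ v∈ = contradiction v∈ v∉
  bit-unique false false _  _  = refl

  setMarks-inside : ∀ k Bs {S v} → v ∈ S → Marked v k (setMarks S k Bs)
  setMarks-inside k []       v∈S = tt
  setMarks-inside k (B ∷ Bs) v∈S = setBit-inside (odd? k) v∈S , setMarks-inside (k / 2) Bs v∈S

  setMarks-outside : ∀ k k′ Bs {S v} → v ∉ S → Marked v k′ (setMarks S k Bs) → Marked v k′ Bs
  setMarks-outside k k′ []       v∉S _         = tt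
  setMarks-outside k k′ (B ∷ Bs) v∉S (bit , m) =
    setBit-outside⁻ (odd? k) (odd? k′) v∉S bit , setMarks-outside (k / 2) (k′ / 2) Bs v∉S m

  odd?-injective : ∀ k k′ → odd? k ≡ odd? k′ → k % 2 ≡ k′ % 2
  odd?-injective k k′ eq with k % 2 | k′ % 2 | m%n<n k 2 | m%n<n k′ 2
  odd?-injective k k′ eq | 0 | 0 | _ | _ = refl
  odd?-injective k k′ eq | 1 | 1 | _ | _ = refl
  odd?-injective k k′ () | 0 | 1 | _ | _
  odd?-injective k k′ () | 1 | 0 | _ | _
  odd?-injective k k′ eq | suc (suc _) | _ | s≤s (s≤s ()) | _
  odd?-injective k k′ eq | 0 | suc (suc _) | _ | s≤s (s≤s ())
  odd?-injective k k′ eq | 1 | suc (suc _) | _ | s≤s (s≤s ())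

  half< : ∀ {k} l → k < 2 ^ suc l → k / 2 < 2 ^ l
  half< {k} l k< = m<n*o⇒m/o<n (subst (k <_) (*-comm 2 (2 ^ l)) k<)

  mark-unique : ∀ k k′ Bs {v} → k < 2 ^ length Bs → k′ < 2 ^ length Bs →
                Marked v k Bs → Marked v k′ Bs → k ≡ k′
  mark-unique k k′ [] k< k′< _ _ = trans (n<1⇒n≡0 k<) (sym (n<1⇒n≡0 k′<))
  mark-unique k k′ (B ∷ Bs) k< k′< (bit , m) (bit′ , m′) = begin
    k                  ≡⟨ m≡m%n+[m/n]*n k 2 ⟩
    k % 2 + k / 2 * 2  ≡⟨ cong₂ (λ a b → a + b * 2) (odd?-injective k k′ (bit-unique (odd? k) (odd? k′) bit bit′))
                            (mark-unique (k / 2) (k′ / 2) Bs (half< (length Bs) k<) (half< (length Bs) k′<) m m′) ⟩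
    k′ % 2 + k′ / 2 * 2 ≡⟨ m≡m%n+[m/n]*n k′ 2 ⟨
    k′                 ∎
    where open ≡-Reasoning

  setBit-restore : ∀ b b′ {B S} → (∀ {v} → v ∈ S → HasBit b v B) → setBit b (setBit b′ B S) S ≡ B
  setBit-restore b b′ {B} {S} bits = ⊆-antisym forth back
    where
    to : ∀ b {v} → v ∉ S → v ∈ setBit b (setBit b′ B S) S → v ∈ B
    to b v∉S v∈ = setBit-outside⁻ b′ true v∉S (setBit-outside⁻ b true v∉S v∈)
    forth : setBit b (setBit b′ B S) S ⊆ B
    forth {v} v∈ with v ∈? S
    ... | no v∉S = to b v∉S v∈
    ... | yes v∈S = inside b (bits v∈S) (setBit-inside b v∈S) v∈
      where
      inside : ∀ b {C} → HasBit b v B → HasBit b v C → v ∈ C → v ∈ B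
      inside true  v∈B _   _   = v∈B
      inside false _   v∉C v∈C = contradiction v∈C v∉C
    back : B ⊆ setBit b (setBit b′ B S) S
    back {v} v∈B with v ∈? S
    ... | yes v∈S = inside b (bits v∈S) (setBit-inside b v∈S)
      where
      inside : ∀ b {C} → HasBit b v B → HasBit b v C → v ∈ C
      inside true  _   v∈C = v∈C
      inside false v∉B _   = contradiction v∈B v∉B
    ... | no v∉S with v ∈? setBit b (setBit b′ B S) S
    ...   | yes v∈ = v∈
    ...   | no v∉ = contradiction v∈B (setBit-outside⁻ b′ false v∉S (setBit-outside⁻ b false v∉S v∉))

  -- If all of `S` carried the mark `k`, then `k` and `S` determine what was overwritten. This is
  -- why a single number per vertex can encode a chain of sets.
  setMarks-restore : ∀ k k′ Bs {S} → (∀ {v} → v ∈ S → Marked v k Bs) →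
                     setMarks S k (setMarks S k′ Bs) ≡ Bs
  setMarks-restore k k′ []       marks = refl
  setMarks-restore k k′ (B ∷ Bs) marks = cong₂ _∷_
    (setBit-restore (odd? k) (odd? k′) (proj₁ ∘ marks))
    (setMarks-restore (k / 2) (k′ / 2) Bs (proj₂ ∘ marks))

pair : Player → ℕ → ℕ → Player → ℕ
pair Even a b Even = a
pair Even a b Odd  = b
pair Odd  a b Even = b
pair Odd  a b Odd  = a

parity-% : ∀ k → parity k ≡ Even × k % 2 ≡ 0 ⊎ parity k ≡ Odd × k % 2 ≡ 1
parity-% zero          = inj₁ (refl , refl)
parity-% (suc zero)    = inj₂ (refl , refl)
parity-% (suc (suc k)) = parity-% k

-- The successive levels h, f h, f (f h), … up to the first one that satisfies P, which is g.
data Search (P : ℕ → Set) (f : ℕ → ℕ) (V : ℕ) : ℕ → ℕ → ℕ → Set where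
  found : ∀ {h} → P h → Search P f V h h 0
  next  : ∀ {h g r} → ¬ P h → f h ≤ V → Search P f V (f h) g r → Search P f V h g (suc r)

search-up : ∀ {P V} r {h g} → r + h ≡ g → P g → (∀ {k} → h ≤ k → k < g → ¬ P k) → g ≤ V →
            Search P suc V h g r
search-up zero    refl Pg absent g≤V = found Pg
search-up {V = V} (suc r) {h} {g} eq   Pg absent g≤V =
  next (absent ≤-refl (≤-trans (s≤s (m≤n+m h r)) (≤-reflexive eq)))
       (≤-trans (≤-trans (m≤n+m (suc h) r) (≤-reflexive eq′)) g≤V)
       (search-up r eq′ Pg (λ h<k → absent (≤-trans (n≤1+n h) h<k)) g≤V)
  where
  eq′ : r + suc h ≡ g
  eq′ = trans (+-suc r h) eq

abstract
  search-down : ∀ {P V} → (∀ k → Dec (P k)) → ∀ h {g} → P g → g ≤ h → h ≤ V →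
                ∃ λ h′ → ∃ λ r → Search P (_∸ 1) V h h′ r × P h′ × g ≤ h′ × h′ ≤ h × r ≤ h
                  × (∀ {k} → h′ < k → k ≤ h → ¬ P k)
  search-down P? h Pg g≤h h≤V with P? h
  ... | yes Ph = h , 0 , found Ph , Ph , g≤h , ≤-refl , z≤n , λ h<k k≤h _ → <⇒≱ h<k k≤h
  search-down {P} P? zero {g} Pg g≤h h≤V | no ¬P0 = contradiction (subst P (n≤0⇒n≡0 g≤h) Pg) ¬P0
  search-down {P} P? (suc h) {g} Pg g≤h h≤V | no ¬Ph with m≤n⇒m<n∨m≡n g≤h
  ... | inj₂ refl = contradiction Pg ¬Ph
  ... | inj₁ (s≤s g≤h′) with search-down P? h Pg g≤h′ (≤-trans (n≤1+n h) h≤V)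
  ...   | h′ , r , s , Ph′ , g≤ , ≤h , r≤ , absent =
          h′ , suc r , next ¬Ph (≤-trans (n≤1+n h) h≤V) s , Ph′ , g≤ , m≤n⇒m≤1+n ≤h , s≤s r≤ , absent′
    where
    absent′ : ∀ {k} → h′ < k → k ≤ suc h → ¬ P k
    absent′ h′<k k≤ with m≤n⇒m<n∨m≡n k≤
    ... | inj₂ refl = ¬Ph
    ... | inj₁ (s≤s k≤h) = absent h′<k k≤h

-- Effect and duration of the program fragments

module Machine (G : ParityGame) (n d m V : ℕ) (size≤n : size G ≤ n)
               (n≤V : n ≤ V) (K≤V : 4 + (d + d) ≤ V) (limit≤V : 8 + m ≤ V) where

  open Game G public
  open Marks {size G} public
  open Execution G V (8 + m) public

  record Scratch : Set where
    field
      i t w : ℕ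
      x₁ x₂ x₃ x₄ x₅ x₆ : VertexSet G

  open Scratch public

  record Frame : Set where
    field
      lvl dep stk : ℕ
      prec        : Player → ℕ
      md          : ℕ
      Z           : VertexSet G
      bits        : List (VertexSet G)

  open Frame public

  K : ℕ
  K = 4 + (d + d)

  -- Explicit lists let the effect of a block be found by evaluation. A frame holds what the
  -- correctness argument tracks; the scratch contents are mostly hidden behind an existential
  -- quantifier.
  mem : Frame → Scratch → State G
  mem F j =
    ⟨ n ∷ d ∷ lvl F ∷ dep F ∷ stk F ∷ prec F Even ∷ prec F Odd ∷ md F ∷ K ∷ 8 + m ∷ i j ∷ t j ∷ w j
      ∷ 0 ∷ 1 ∷ 2 ∷ 3 ∷ 4 ∷ 5 ∷ 6 ∷ 7 ∷ []
    , Z F ∷ x₁ j ∷ x₂ j ∷ x₃ j ∷ x₄ j ∷ x₅ j ∷ x₆ j ∷ ∅ ∷ bits F ⟩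

  -- The unit of time. Up to constants it covers a fixpoint loop of `n` rounds, a pass over the `m`
  -- mark bits and a scan over at most `d` levels.
  u : ℕ
  u = 1 + (n + (m + d))

  record Within (k : ℕ) (P : Program) (s s′ : State G) : Set where
    constructor within
    field
      get : Exec P s s′ (k * u)

  open Within public

  okW : ∀ {k P s s′} → Within k P s s′ → OK s′
  okW (within e) = ok e

  units : ∀ k {t} → t ≤ k → t ≤ k * u
  units k t≤k = ≤-trans t≤k (m≤m*n k u)

  infixr 4 _»_

  _»_ : ∀ {a b P Q s s′ s″} → Within a P s s′ → Within b Q s′ s″ → Within (a + b) (P ⨾ Q) s s″
  _»_ {a} {b} (within e) (within e′) = within (weaken (≤-reflexive (sym (*-distribʳ-+ u a b))) (e then e′))

  constant : ∀ {k P s s′} → Exec P s s′ k → Within k P s s′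
  constant {k} e = within (weaken (units k ≤-refl) e)

  whenTrue : ∀ {k c P Q s s′} → evalTest G s c ≡ true → Within k P s s′ →
             Within (1 + k) (if c then P else Q) s s′
  whenTrue c (within e) = within (weaken (+-monoˡ-≤ _ (s≤s z≤n)) (exec-true c e))

  whenFalse : ∀ {k c P Q s s′} → evalTest G s c ≡ false → Within k Q s s′ →
              Within (1 + k) (if c then P else Q) s s′
  whenFalse c (within e) = within (weaken (+-monoˡ-≤ _ (s≤s z≤n)) (exec-false c e))

  linear : ∀ a {b c k} → b ≤ c → k ≤ n + (m + d) → b + k * a ≤ (c + a) * u
  linear a {b} {c} {k} b≤c k≤ = begin
    b + k * a       ≤⟨ +-mono-≤ b≤c (*-monoˡ-≤ a (m≤n⇒m≤1+n k≤)) ⟩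
    c + u * a       ≤⟨ +-mono-≤ (m≤m*n c u) (≤-reflexive (*-comm u a)) ⟩
    c * u + a * u   ≡⟨ *-distribʳ-+ u c a ⟨
    (c + a) * u     ∎
    where open ≤-Reasoning

  m≤u : m ≤ n + (m + d)
  m≤u = ≤-trans (m≤m+n m d) (m≤n+m (m + d) n)

  d≤u : d ≤ n + (m + d)
  d≤u = ≤-trans (m≤n+m d m) (m≤n+m (m + d) n)

  restrict-loop : ∀ p r F j → i j + r ≡ n → OK (mem F j) →
    ∃ λ j′ → Exec (while less pointer 0 loop restrict p)
                  (mem F j) (mem F j′) (1 + r * 11)
           × x₁ j′ ≡ x₁ j × x₃ j′ ≡ restrictions p (x₂ j) r (x₃ j)
  restrict-loop p zero F j eq ok = j
    , exec-stop ok (does-no (i j <? n) (<-irrefl (trans (sym (+-identityʳ _)) eq)))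
    , refl , refl
  restrict-loop p (suc r) F j eq ok₀ =
    let j′ , e′ , x₁≡ , x₃≡ = restrict-loop p r F j₁ (trans (sym (+-suc (i j) r)) eq) (ok e)
    in j′ , exec-repeat (does⁺ (i j <? n) i<n) e e′ , x₁≡ , x₃≡
    where
    i<n : i j < n
    i<n = ≤-trans (s≤s (m≤m+n (i j) r)) (≤-reflexive (trans (sym (+-suc (i j) r)) eq))
    q = p ⁻¹
    y₄ = cpre G q (x₃ j ∪ x₂ j) ∩ ownedBy G p
    y₅ = cpre G q (x₃ j) ∩ ownedBy G q
    j₁ : Scratch
    j₁ = record { i = 1 + i j ; t = t j ; w = w j ; x₁ = x₁ j ; x₂ = x₂ j ; x₃ = x₃ j ∩ (y₄ ∪ y₅)
                ; x₄ = y₄ ∪ y₅ ; x₅ = y₅ ; x₆ = ownedBy G q }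
    e : Exec (restrict p) (mem F j) (mem F j₁) 10
    e = exec-block _ _ ok₀ (_ , _ , _ , _ , _ , _ , _ , _ , _ , _ , ≤-trans i<n n≤V)

  abstract
    restrictW : ∀ p F j → OK (mem F j) → x₃ j ⊆ x₁ j →
      ∃ λ j′ → Within 15 (restrictTo p) (mem F j) (mem F j′)
             × x₁ j′ ≡ x₁ j × MaxTrap p (x₁ j) (x₃ j) (x₃ j′)
    restrictW p F j ok₀ x₃⊆x₁ =
      let j′ , e′ , x₁≡ , x₃≡ = restrict-loop p n F j₁ refl (ok e)
      in j′ , within (weaken (linear 11 {4} ≤-refl (m≤m+n n (m + d))) (e then e′)) , x₁≡
       , subst (MaxTrap p (x₁ j) (x₃ j)) (sym x₃≡) (restrictions-trap {p} {x₁ j} {n} {x₃ j} size≤n x₃⊆x₁)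
      where
      j₁ : Scratch
      j₁ = record j { i = 0 ; x₂ = full ─ x₁ j }
      e : Exec (block (assignSet c2 all) (assignSet c2 (setOp difference c2 c1) ∷ assign pointer (lit 0) ∷ []))
               (mem F j) (mem F j₁) 3
      e = exec-block _ _ ok₀ (_ , _ , _ , z≤n)

  read-middle : ∀ (done : List (VertexSet G)) {B Bs} → read ∅ (done ++ˡ (B ∷ Bs)) (length done) ≡ B
  read-middle []         = refl
  read-middle (_ ∷ done) = read-middle done

  write-middle : ∀ (done : List (VertexSet G)) {B B′ Bs} → write ∅ (length done) B′ (done ++ˡ (B ∷ Bs)) ≡ done ++ˡ (B′ ∷ Bs)
  write-middle []             = refl
  write-middle (C ∷ done) {B} = cong (C ∷_) (write-middle done {B})

  length-∷ʳ : ∀ (done : List (VertexSet G)) {B} → suc (length done) ≡ length (done ++ˡ (B ∷ []))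
  length-∷ʳ []         = refl
  length-∷ʳ (_ ∷ done) = cong suc (length-∷ʳ done)

  branchOn : Bool → Instruction → Instruction → Instruction
  branchOn true  one zer = one
  branchOn false one zer = zer

  t≤V : ∀ {F j} → OK (mem F j) → t j ≤ V
  t≤V (_ , (_ ∷ _ ∷ _ ∷ _ ∷ _ ∷ _ ∷ _ ∷ _ ∷ _ ∷ _ ∷ _ ∷ t≤ ∷ _) , _) = t≤

  exec-bit : ∀ F j one zer {s′} → OK (mem F j) →
    (OK (mem F (record j { w = t j % 2 })) →
     Exec (instr (branchOn (odd? (t j)) one zer)) (mem F (record j { w = t j % 2 })) s′ 1) →
    Exec (instr (assign digit (op remainder value c2)) ⨾ (if less c0 digit then instr one else instr zer))
         (mem F j) s′ 3
  exec-bit F j one zer {s′} ok₀ rest = e then branch (odd? (t j)) refl (rest (ok e))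
    where
    e : Exec (instr (assign digit (op remainder value c2))) (mem F j) (mem F (record j { w = t j % 2 })) 1
    e = exec-instr (assign digit (op remainder value c2)) ok₀ (_ , ≤-trans (m%n≤m (t j) 2) (t≤V {F} {j} ok₀))
    branch : ∀ b → odd? (t j) ≡ b → Exec (instr (branchOn b one zer)) (mem F (record j { w = t j % 2 })) s′ 1 →
             Exec (if less c0 digit then instr one else instr zer) (mem F (record j { w = t j % 2 })) s′ 2
    branch true  = exec-true
    branch false = exec-false

  next-bit : ∀ F j k → k < m → OK (mem F (record j { i = 8 + k })) →
    Exec (block (assign value (op quotient value c2)) (assign pointer (op plus c1 pointer) ∷ []))
         (mem F (record j { i = 8 + k })) (mem F (record j { i = 9 + k ; t = t j / 2 })) 2
  next-bit F j k k<m ok₀ = exec-block _ _ ok₀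
    ((_ , ≤-trans (m/n≤m (t j) 2) (t≤V {F} {record j { i = 8 + k }} ok₀)) , (_ , ≤-trans (+-monoʳ-≤ 8 k<m) limit≤V))

  k<m : ∀ {k l} → k + suc l ≡ m → k < m
  k<m {k} {l} eq = ≤-trans (s≤s (m≤m+n k l)) (≤-reflexive (trans (sym (+-suc k l)) eq))

  guard : ∀ F j {k} → k < m → evalTest G (mem F (record j { i = 8 + k })) (less pointer limit) ≡ true
  guard F j {k} k< = does⁺ (8 + k <? 8 + m) (+-monoʳ-< 8 k<)

  no-guard : ∀ F j {k} → k + 0 ≡ m → evalTest G (mem F (record j { i = 8 + k })) (less pointer limit) ≡ false
  no-guard F j {k} eq = does-no (8 + k <? 8 + m) (<-irrefl (cong (8 +_) (trans (sym (+-identityʳ k)) eq)))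

  mark-one mark-zero select-one select-zero : Instruction
  mark-one    = assignSet pointer (setOp union pointer c1)
  mark-zero   = assignSet pointer (setOp difference pointer c1)
  select-one  = assignSet c1 (setOp intersection c1 pointer)
  select-zero = assignSet c1 (setOp difference c1 pointer)

  mark-loop : ∀ F j done Bs {bs bs′ k} → bs ≡ done ++ˡ Bs → bs′ ≡ done ++ˡ setMarks (x₁ j) (t j) Bs →
    k ≡ length done → k + length Bs ≡ m → OK (mem (record F { bits = bs }) (record j { i = 8 + k })) →
    ∃ λ j′ → Exec (overBits mark-one mark-zero) (mem (record F { bits = bs }) (record j { i = 8 + k }))
                  (mem (record F { bits = bs′ }) j′) (1 + length Bs * 6)
           × x₁ j′ ≡ x₁ j
  mark-loop F j done [] refl refl refl eq ok₀ =
    record j { i = 8 + length done } , exec-stop ok₀ (no-guard F j eq) , refl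
  mark-loop F j done (B ∷ Bs) refl refl refl eq ok₀ =
    let b = odd? (t j)
        B′ = setBit b B (x₁ j)
        F₁ = record F { bits = done ++ˡ (B′ ∷ Bs) }
        j₁ = record j { i = 8 + length done ; w = t j % 2 }
        e₁ = exec-bit F₀ j₀ mark-one mark-zero {mem F₁ j₁} ok₀ (write-bit b)
        e₂ = next-bit F₁ j₁ (length done) (k<m eq) (ok e₁)
        j′ , e , x₁≡ = mark-loop F (record j₁ { t = t j / 2 }) (done ++ˡ (B′ ∷ [])) Bs
          (sym (++-assoc done (B′ ∷ []) Bs)) (sym (++-assoc done (B′ ∷ []) (setMarks (x₁ j) (t j / 2) Bs)))
          (length-∷ʳ done) (trans (sym (+-suc (length done) (length Bs))) eq) (ok e₂)
    in j′ , exec-repeat (guard F j (k<m eq)) (e₁ then e₂) e , x₁≡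
    where
    F₀ = record F { bits = done ++ˡ (B ∷ Bs) }
    j₀ = record j { i = 8 + length done }
    j₁ = record j₀ { w = t j % 2 }
    here< : T (length done <ᵇ m)
    here< = <⇒<ᵇ (k<m eq)
    written : ∀ b → write ∅ (length done) (setBit b (read ∅ (bits F₀) (length done)) (x₁ j)) (bits F₀) ≡ done ++ˡ (setBit b B (x₁ j) ∷ Bs)
    written b = trans (cong (λ C → write ∅ (length done) (setBit b C (x₁ j)) (bits F₀)) (read-middle done {B} {Bs})) (write-middle done {B})
    write-bit : ∀ b → OK (mem F₀ j₁) → Exec (instr (branchOn b mark-one mark-zero)) (mem F₀ j₁)
                  (mem (record F { bits = done ++ˡ (setBit b B (x₁ j) ∷ Bs) }) j₁) 1
    write-bit true  ok₁ = subst (λ bs → Exec (instr mark-one) (mem F₀ j₁) (mem (record F { bits = bs }) j₁) 1)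
      (written true) (exec-instr mark-one {mem F₀ j₁} ok₁ here<)
    write-bit false ok₁ = subst (λ bs → Exec (instr mark-zero) (mem F₀ j₁) (mem (record F { bits = bs }) j₁) 1)
      (written false) (exec-instr mark-zero {mem F₀ j₁} ok₁ here<)

  abstract
    markW : ∀ F j → length (bits F) ≡ m → OK (mem F j) →
      ∃ λ j′ → Within 8 mark (mem F j) (mem (record F { bits = setMarks (x₁ j) (t j) (bits F) }) j′)
             × x₁ j′ ≡ x₁ j
    markW F j len ok₀ =
      let e = exec-instr (assign pointer (lit 8)) {mem F j} ok₀ (_ , ≤-trans (m≤m+n 8 m) limit≤V)
          j′ , e′ , x₁≡ = mark-loop F j [] (bits F) refl refl refl len (ok e)
      in j′ , within (weaken (≤-trans (≤-reflexive (cong (λ l → 2 + l * 6) len)) (linear 6 {2} ≤-refl m≤u)) (e then e′)) , x₁≡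

  select-loop : ∀ F j done Bs {k} → bits F ≡ done ++ˡ Bs →
    k ≡ length done → k + length Bs ≡ m → OK (mem F (record j { i = 8 + k })) →
    ∃ λ j′ → Exec (overBits select-one select-zero) (mem F (record j { i = 8 + k }))
                  (mem F j′) (1 + length Bs * 6)
           × x₁ j′ ≡ selectMarked (x₁ j) (t j) Bs
  select-loop F j done [] eqB refl eq ok₀ =
    record j { i = 8 + length done } , exec-stop ok₀ (no-guard F j eq) , refl
  select-loop F j done (B ∷ Bs) {k} eqB refl eq ok₀ =
    let b = odd? (t j)
        j₁ = record j { i = 8 + length done ; w = t j % 2 ; x₁ = selectBit b (x₁ j) B }
        e₁ = exec-bit F j₀ select-one select-zero {mem F j₁} ok₀ (select-bit b)
        e₂ = next-bit F j₁ (length done) (k<m eq) (ok e₁)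
        j′ , e , x₁≡ = select-loop F (record j₁ { t = t j / 2 }) (done ++ˡ (B ∷ [])) Bs
          (trans eqB (sym (++-assoc done (B ∷ []) Bs)))
          (length-∷ʳ done) (trans (sym (+-suc (length done) (length Bs))) eq) (ok e₂)
    in j′ , exec-repeat (guard F j (k<m eq)) (e₁ then e₂) e , x₁≡
    where
    j₀ = record j { i = 8 + length done }
    j₁ = record j₀ { w = t j % 2 }
    B≡ : read ∅ (bits F) (length done) ≡ B
    B≡ = trans (cong (λ bs → read ∅ bs (length done)) eqB) (read-middle done {B} {Bs})
    select-bit : ∀ b → OK (mem F j₁) →
      Exec (instr (branchOn b select-one select-zero)) (mem F j₁) (mem F (record j₁ { x₁ = selectBit b (x₁ j) B })) 1
    select-bit true  ok₁ = subst (λ C → Exec (instr select-one) (mem F j₁) (mem F (record j₁ { x₁ = x₁ j ∩ C })) 1)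
      B≡ (exec-instr select-one {mem F j₁} ok₁ _)
    select-bit false ok₁ = subst (λ C → Exec (instr select-zero) (mem F j₁) (mem F (record j₁ { x₁ = x₁ j ─ C })) 1)
      B≡ (exec-instr select-zero {mem F j₁} ok₁ _)

  abstract
    markedW : ∀ F j → length (bits F) ≡ m → OK (mem F j) →
      ∃ λ j′ → Within 9 marked (mem F j) (mem F j′) × x₁ j′ ≡ selectMarked full (t j) (bits F)
    markedW F j len ok₀ =
      let e = exec-block (assign pointer (lit 8)) (assignSet c1 all ∷ []) {mem F j} ok₀ ((_ , ≤-trans (m≤m+n 8 m) limit≤V) , _)
          j′ , e′ , x₁≡ = select-loop F (record j { x₁ = full }) [] (bits F) refl refl len (ok e)
      in j′ , within (weaken (≤-trans (≤-reflexive (cong (λ l → 3 + l * 6) len)) (linear 6 {3} ≤-refl m≤u)) (e then e′)) , x₁≡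

  Present : ℕ → Set
  Present k = Nonempty (withPriority G k)

  nonempty-test : ∀ F j → Nonempty (x₃ j) → evalTest G (mem F j) (subset c3 c7) ≡ false
  nonempty-test F j (v , v∈) = does-no (x₃ j ⊆? ∅) λ ⊆∅ → ∉⊥ (⊆∅ v∈)

  empty-test : ∀ F j → ¬ Nonempty (x₃ j) → evalTest G (mem F j) (subset c3 c7) ≡ true
  empty-test F j empty = does⁺ (x₃ j ⊆? ∅) λ {v} v∈ → contradiction (v , v∈) empty

  module Scan (e : NumExp) (f : ℕ → ℕ) (eval : ∀ F j → evalNum G (mem F j) e ≡ f (lvl F)) where

    visit : ∀ F j → OK (mem F j) → f (lvl F) ≤ V →
      Exec (moveTo e) (mem F j)
           (mem (record F { lvl = f (lvl F) }) (record j { x₃ = withPriority G (f (lvl F)) })) 2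
    visit F j ok₀ f≤V =
      subst (λ k → Exec (moveTo e) (mem F j)
                        (mem (record F { lvl = k }) (record j { x₃ = withPriority G k })) 2)
            (eval F j)
            (exec-block (assign level e) (assignSet c3 (priority level) ∷ []) {mem F j} ok₀
              ((_ , subst (_≤ V) (sym (eval F j)) f≤V) , _))

    scanning : ∀ F j {g r} → OK (mem F j) → x₃ j ≡ withPriority G (lvl F) → Search Present f V (lvl F) g r →
      ∃ λ j′ → Exec (while subset c3 c7 loop moveTo e)
                    (mem F j) (mem (record F { lvl = g }) j′) (1 + r * 3)
             × x₁ j′ ≡ x₁ j × x₃ j′ ≡ withPriority G g
    scanning F j ok₀ x₃≡ (found Ph) =
      j , exec-stop ok₀ (nonempty-test F j (subst Nonempty (sym x₃≡) Ph)) , refl , x₃≡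
    scanning F j ok₀ x₃≡ (next ¬Ph f≤V s) =
      let e₁ = visit F j ok₀ f≤V
          j′ , e₂ , rest = scanning (record F { lvl = f (lvl F) }) (record j { x₃ = withPriority G (f (lvl F)) })
                             (ok e₁) refl s
      in j′ , exec-repeat (empty-test F j (¬Ph ∘ subst Nonempty x₃≡)) e₁ e₂ , rest

    abstract
      scanW : ∀ F j {g r} → OK (mem F j) → f (lvl F) ≤ V → r ≤ d → Search Present f V (f (lvl F)) g r →
        ∃ λ j′ → Within 6 (scan e) (mem F j) (mem (record F { lvl = g }) j′)
               × x₁ j′ ≡ x₁ j × x₃ j′ ≡ withPriority G g
      scanW F j {g} {r} ok₀ f≤V r≤d s =
        let e₁ = visit F j ok₀ f≤V
            j′ , e₂ , rest = scanning (record F { lvl = f (lvl F) }) (record j { x₃ = withPriority G (f (lvl F)) })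
                               (ok e₁) refl s
        in j′ , within (weaken (linear 3 {3} ≤-refl (≤-trans r≤d d≤u)) (e₁ then e₂)) , rest

  module ScanDown = Scan (op monus level c1) (_∸ 1) (λ _ _ → refl)
  module ScanUp   = Scan (op plus c1 level) suc (λ _ _ → refl)

  frame< : ∀ {l} → l ≤ d → 1 + (l + l) < K
  frame< {l} l≤d = s≤s (s≤s (≤-trans (+-mono-≤ l≤d l≤d) (m≤n+m (d + d) 2)))

  left right : Frame → ℕ
  left  F = (lvl F + lvl F) + stk F * K
  right F = (1 + (lvl F + lvl F)) + stk F * K

  push≤V : ∀ S {x} → S * K + K ≤ V → x < K → x + S * K ≤ V
  push≤V S {x} S≤V x<K = ≤-trans (≤-trans (≤-reflexive (+-comm x _)) (+-monoʳ-≤ (S * K) (<⇒≤ x<K))) S≤V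

  2l<K : ∀ {l} → l ≤ d → l + l < K
  2l<K l≤d = ≤-trans (n≤1+n _) (frame< l≤d)

  2l≤V : ∀ {l} → l ≤ d → l + l ≤ V
  2l≤V l≤d = ≤-trans (<⇒≤ (2l<K l≤d)) K≤V

  _for_,_,_ : Frame → Player → ℕ → ℕ → Frame
  F for p , a , b = record F { prec = pair p a b }

  abstract
    pushLeftW : ∀ p F j a b → lvl F ≤ d → stk F * K + K ≤ V → OK (mem (F for p , a , suc b) j) →
      ∃ λ j′ → Within 4 (pushLeft p) (mem (F for p , a , suc b) j)
        (mem (record F { stk = left F } for p , a , b) j′)
    pushLeftW p F j a b l≤d S≤V ok₀ = record j { t = lvl F + lvl F } , constant (go p ok₀)
      where
      fits : stk F * K ≤ V × lvl F + lvl F ≤ V × (lvl F + lvl F) + stk F * K ≤ V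
      fits = push≤V (stk F) {0} S≤V (s≤s z≤n) , 2l≤V l≤d , push≤V (stk F) S≤V (2l<K l≤d)
      -- The address of a precision depends on the player, so evaluation needs a concrete one.
      go : ∀ p → OK (mem (F for p , a , suc b) j) →
        Exec (pushLeft p) (mem (F for p , a , suc b) j)
          (mem (record F { stk = left F } for p , a , b) (record j { t = lvl F + lvl F })) 4
      go Even ok₀@(_ , (_ ∷ _ ∷ _ ∷ _ ∷ _ ∷ _ ∷ b≤V ∷ _) , _) = let S≤ , 2l≤ , S′≤ = fits in
        exec-block _ _ ok₀ ((_ , S≤) , (_ , 2l≤) , (_ , S′≤) , (_ , ≤-trans (n≤1+n b) b≤V))
      go Odd  ok₀@(_ , (_ ∷ _ ∷ _ ∷ _ ∷ _ ∷ b≤V ∷ _) , _) = let S≤ , 2l≤ , S′≤ = fits in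
        exec-block _ _ ok₀ ((_ , S≤) , (_ , 2l≤) , (_ , S′≤) , (_ , ≤-trans (n≤1+n b) b≤V))

    pushRightW : ∀ p F j a b → lvl F ≤ d → stk F * K + K ≤ V → OK (mem (F for p , a , suc b) j) →
      ∃ λ j′ → Within 6 (pushRight p) (mem (F for p , a , suc b) j)
        (mem (record F { stk = right F ; md = 0 } for p , a , b) j′)
    pushRightW p F j a b l≤d S≤V ok₀ = record j { t = 1 + (lvl F + lvl F) } , constant (go p ok₀)
      where
      fits : stk F * K ≤ V × 1 + (lvl F + lvl F) ≤ V × (1 + (lvl F + lvl F)) + stk F * K ≤ V
      fits = push≤V (stk F) {0} S≤V (s≤s z≤n) , ≤-trans (<⇒≤ (frame< l≤d)) K≤V , push≤V (stk F) S≤V (frame< l≤d)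
      go : ∀ p → OK (mem (F for p , a , suc b) j) →
        Exec (pushRight p) (mem (F for p , a , suc b) j)
          (mem (record F { stk = right F ; md = 0 } for p , a , b)
               (record j { t = 1 + (lvl F + lvl F) })) 6
      go Even ok₀@(_ , (_ ∷ _ ∷ _ ∷ _ ∷ _ ∷ _ ∷ b≤V ∷ _) , _) = let S≤ , 1+2l≤ , S′≤ = fits in
        exec-block _ _ ok₀ ((_ , S≤) , (_ , 2l≤V l≤d) , (_ , 1+2l≤) , (_ , S′≤) , (_ , ≤-trans (n≤1+n b) b≤V) , (_ , z≤n))
      go Odd  ok₀@(_ , (_ ∷ _ ∷ _ ∷ _ ∷ _ ∷ b≤V ∷ _) , _) = let S≤ , 1+2l≤ , S′≤ = fits in
        exec-block _ _ ok₀ ((_ , S≤) , (_ , 2l≤V l≤d) , (_ , 1+2l≤) , (_ , S′≤) , (_ , ≤-trans (n≤1+n b) b≤V) , (_ , z≤n))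

  abstract
    popW : ∀ p F j a b → suc b ≤ V → OK (mem (F for p , a , b) j) →
      Within 3 (pop p) (mem (F for p , a , b) j)
        (mem (record F { prec = pair p a (suc b) ; stk = stk F / K }) (record j { w = w j ∸ 1 }))
    popW p F j a b b<V ok₀ = constant (go p ok₀)
      where
      go : ∀ p → OK (mem (F for p , a , b) j) →
        Exec (pop p) (mem (F for p , a , b) j)
        (mem (record F { prec = pair p a (suc b) ; stk = stk F / K }) (record j { w = w j ∸ 1 })) 3
      go Even ok₀@(_ , (_ ∷ _ ∷ _ ∷ _ ∷ S≤V ∷ _ ∷ _ ∷ _ ∷ _ ∷ _ ∷ _ ∷ _ ∷ w≤V ∷ _) , _) =
        exec-block _ _ ok₀ ((_ , ≤-trans (m/n≤m (stk F) K) S≤V) , (_ , b<V) , (_ , ≤-trans (m∸n≤m (w j) 1) w≤V))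
      go Odd ok₀@(_ , (_ ∷ _ ∷ _ ∷ _ ∷ S≤V ∷ _ ∷ _ ∷ _ ∷ _ ∷ _ ∷ _ ∷ _ ∷ w≤V ∷ _) , _) =
        exec-block _ _ ok₀ ((_ , ≤-trans (m/n≤m (stk F) K) S≤V) , (_ , b<V) , (_ , ≤-trans (m∸n≤m (w j) 1) w≤V))

  abstract

    parity-ok : ∀ F j → OK (mem F j) → lvl F ≤ V → OK (mem F (record j { w = lvl F % 2 }))
    parity-ok F j ok₀ l≤V =
      ok (exec-instr (assign digit (op remainder level c2)) {mem F j} ok₀ (_ , ≤-trans (m%n≤m (lvl F) 2) l≤V))

    byParityW : ∀ P {p k s′} F j → OK (mem F j) → lvl F ≤ V → parity (lvl F) ≡ p →
      Within k (P p) (mem F (record j { w = lvl F % 2 })) s′ → Within (2 + k) (byParity P) (mem F j) s′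
    byParityW P {p} {k} {s′} F j ok₀ l≤V p≡ rest = e » branch
      where
      e : Within 1 (instr (assign digit (op remainder level c2))) (mem F j) (mem F (record j { w = lvl F % 2 }))
      e = constant (exec-instr (assign digit (op remainder level c2)) ok₀ (_ , ≤-trans (m%n≤m (lvl F) 2) l≤V))
      branch : Within (1 + k) (if less c0 digit then P Odd else P Even) (mem F (record j { w = lvl F % 2 })) s′
      branch with parity-% (lvl F)
      ... | inj₁ (even , r) = whenFalse (cong (λ r → does (0 <? r)) r)
              (subst (λ p → Within k (P p) (mem F (record j { w = lvl F % 2 })) s′) (trans (sym p≡) even) rest)
      ... | inj₂ (odd , r) = whenTrue (cong (λ r → does (0 <? r)) r)
              (subst (λ p → Within k (P p) (mem F (record j { w = lvl F % 2 })) s′) (trans (sym p≡) odd) rest)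

  d<V : 1 + d ≤ V
  d<V = ≤-trans (s≤s (≤-trans (m≤m+n d d) (m≤n+m (d + d) 3))) K≤V

  d≤V : d ≤ V
  d≤V = ≤-trans (n≤1+n d) d<V

  _at_,_,_,_ : Frame → Player → ℕ → ℕ → ℕ → Frame
  F at p , a , b , md′ = record F { prec = pair p a b ; md = md′ }

  callW-zero : ∀ p F j a → OK (mem (F at p , a , 0 , 0) j) → lvl F ≤ V →
    parity (lvl F) ≡ p →
    ∃ λ j′ → Within 5 body (mem (F at p , a , 0 , 0) j)
                           (mem (F at p , a , 0 , 1) j′)
  callW-zero p F j a ok₀ l≤V p≡ =
    _ , whenTrue refl (byParityW call F₀ j ok₀ l≤V p≡ (go p (parity-ok F₀ j ok₀ l≤V)))
    where
    F₀ = F at p , a , 0 , 0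
    j₁ = record j { w = lvl F % 2 }
    1≤V : 1 ≤ V
    1≤V = ≤-trans (s≤s z≤n) K≤V
    go : ∀ p → OK (mem (F at p , a , 0 , 0) j₁) →
         Within 2 (call p) (mem (F at p , a , 0 , 0) j₁)
                           (mem (F at p , a , 0 , 1) j₁)
    go Even ok₁ = whenFalse refl (constant (exec-instr (assign mode (lit 1)) ok₁ (_ , 1≤V)))
    go Odd  ok₁ = whenFalse refl (constant (exec-instr (assign mode (lit 1)) ok₁ (_ , 1≤V)))

  callW-suc : ∀ p F j a b → OK (mem (F at p , a , suc b , 0) j) → lvl F ≤ d →
    stk F * K + K ≤ V → parity (lvl F) ≡ p →
    ∃ λ j′ → Within 8 body (mem (F at p , a , suc b , 0) j)
      (mem (record F { prec = pair p a b ; stk = left F ; md = 0 }) j′)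
  callW-suc p F j a b ok₀ l≤d S≤V p≡ =
    _ , whenTrue refl (byParityW call F₀ j ok₀ l≤V p≡
          (go p (proj₂ (pushLeftW p F′ j₁ a b l≤d S≤V (parity-ok F₀ j ok₀ l≤V)))))
    where
    l≤V = ≤-trans l≤d d≤V
    F₀ = F at p , a , suc b , 0
    j₁ = record j { w = lvl F % 2 }
    F′ = record F { md = 0 }
    go : ∀ p {s′} → Within 4 (pushLeft p) (mem (F at p , a , suc b , 0) j₁) s′ →
         Within 5 (call p) (mem (F at p , a , suc b , 0) j₁) s′
    go Even e = whenTrue refl e
    go Odd  e = whenTrue refl e

  innerBits : Frame → List (VertexSet G)
  innerBits F = setMarks (Z F) (suc (dep F)) (bits F)

  inner : Frame → ℕ → VertexSet G → Frame
  inner F h′ H = record F { lvl = h′ ; dep = suc (dep F) ; Z = H ; bits = innerBits F }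

  LowTrap : Player → Frame → VertexSet G → Set
  LowTrap p F = MaxTrap p (Z F) (Z F ─ withPriority G (lvl F))

  Emptied : ∀ p (F : Frame) j a b (H : VertexSet G) → Set
  Emptied p F j a b H = ¬ Nonempty H × ∃ λ j′ →
    Within 25 (descend p) (mem (F for p , a , suc b) j)
      (mem (record F { prec = pair p a b ; stk = right F ; md = 0 }) j′)

  Entered : ∀ p (F : Frame) j (H : VertexSet G) → Set
  Entered p F j H = ∃ λ h′ → ∃ λ j′ →
      Present h′ × h′ < lvl F × (∀ {v} → v ∈ H → π G v ≤ h′) × (∀ {k} → h′ < k → k < lvl F → ¬ Present k)
    × Within 37 (descend p) (mem F j) (mem (record (inner F h′ H) { md = 0 }) j′)

  abstract

    descend-into : ∀ {F j} → OK (mem F j) → x₁ j ≡ Z F → Nonempty (x₃ j) → x₃ j ⊆ Z F → lvl F ≤ d → dep F + lvl F ≤ d →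
      length (bits F) ≡ m → (∀ {v} → v ∈ x₃ j → π G v < lvl F) →
      ∃ λ h′ → ∃ λ j′ →
        Present h′ × h′ < lvl F × (∀ {v} → v ∈ x₃ j → π G v ≤ h′) × (∀ {k} → h′ < k → k < lvl F → ¬ Present k)
      × Within 18 enter (mem F j) (mem (record (inner F h′ (x₃ j)) { md = 0 }) j′)
    descend-into {F} {j} ok₀ x₁≡ (v , v∈H) H⊆Z l≤d δ+l≤d len π<l =
      -- The priority of `v` is a non-empty level below the current one, which is what ends the
      -- search.
      case search-down {Present} {V} (λ k → nonempty? (withPriority G k)) (lvl F ∸ 1)
             (v , ∈-withPriority⁺ {π G v} {v} refl) (∸-monoˡ-≤ 1 (π<l v∈H)) l-1≤V
      of λ { (h′ , r , s , present , _ , h′≤ , r≤ , gap) →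
      case markW F₃ j₃ len (okW e₃) of λ { (j₄ , e₄ , _) →
      case ScanDown.scanW F₄ j₄ (okW e₄) l-1≤V (≤-trans r≤ (≤-trans (m∸n≤m (lvl F) 1) l≤d)) s of λ { (j₅ , e₅ , _) →
        h′ , j₅ , present
      , ≤-trans (s≤s h′≤) (≤-reflexive (m+[n∸m]≡n (≤-trans (s≤s z≤n) (π<l v∈H))))
      , (λ {w} w∈ → case π G w ≤? h′ of λ
          { (yes ≤h′) → ≤h′
          ; (no ≰h′) → contradiction (w , ∈-withPriority⁺ refl) (gap (≰⇒> ≰h′) (∸-monoˡ-≤ 1 (π<l w∈))) })
      , (λ {_} h′<k k<l → gap h′<k (∸-monoˡ-≤ 1 k<l))
      , subst (λ C → Within 18 enter (mem F j)
            (mem (record F₃ { lvl = h′ ; md = 0 ; bits = setMarks C (suc (dep F)) (bits F) }) j₅)) x₁≡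
          (e₃ » e₄ » e₅ » constant (exec-instr (assign mode (lit 0)) {mem (record F₄ { lvl = h′ }) j₅} (okW e₅) (_ , z≤n))) }}}
      where
      l-1≤V : lvl F ∸ 1 ≤ V
      l-1≤V = ≤-trans (m∸n≤m (lvl F) 1) (≤-trans l≤d d≤V)
      1+δ≤V : 1 + dep F ≤ V
      1+δ≤V = ≤-trans (≤-trans (s≤s (m≤m+n (dep F) (lvl F))) (s≤s δ+l≤d)) d<V
      F₃ F₄ : Frame
      F₃ = record F { Z = x₃ j ; dep = suc (dep F) }
      F₄ = record F₃ { bits = setMarks (x₁ j) (suc (dep F)) (bits F) }
      j₃ : Scratch
      j₃ = record j { t = suc (dep F) }
      e₃ : Within 3 deepen
                  (mem F j) (mem F₃ j₃)
      e₃ = constant (subst (λ C → Exec deepen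
                  (mem F j) (mem (record F₃ { Z = C }) j₃) 3) (∪-idem (x₃ j))
                  (exec-block _ _ {mem F j} ok₀ (_ , (_ , 1+δ≤V) , (_ , 1+δ≤V))))

    descendW : ∀ p F j a b → OK (mem (F for p , a , suc b) j) → lvl F ≤ d → dep F + lvl F ≤ d →
      stk F * K + K ≤ V → length (bits F) ≡ m → (∀ {v} → v ∈ Z F → π G v ≤ lvl F) →
      ∃ λ H → LowTrap p F H
            × (Emptied p F j a b H ⊎ Entered p (F for p , a , suc b) j H)
    descendW p F₋ j a b ok₀ l≤d δ+l≤d S≤V len π≤l =
      case restrictW p F j₁ (okW e₁) (p─q⊆p (Z F) N) of λ { (j₂ , e₂ , x₁≡ , trapH) →
        x₃ j₂ , trapH , (case nonempty? (x₃ j₂) of λ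
          { (no empty) → case pushRightW p F₋ j₂ a b l≤d S≤V (okW e₂) of λ { (j′ , e) →
              inj₁ (empty , j′ , (e₁ » e₂ » whenTrue (empty-test F j₂ empty) e)) }
          ; (yes ne) → case descend-into {F} {j₂} (okW e₂) x₁≡ ne (λ v∈ → Trap.sub (MaxTrap.trap trapH) v∈) l≤d δ+l≤d len
                (λ v∈ → ≤∧≢⇒< (π≤l (Trap.sub (MaxTrap.trap trapH) v∈)) λ πv →
                  ─⇒∉ (Z F) N (MaxTrap.below trapH v∈) (∈-withPriority⁺ πv))
              of λ { (h′ , j′ , present , h′<l , bound , gap , e) →
              inj₂ (h′ , j′ , present , h′<l , (λ {_} v∈ → bound v∈) , (λ {_} h′<k k<l → gap h′<k k<l)
                   , (e₁ » e₂ » whenFalse (nonempty-test F j₂ ne) e)) } }) }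
      where
      N : VertexSet G
      N = withPriority G (lvl F₋)
      F : Frame
      F = F₋ for p , a , suc b
      j₁ : Scratch
      j₁ = record j { x₁ = Z F ; x₃ = Z F ─ N }
      e₁ : Within 3 dropLevel
                  (mem F j) (mem F j₁)
      e₁ = constant (subst (λ C → Exec dropLevel
                    (mem F j) (mem F (record j { x₁ = C ; x₃ = C ─ N })) 3)
                    (∪-idem (Z F))
                    (exec-block _ _ {mem F j} ok₀ _))

  -- What the opponent of p′ wins in H, where R is what a level of parity p has left of H.
  lost : Player → Player → (H R : VertexSet G) → VertexSet G
  lost p p′ H R = choose (p ≟ p′) (H ─ R) R

  abstract
    separateW : ∀ p p′ F j → OK (mem F j) →
      Within 2 (separate p p′)
        (mem F j) (mem F (record j { x₃ = x₁ j ─ lost p p′ (x₃ j) (Z F) }))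
    separateW Even Even F j ok₀ = constant (exec-block _ _ ok₀ _)
    separateW Odd  Odd  F j ok₀ = constant (exec-block _ _ ok₀ _)
    separateW Even Odd  F j ok₀ = constant (subst (λ C → Exec (separate Even Odd)
      (mem F j) (mem F (record j { x₃ = x₁ j ─ C })) 2) (∪-idem (Z F)) (exec-block _ _ {mem F j} ok₀ _))
    separateW Odd Even F j ok₀ = constant (subst (λ C → Exec (separate Odd Even)
      (mem F j) (mem F (record j { x₃ = x₁ j ─ C })) 2) (∪-idem (Z F)) (exec-block _ _ {mem F j} ok₀ _))

  abstract
    concludeW : ∀ p p′ F j a b → OK (mem (F for p′ , a , suc b) j) →
      x₃ j ≡ withPriority G (lvl F) → lvl F ≤ d → stk F * K + K ≤ V →
      ∃ λ H → ∃ λ Z₂ → ∃ λ j′ → MaxTrap p′ (x₁ j) (x₁ j ─ withPriority G (lvl F)) H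
        × MaxTrap (p′ ⁻¹) (x₁ j) (x₁ j ─ lost p p′ H (Z F)) Z₂
        × Within 40 (conclude p p′) (mem (F for p′ , a , suc b) j)
            (mem (record F { Z = Z₂ ; prec = pair p′ a b ; stk = right F ; md = 0 }) j′)
    concludeW p p′ F₋ j a b ok₀ x₃≡ l≤d S≤V =
      case restrictW p′ F j₁ (okW e₁) (p─q⊆p (x₁ j) (x₃ j)) of λ { (j₂ , e₂ , x₁≡ , trapH) →
      case restrictW (p′ ⁻¹) F (j₃ j₂) (okW (separateW p p′ F j₂ (okW e₂))) (p─q⊆p (x₁ j₂) (U j₂)) of λ { (j₄ , e₄ , _ , trapZ) →
      case pushRightW p′ (record F₋ { Z = x₃ j₄ }) j₄ a b l≤d S≤V (okW (copied j₄ (okW e₄))) of λ { (j₆ , e₆) →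
        x₃ j₂ , x₃ j₄ , j₆
      , subst (λ N → MaxTrap p′ (x₁ j) (x₁ j ─ N) (x₃ j₂)) x₃≡ trapH
      , subst (λ Y → MaxTrap (p′ ⁻¹) Y (Y ─ U j₂) (x₃ j₄)) x₁≡ trapZ
      , (e₁ » e₂ » separateW p p′ F j₂ (okW e₂) » e₄ » copied j₄ (okW e₄) » e₆) }}}
      where
      F : Frame
      F = F₋ for p′ , a , suc b
      j₁ : Scratch
      j₁ = record j { x₃ = x₁ j ─ x₃ j }
      e₁ : Within 1 (instr (assignSet c3 (setOp difference c1 c3))) (mem F j) (mem F j₁)
      e₁ = constant (exec-instr (assignSet c3 (setOp difference c1 c3)) {mem F j} ok₀ _)
      U : Scratch → VertexSet G
      U j₂ = lost p p′ (x₃ j₂) (Z F₋)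
      j₃ : Scratch → Scratch
      j₃ j₂ = record j₂ { x₃ = x₁ j₂ ─ U j₂ }
      copied : ∀ j → OK (mem F j) → Within 1 (instr (assignSet c0 (setOp union c3 c3))) (mem F j) (mem (record F { Z = x₃ j }) j)
      copied j ok₁ = constant (subst (λ C → Exec (instr (assignSet c0 (setOp union c3 c3))) (mem F j) (mem (record F { Z = C }) j) 1)
        (∪-idem (x₃ j)) (exec-instr (assignSet c0 (setOp union c3 c3)) {mem F j} ok₁ _))

  abstract
    ascendW : ∀ p p′ F j a b {l δ Y} → OK (mem (record F { prec = pair p′ a (suc b) ; dep = suc δ }) j) →
      selectMarked full (suc δ) (bits F) ≡ Y → length (bits F) ≡ m →
      lvl F < l → l ≤ d → Present l → (∀ {k} → lvl F < k → k < l → ¬ Present k) → parity l ≡ p′ →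
      stk F * K + K ≤ V →
      ∃ λ H → ∃ λ Z₂ → ∃ λ j′ → MaxTrap p′ Y (Y ─ withPriority G l) H
        × MaxTrap (p′ ⁻¹) Y (Y ─ lost p p′ H (Z F)) Z₂
        × Within 68 (ascend p) (mem (record F { prec = pair p′ a (suc b) ; dep = suc δ }) j)
            (mem (record F { lvl = l ; dep = δ ; prec = pair p′ a b ; stk = (1 + (l + l)) + stk F * K
                           ; md = 0 ; Z = Z₂ ; bits = setMarks Y δ (bits F) }) j′)
    ascendW p p′ F₋ j a b {l} {δ} {Y} ok₀@(_ , (_ ∷ _ ∷ _ ∷ δ<V ∷ _) , _) select≡ len l< l≤d present absent l≡p′ S≤V =
      case markedW F (record j { t = suc δ }) len (okW e₁) of λ { (j₂ , e₂ , x₁≡₂) →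
      case markW F₃ (record j₂ { t = δ }) len (okW (lowered j₂ (okW e₂))) of λ { (j₄ , e₄ , x₁≡₄) →
      case ScanUp.scanW (F₄ (x₁ j₂)) j₄ (okW e₄) (≤-trans l< l≤V) (≤-trans (m∸n≤m l (suc (lvl F₋))) l≤d)
             (search-up (l ∸ suc (lvl F₋)) (m∸n+n≡m l<) present absent l≤V) of λ { (j₅ , e₅ , x₁≡₅ , x₃≡₅) →
      case concludeW p p′ (record F₋ { lvl = l ; dep = δ ; bits = setMarks (x₁ j₂) δ (bits F₋) })
             (record j₅ { w = l % 2 }) a b (parity-ok (F₅ (x₁ j₂)) j₅ (okW e₅) l≤V) x₃≡₅ l≤d S≤V of λ { (H , Z₂ , j₆ , trapH , trapZ , e₆) →
        H , Z₂ , j₆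
      , subst (λ Y → MaxTrap p′ Y (Y ─ withPriority G l) H) (trans x₁≡₅ (trans x₁≡₄ (trans x₁≡₂ select≡))) trapH
      , subst (λ Y → MaxTrap (p′ ⁻¹) Y (Y ─ lost p p′ H (Z F₋)) Z₂) (trans x₁≡₅ (trans x₁≡₄ (trans x₁≡₂ select≡))) trapZ
      , subst (λ C → Within 68 (ascend p) (mem F j)
            (mem (record F₋ { lvl = l ; dep = δ ; prec = pair p′ a b ; stk = (1 + (l + l)) + stk F₋ * K
                           ; md = 0 ; Z = Z₂ ; bits = setMarks C δ (bits F₋) }) j₆)) (trans x₁≡₂ select≡)
           (e₁ » e₂ » lowered j₂ (okW e₂) » e₄ » e₅ » byParityW (conclude p) (F₅ (x₁ j₂)) j₅ (okW e₅) l≤V l≡p′ e₆) }}}}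
      where
      l≤V : l ≤ V
      l≤V = ≤-trans l≤d d≤V
      F F₃ : Frame
      F = record F₋ { prec = pair p′ a (suc b) ; dep = suc δ }
      F₃ = record F₋ { prec = pair p′ a (suc b) ; dep = δ }
      F₄ F₅ : VertexSet G → Frame
      F₄ C = record F₃ { bits = setMarks C δ (bits F₋) }
      F₅ C = record F₃ { bits = setMarks C δ (bits F₋) ; lvl = l }
      e₁ : Within 1 (instr (assign value (copy depth))) (mem F j) (mem F (record j { t = suc δ }))
      e₁ = constant (exec-instr (assign value (copy depth)) {mem F j} ok₀ (_ , δ<V))
      lowered : ∀ j → OK (mem F j) → Within 2 (block (assign depth (op monus depth c1)) (assign value (copy depth) ∷ []))
        (mem F j) (mem F₃ (record j { t = δ }))
      lowered j ok₁ = constant (exec-block _ _ {mem F j} ok₁ ((_ , ≤-trans (n≤1+n δ) δ<V) , (_ , ≤-trans (n≤1+n δ) δ<V)))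

  returning : Frame → Frame
  returning F = record F { md = 1 }

  module Return (p : Player) (F₋ : Frame) (j : Scratch)
                (ok₀ : OK (mem (returning F₋) j))
                (l≤d : lvl F₋ ≤ d) (l≡p : parity (lvl F₋) ≡ p) where

    F : Frame
    F = returning F₋

    private
      l = lvl F₋
      l≤V : l ≤ V
      l≤V = ≤-trans l≤d d≤V

      j₁ : Scratch
      j₁ = record j { w = l % 2 }

    j₂ : Scratch
    j₂ = record j { w = 2 + (l + l) ; t = stk F₋ % K }

    private
      w≤V : 2 + (l + l) ≤ V
      w≤V = ≤-trans (s≤s (s≤s (≤-trans (+-mono-≤ l≤d l≤d) (m≤n+m (d + d) 2)))) K≤V

      abstract
        e₁ : Within 3 readTop
                (mem F j₁) (mem F j₂)
        e₁ = compute (parity-ok F j ok₀ l≤V)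
          where
          compute : OK (mem F j₁) → Within 3 readTop
                (mem F j₁) (mem F j₂)
          compute ok₁@(_ , (_ ∷ _ ∷ _ ∷ _ ∷ S≤V ∷ _) , _) = constant (exec-block _ _ {mem F j₁} ok₁
            ((_ , ≤-trans (m%n≤m (stk F₋) K) S≤V) , (_ , ≤-trans (m≤n+m (l + l) 2) w≤V) , (_ , w≤V)))

    ok₂ : OK (mem F j₂)
    ok₂ = okW e₁

    abstract

      otherW : 2 + (l + l) ≤ stk F₋ % K → ∀ {k s′} →
        Within k (if less c0 depth then ascend p else instr (assign mode (lit 2))) (mem F j₂) s′ →
        Within (7 + k) body (mem F j) s′
      otherW other {k} e = whenFalse refl (byParityW return F j ok₀ l≤V l≡p
        (e₁ » whenFalse (does-no (stk F₋ % K <? 2 + (l + l)) (≤⇒≯ other)) e))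

      haltW : 2 + (l + l) ≤ stk F₋ % K → dep F₋ ≡ 0 → Within 9 body (mem F j) (mem (record F { md = 2 }) j₂)
      haltW other δ≡0 = otherW other (whenFalse (cong (λ δ → does (0 <? δ)) δ≡0)
        (constant (exec-instr (assign mode (lit 2)) ok₂ (_ , ≤-trans (s≤s (s≤s z≤n)) K≤V))))

    popTest : Program
    popTest = pop p ⨾ (if less value digit then descend p else skip)

    abstract
      ownW : stk F₋ % K < 2 + (l + l) → ∀ {k s′} → Within k popTest (mem F j₂) s′ → Within (7 + k) body (mem F j) s′
      ownW own e = whenFalse refl (byParityW return F j ok₀ l≤V l≡p
        (e₁ » whenTrue (does⁺ (stk F₋ % K <? 2 + (l + l)) own) e))

  module Pop (p : Player) (F₋ : Frame) (j : Scratch) (a b : ℕ)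
             (ok₀ : OK (mem (F₋ at p , a , b , 1) j))
             (l≤d : lvl F₋ ≤ d) (l≡p : parity (lvl F₋) ≡ p) (b<V : suc b ≤ V)
             {S′ : ℕ} (S/K : stk F₋ / K ≡ S′) where

    private
      l = lvl F₋

      F₁ : Frame
      F₁ = record F₋ { prec = pair p a b }

    open Return p F₁ j ok₀ l≤d l≡p public

    F′ : Frame
    F′ = record F₋ { prec = pair p a (suc b) ; md = 1 ; stk = S′ }

    j₃ : Scratch
    j₃ = record j₂ { w = 1 + (l + l) }

    private
      abstract
        e₂ : Within 3 (pop p) (mem F j₂) (mem F′ j₃)
        e₂ = subst (λ S → Within 3 (pop p) (mem F j₂) (mem (record F′ { stk = S }) j₃)) S/K
               (popW p (record F₋ { md = 1 }) j₂ a b b<V ok₂)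

    ok₃ : OK (mem F′ j₃)
    ok₃ = okW e₂

    abstract

      leftW : stk F₋ % K ≡ l + l → ∀ {k s′} → Within k (descend p) (mem F′ j₃) s′ → Within (11 + k) body (mem F j) s′
      leftW left {k} e = ownW (s≤s (≤-trans (≤-reflexive left) (n≤1+n _)))
        (e₂ » whenTrue (does⁺ (stk F₋ % K <? 1 + (l + l)) (s≤s (≤-reflexive left))) e)

      rightW : stk F₋ % K ≡ 1 + (l + l) → Within 12 body (mem F j) (mem F′ j₃)
      rightW right = ownW (s≤s (≤-reflexive right))
        (e₂ » whenFalse (does-no (stk F₋ % K <? 1 + (l + l)) (≤⇒≯ (≤-reflexive (sym right))))
                (constant (exec-skip ok₃)))

-- The number of iterations of the main loop spent on a level, when at most k levels (this one
-- included) remain and the two precisions add up to L.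
iterations : ℕ → ℕ → ℕ
iterations k       zero    = 1
iterations zero    (suc L) = 4 + (iterations zero L + iterations zero L)
iterations (suc k) (suc L) = 4 + (iterations (suc k) L + iterations (suc k) L) + iterations k (suc L)

-- Shifts the number of levels so that both cases of `iterations` obey one recurrence: without a
-- lower level there is no middle call.
below : ℕ → ℕ → ℕ
below zero    L = 0
below (suc k) L = iterations k L

iterations-suc : ∀ k L → iterations k (suc L) ≡ 4 + (iterations k L + iterations k L) + below k (suc L)
iterations-suc zero    L = sym (+-identityʳ _)
iterations-suc (suc k) L = refl

iterations>0 : ∀ k L → 1 ≤ iterations k L
iterations>0 k       zero    = ≤-refl
iterations>0 zero    (suc L) = s≤s z≤n
iterations>0 (suc k) (suc L) = s≤s z≤n

-- Correctness of a call and its number of iterations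

-- The rank `μ` bounds the depth of the recursion. It is kept abstract because two ranks are used:
-- one by priorities, one by numbers of vertices.
module Main (G : ParityGame) (n d m V a₀ : ℕ) (size≤n : size G ≤ n) (n≤V : n ≤ V)
            (K≤V : 4 + (d + d) ≤ V) (limit≤V : 8 + m ≤ V)
            (a₀≤V : a₀ + a₀ ≤ V) (stack≤V : (4 + (d + d)) ^ (1 + (a₀ + a₀)) ≤ V) (d<2^m : 1 + d < 2 ^ m)
            (μ : ℕ → ℕ) (μ-mono : ∀ {h h′} → Nonempty (withPriority G h) → h′ < h → μ h′ < μ h) where

  open Machine G n d m V size≤n n≤V K≤V limit≤V public

  -- Eighty units suffice for every kind of iteration; the longest is the ascent with 76.
  data Chain : State G → State G → ℕ → Set where
    []  : ∀ {s} → Chain s s 0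
    _∷_ : ∀ {s s′ s″ k} → evalTest G s (less mode c2) ≡ true × Within 80 body s s′ → Chain s′ s″ k →
          Chain s s″ (suc k)

  _⧺_ : ∀ {s s′ s″ k l} → Chain s s′ k → Chain s′ s″ l → Chain s s″ (k + l)
  []      ⧺ c′ = c′
  (x ∷ c) ⧺ c′ = x ∷ (c ⧺ c′)

  within-80 : ∀ {k s s′} {k≤80 : T (k ≤ᵇ 80)} → Within k body s s′ → Within 80 body s s′
  within-80 {k} {k≤80 = k≤} (within e) = within (weaken (*-monoˡ-≤ u (≤ᵇ⇒≤ k 80 k≤)) e)

  run-chain : ∀ {s s′ k} → OK s′ → evalTest G s′ (less mode c2) ≡ false → Chain s s′ k →
              Exec (while less mode c2 loop body) s s′ (1 + k * (1 + 80 * u))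
  run-chain o halted []                 = exec-stop o halted
  run-chain {k = suc k} o halted ((go , within e) ∷ c) =
    weaken (≤-reflexive (cong suc (trans (+-suc (80 * u) (k * (1 + 80 * u))) refl)))
      (exec-repeat go e (run-chain o halted c))

  top-of : ∀ x S → x < K → (x + S * K) % K ≡ x
  top-of x S x<K = trans ([m+kn]%n≡m%n x S K) (m<n⇒m%n≡m x<K)

  rest-of : ∀ x S → x < K → (x + S * K) / K ≡ S
  rest-of x S x<K = trans (+-distrib-/-∣ʳ x (n∣m*n S)) (cong₂ _+_ (m<n⇒m/n≡0 x<K) (m*n/n≡m S K))

  -- `f` counts the stack digits besides the initial one. Each of them has used up one unit of
  -- precision, so `f + L` is constant and the stack stays below `K ^ (1 + (a₀ + a₀))`. By `marks`
  -- and `fresh` the current game carries the largest mark in use, and by `top` the digits of all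
  -- lower levels are gone.
  record Ready (p : Player) (F : Frame) (a b k L : ℕ) : Set where
    field
      a+b≡L   : a + b ≡ L
      present : Present (lvl F)
      l≡p     : parity (lvl F) ≡ p
      game    : Subgame (Z F)
      π≤l     : ∀ {v} → v ∈ Z F → π G v ≤ lvl F
      μ≤k     : μ (lvl F) ≤ k
      δ+l≤d   : dep F + lvl F ≤ d
      len     : length (bits F) ≡ m
      marks   : ∀ {v} → v ∈ Z F → Marked v (dep F) (bits F)
      fresh   : ∀ {v k} → dep F < k → k ≤ 1 + d → ¬ Marked v k (bits F)
      top     : lvl F + lvl F ≤ stk F % K
      f       : ℕ
      S<      : stk F < K ^ suc f
      f+L     : f + L ≡ a₀ + a₀

    l≤d : lvl F ≤ d
    l≤d = ≤-trans (m≤n+m (lvl F) (dep F)) δ+l≤d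

  record Result (p : Player) (F : Frame) (j : Scratch) (a b k L : ℕ) : Set where
    field
      Z′     : VertexSet G
      j′     : Scratch
      N      : ℕ
      chain  : Chain (mem (F at p , a , b , 0) j) (mem (record F { Z = Z′ } at p , a , b , 1) j′) N
      N≤     : N ≤ iterations k L
      okEnd  : OK (mem (record F { Z = Z′ } at p , a , b , 1) j′)
      approx : Approx p a b (Z F) Z′

  -- Apart from the residual game and the mode, a call leaves the frame as it found it; in
  -- particular, the stack and the mark bits are restored.
  CallSpec : ℕ → ℕ → Set
  CallSpec k L = ∀ p F j a b → OK (mem (F at p , a , b , 0) j) → Ready p F a b k L → Result p F j a b k L

  lost-same : ∀ p {H R} → lost p p H R ≡ H ─ R
  lost-same Even = refl
  lost-same Odd  = refl

  lost-opponent : ∀ p {H R} → lost (p ⁻¹) p H R ≡ R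
  lost-opponent Even = refl
  lost-opponent Odd  = refl

  mem-flip : ∀ p F j a b md′ → mem (F at (p ⁻¹) , b , a , md′) j ≡ mem (F at p , a , b , md′) j
  mem-flip Even F j a b md′ = refl
  mem-flip Odd  F j a b md′ = refl

  module _ {p F a b k L} (r : Ready p F a b k L) where

    open Ready r

    δ<d+1 : suc (dep F) ≤ 1 + d
    δ<d+1 = s≤s (≤-trans (m≤m+n (dep F) (lvl F)) δ+l≤d)

    marks<2^m : ∀ {x} → x ≤ 1 + d → x < 2 ^ length (innerBits F)
    marks<2^m x≤ = subst (λ l → _ < 2 ^ l) (sym (trans (length-setMarks (Z F) _ (bits F)) len)) (≤-<-trans x≤ d<2^m)

    inner-marks : ∀ {v} → v ∈ Z F → Marked v (suc (dep F)) (innerBits F)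
    inner-marks = setMarks-inside (suc (dep F)) (bits F)

    inner-fresh : ∀ {v x} → suc (dep F) < x → x ≤ 1 + d → ¬ Marked v x (innerBits F)
    inner-fresh {v} {x} δ<x x≤ marked with v ∈? Z F
    ... | yes v∈ = <⇒≢ δ<x (mark-unique (suc (dep F)) x (innerBits F)
                     (marks<2^m δ<d+1) (marks<2^m x≤) (inner-marks v∈) marked)
    ... | no v∉ = fresh (<⇒≤ δ<x) x≤ (setMarks-outside (suc (dep F)) x (bits F) v∉ marked)

    -- Inside `Z F` the mark has just been set. Outside, the marks are the old ones, and `fresh`
    -- rules out the new depth among them.
    recover : selectMarked full (suc (dep F)) (innerBits F) ≡ Z F
    recover = ⊆-antisym
      (λ {v} v∈ → case v ∈? Z F of λ
        { (yes v∈Z) → v∈Z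
        ; (no v∉Z) → contradiction (setMarks-outside (suc (dep F)) (suc (dep F)) (bits F) v∉Z
                       (proj₂ (selectMarked⁻ (suc (dep F)) (innerBits F) v∈)))
                       (fresh ≤-refl δ<d+1) })
      (λ v∈ → selectMarked⁺ (suc (dep F)) (innerBits F) ∈⊤ (inner-marks v∈))

    restore : setMarks (Z F) (dep F) (innerBits F) ≡ bits F
    restore = setMarks-restore (dep F) (suc (dep F)) (bits F) marks

    inner-ready : ∀ {h′ H k′ p′ a′ b′} → k ≡ suc k′ → a′ + b′ ≡ L → Present h′ → parity h′ ≡ p′ → h′ < lvl F →
      Trap p (Z F) H → (∀ {v} → v ∈ H → π G v ≤ h′) → Ready p′ (inner F h′ H) a′ b′ k′ L
    inner-ready {h′} refl a′+b′≡L present′ h′≡p′ h′<l trapH bound = record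
      { a+b≡L = a′+b′≡L ; present = present′ ; l≡p = h′≡p′
      ; game = trap-subgame game trapH ; π≤l = bound
      ; μ≤k = ≤-pred (≤-trans (μ-mono present h′<l) μ≤k)
      ; δ+l≤d = ≤-trans (≤-reflexive (sym (+-suc (dep F) h′))) (≤-trans (+-monoʳ-≤ (dep F) h′<l) δ+l≤d)
      ; len = trans (length-setMarks (Z F) _ (bits F)) len
      ; marks = λ v∈ → inner-marks (Trap.sub trapH v∈)
      ; fresh = inner-fresh
      ; top = ≤-trans (+-mono-≤ (<⇒≤ h′<l) (<⇒≤ h′<l)) top
      ; f = f ; S< = S< ; f+L = f+L }

  -- Positive remaining precision means that the stack has not reached its full number of digits.
  room : ∀ {p F a b k L} → Ready p F a b k (suc L) → stk F * K + K ≤ V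
  room {F = F} {L = L} r = begin
    stk F * K + K       ≡⟨ +-comm (stk F * K) K ⟩
    suc (stk F) * K     ≤⟨ *-monoˡ-≤ K S< ⟩
    K ^ suc f * K       ≡⟨ *-comm (K ^ suc f) K ⟩
    K ^ suc (suc f)     ≤⟨ ^-monoʳ-≤ K (s≤s (≤-trans (m≤m+n (suc f) L) (≤-reflexive (trans (sym (+-suc f L)) f+L)))) ⟩
    K ^ suc (a₀ + a₀)   ≤⟨ stack≤V ⟩
    V                   ∎
    where
    open Ready r
    open ≤-Reasoning

  b<V : ∀ {p F a b k L} → Ready p F a (suc b) k (suc L) → suc b ≤ V
  b<V {a = a} {b} {L = L} r = ≤-trans (≤-trans (m≤n+m (suc b) a) (≤-reflexive a+b≡L))
    (≤-trans (≤-trans (m≤n+m (suc L) f) (≤-reflexive f+L)) a₀≤V)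
    where open Ready r

  half-ready : ∀ {p F a b k L Z′ x} → Ready p F a (suc b) k (suc L) → lvl F + lvl F ≤ x → x < K →
    Subgame Z′ → Z′ ⊆ Z F → Ready p (record F { stk = x + stk F * K ; Z = Z′ }) a b k L
  half-ready {F = F} {a} {b} {L = L} {x = x} r 2l≤x x<K game′ Z′⊆ = record
    { a+b≡L = suc-injective (trans (sym (+-suc a b)) a+b≡L) ; present = present ; l≡p = l≡p
    ; game = game′ ; π≤l = λ v∈ → π≤l (Z′⊆ v∈) ; μ≤k = μ≤k ; δ+l≤d = δ+l≤d ; len = len
    ; marks = λ v∈ → marks (Z′⊆ v∈) ; fresh = fresh
    ; top = ≤-trans 2l≤x (≤-reflexive (sym (top-of x (stk F) x<K)))
    ; f = suc f
    ; S< = begin-strict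
        x + stk F * K     <⟨ +-monoˡ-< (stk F * K) x<K ⟩
        suc (stk F) * K   ≤⟨ *-monoˡ-≤ K S< ⟩
        K ^ suc f * K     ≡⟨ *-comm (K ^ suc f) K ⟩
        K ^ suc (suc f)   ∎
    ; f+L = trans (sym (+-suc f L)) f+L }
    where
    open Ready r
    open ≤-Reasoning

  residual : Frame → ℕ → (H R : VertexSet G) → Frame
  residual F h′ H R = record (inner F h′ H) { Z = R }

  record Visit (p : Player) (F : Frame) (a b k L h′ : ℕ) (H : VertexSet G) (j : Scratch) : Set where
    field
      R         : VertexSet G
      j′        : Scratch
      N         : ℕ
      separates : Separates p a b H (lost (parity h′) p H R)
      chain     : Chain (mem (inner F h′ H at p , a , b , 0) j) (mem (residual F h′ H R at p , a , b , 1) j′) N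
      N≤        : N ≤ iterations k L
      okEnd     : OK (mem (residual F h′ H R at p , a , b , 1) j′)

  abstract

    -- When the lower level has the opponent's parity, the same memory is read as a call with
    -- players and precisions exchanged.
    visit : ∀ {p F a b k k′ L h′ H} j → Ready p F a b k L → k ≡ suc k′ → CallSpec k′ L →
      Present h′ → h′ < lvl F → Trap p (Z F) H → (∀ {v} → v ∈ H → π G v ≤ h′) →
      OK (mem (inner F h′ H at p , a , b , 0) j) → Visit p F a b k′ L h′ H j
    visit {p} {F} {a} {b} {k} {k′} {L} {h′} {H} j r k≡ spec present′ h′<l trapH bound ok₀
      with sameOrOpponent p (parity h′)
    ... | inj₁ same = record
        { R = R.Z′ ; j′ = R.j′ ; N = R.N
        ; separates = subst (Separates p a b H) (sym (trans (cong (λ q → lost q p H R.Z′) same) (lost-same p)))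
                        (separates-rest R.approx)
        ; chain = R.chain ; N≤ = R.N≤ ; okEnd = R.okEnd }
      where
      module R = Result (spec p (inner F h′ H) j a b ok₀
        (inner-ready r k≡ (Ready.a+b≡L r) present′ same h′<l trapH bound))
    ... | inj₂ opposite = record
        { R = R.Z′ ; j′ = R.j′ ; N = R.N
        ; separates = subst (Separates p a b H) (sym (trans (cong (λ q → lost q p H R.Z′) opposite) (lost-opponent p)))
                        (separates-same R.approx)
        ; chain = subst₂ (λ s s′ → Chain s s′ R.N) (mem-flip p (inner F h′ H) j a b 0)
                    (mem-flip p (residual F h′ H R.Z′) R.j′ a b 1) R.chain
        ; N≤ = R.N≤
        ; okEnd = subst OK (mem-flip p (residual F h′ H R.Z′) R.j′ a b 1) R.okEnd }
      where
      module R = Result (spec (p ⁻¹) (inner F h′ H) j b a (subst OK (sym (mem-flip p (inner F h′ H) j a b 0)) ok₀)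
        (inner-ready r k≡ (trans (+-comm b a) (Ready.a+b≡L r)) present′ opposite h′<l trapH bound))

  afterLeft : Frame → VertexSet G → Frame
  afterLeft F Z₂ = record F { Z = Z₂ ; stk = right F }

  abstract

    climb : ∀ {p F a b k L h′ H R} j → Ready p F a (suc b) k (suc L) →
      h′ < lvl F → (∀ {x} → h′ < x → x < lvl F → ¬ Present x) →
      OK (mem (residual F h′ H R at p , a , suc b , 1) j) →
      ∃ λ H₂ → ∃ λ Z₂ → ∃ λ j′ → LowTrap p F H₂
        × MaxTrap (p ⁻¹) (Z F) (Z F ─ lost (parity h′) p H₂ R) Z₂
        × Within 80 body (mem (residual F h′ H R at p , a , suc b , 1) j)
            (mem (afterLeft F Z₂ at p , a , b , 0) j′)
    climb {p} {F} {a} {b} {h′ = h′} {H} {R} j r h′<l absent ok₀ =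
      case ascendW (parity h′) p (record (inner F h′ H) { Z = R ; md = 1 }) Ret.j₂ a b {lvl F} {dep F} {Z F}
             Ret.ok₂ (recover r) (trans (length-setMarks (Z F) _ (bits F)) len) h′<l l≤d present absent l≡p (room r)
      of λ { (H₂ , Z₂ , j′ , trapH , trapZ , e) →
        H₂ , Z₂ , j′ , trapH , trapZ
      , within-80 (subst (λ bs → Within 76 body (mem (residual F h′ H R at p , a , suc b , 1) j) (mem (record (afterLeft F Z₂ at p , a , b , 0) { bits = bs }) j′))
          (restore r) (Ret.otherW other (whenTrue refl e))) }
      where
      open Ready r
      h′≤d : h′ ≤ d
      h′≤d = ≤-trans (<⇒≤ h′<l) l≤d
      F₁ : Frame
      F₁ = residual F h′ H R at p , a , suc b , 1
      module Ret = Return (parity h′) F₁ j ok₀ h′≤d refl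
      other : 2 + (h′ + h′) ≤ stk F % K
      other = ≤-trans (≤-reflexive (cong suc (sym (+-suc h′ h′)))) (≤-trans (+-mono-≤ h′<l h′<l) top)

  -- Identifies the subgame entered before the middle call with the one recomputed after it.
  max-unique : ∀ {p Z Y H H′} → MaxTrap p Z Y H → MaxTrap p Z Y H′ → H ≡ H′
  max-unique g h = ⊆-antisym
    (MaxTrap.greatest h (MaxTrap.trap g) (MaxTrap.below g))
    (MaxTrap.greatest g (MaxTrap.trap h) (MaxTrap.below h))

  record Middle (p : Player) (F : Frame) (j : Scratch) (a b k L : ℕ) : Set where
    field
      H U Z₂    : VertexSet G
      j′        : Scratch
      N         : ℕ
      low       : LowTrap p F H
      separates : Separates p a (suc b) H U
      rest      : MaxTrap (p ⁻¹) (Z F) (Z F ─ U) Z₂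
      chain     : Chain (mem (record F { stk = left F } at p , a , b , 1) j)
                        (mem (afterLeft F Z₂ at p , a , b , 0) j′) N
      N≤        : N ≤ 2 + below k (suc L)
      okEnd     : OK (mem (afterLeft F Z₂ at p , a , b , 0) j′)

  separates-empty : ∀ {p a b H} → ¬ Nonempty H → Separates p a b H ∅
  separates-empty empty = record
    { inside = ⊥⊆ ; avoids = λ _ _ _ → ∉⊥
    ; catches = λ x _ {v} v∈ → contradiction (v , WinsOr.sub x v∈) empty }

  greatest-all : ∀ {p Z} → Subgame Z → MaxTrap p Z (Z ─ ∅) Z
  greatest-all {Z = Z} sg = record
    { trap = trap-refl sg ; below = λ v∈ → ─⁺ v∈ ∉⊥ ; greatest = λ t _ → Trap.sub t }

  abstract

    middle : ∀ {p F a b k L} j → Ready p F a (suc b) k (suc L) → (∀ k′ → k ≡ suc k′ → CallSpec k′ (suc L)) →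
      OK (mem (record F { stk = left F } at p , a , b , 1) j) → Middle p F j a b k L
    middle {p} {F} {a} {b} {k} {L} j r spec ok₀ = go (descendW p (record F { md = 1 }) P.j₃ a b P.ok₃ l≤d δ+l≤d (room r) len π≤l)
      where
      open Ready r
      F₁ : Frame
      F₁ = record F { stk = left F }
      module P = Pop p F₁ j a b ok₀ l≤d l≡p (b<V r)
                     {stk F} (rest-of (lvl F + lvl F) (stk F) (2l<K l≤d))
      top≡ : left F % K ≡ lvl F + lvl F
      top≡ = top-of (lvl F + lvl F) (stk F) (2l<K l≤d)
      go : (∃ λ H → LowTrap p F H
             × (Emptied p (record F { md = 1 }) P.j₃ a b H ⊎ Entered p (F at p , a , suc b , 1) P.j₃ H)) →
           Middle p F j a b k L
      go (H , low , inj₁ (empty , j′ , e)) = record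
        { H = H ; U = ∅ ; Z₂ = Z F ; j′ = j′ ; N = 1
        ; low = low ; separates = separates-empty empty ; rest = greatest-all game
        ; chain = (refl , within-80 (P.leftW top≡ e)) ∷ []
        ; N≤ = s≤s z≤n ; okEnd = okW e }
      go (H , low , inj₂ (h′ , j₁ , present′ , h′<l , bound , absent , e)) = inside k refl
        where
        inside : ∀ k₁ → k ≡ k₁ → Middle p F j a b k L
        -- A vertex below the current level forces a positive rank.
        inside zero k≡ = contradiction (≤-trans (μ-mono present h′<l) (≤-trans μ≤k (≤-reflexive k≡))) λ ()
        inside (suc k′) k≡ = finish (visit j₁ r k≡ (spec k′ k≡) present′ h′<l (MaxTrap.trap low) bound (okW e))
          where
          finish : Visit p F a (suc b) k′ (suc L) h′ H j₁ → Middle p F j a b k L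
          finish v = case climb {H = H} (Visit.j′ v) r h′<l absent (Visit.okEnd v) of λ { (H₂ , Z₂ , j′ , trapH , trapZ , e′) → record
            { H = H ; U = lost (parity h′) p H (Visit.R v) ; Z₂ = Z₂ ; j′ = j′ ; N = 1 + (Visit.N v + 1)
            ; low = low ; separates = Visit.separates v
            ; rest = subst (λ H → MaxTrap (p ⁻¹) (Z F) (Z F ─ lost (parity h′) p H (Visit.R v)) Z₂)
                           (max-unique trapH low) trapZ
            ; chain = (refl , within-80 (P.leftW top≡ e)) ∷ (Visit.chain v ⧺ ((refl , e′) ∷ []))
            ; N≤ = s≤s (≤-trans (+-monoˡ-≤ 1 (Visit.N≤ v))
                     (≤-reflexive (trans (+-comm _ 1) (cong (λ k → suc (below k (suc L))) (sym k≡)))))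
            ; okEnd = okW e′ } }

  call-step : ∀ k L → (∀ L′ → L ≡ suc L′ → CallSpec k L′) → (∀ k′ → k ≡ suc k′ → CallSpec k′ L) → CallSpec k L
  call-step k L halves lower p F j a zero ok₀ r =
    case callW-zero p F j a ok₀ (≤-trans (Ready.l≤d r) d≤V) (Ready.l≡p r) of λ { (j′ , e) → record
      { Z′ = Z F ; j′ = j′ ; N = 1 ; chain = (refl , within-80 e) ∷ []
      ; N≤ = iterations>0 k L ; okEnd = okW e ; approx = approx-zero (Ready.game r) } }
  call-step k zero halves lower p F j a (suc b) ok₀ r =
    contradiction (trans (sym (+-suc a b)) (Ready.a+b≡L r)) λ ()
  call-step k (suc L) halves lower p F j a (suc b) ok₀ r = first
    where
    open Ready r
    l = lvl F
    half : CallSpec k L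
    half = halves L refl

    Goal : Set
    Goal = Result p F j a (suc b) k (suc L)

    third : ∀ {j₁} (x : Result p (record F { stk = left F }) j₁ a b k L)
            (y : Middle p (record F { Z = Result.Z′ x }) (Result.j′ x) a b k L)
            (z : Result p (afterLeft (record F { Z = Result.Z′ x }) (Middle.Z₂ y)) (Middle.j′ y) a b k L) →
            Within 80 body (mem (F at p , a , suc b , 0) j) (mem (record F { stk = left F } at p , a , b , 0) j₁) → Goal
    third x y z e = record
      -- One iteration opens the first half and one closes the second; the at most two iterations
      -- around the middle call are part of `y.N`.
      { Z′ = z.Z′ ; j′ = P.j₃ ; N = 1 + (x.N + (y.N + (z.N + 1)))
      ; chain = (refl , e) ∷ (x.chain ⧺ (y.chain ⧺ (z.chain ⧺
                  ((refl , within-80 (P.rightW (top-of (1 + (l + l)) (stk F) (frame< l≤d)))) ∷ []))))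
      ; N≤ = count
      ; okEnd = P.ok₃
      ; approx = approx-step game π≤l l≡p x.approx y.low y.separates y.rest z.approx }
      where
      module x = Result x
      module y = Middle y
      module z = Result z
      F₁ : Frame
      F₁ = record F { Z = z.Z′ ; stk = (1 + (l + l)) + stk F * K }
      module P = Pop p F₁ z.j′ a b z.okEnd l≤d l≡p (b<V r)
                     {stk F} (rest-of (1 + (l + l)) (stk F) (frame< l≤d))
      count : 1 + (x.N + (y.N + (z.N + 1))) ≤ iterations k (suc L)
      count = begin
        1 + (x.N + (y.N + (z.N + 1)))             ≤⟨ s≤s (+-mono-≤ x.N≤ (+-mono-≤ y.N≤ (+-monoˡ-≤ 1 z.N≤))) ⟩
        1 + (I + (2 + B + (I + 1)))               ≡⟨ cong suc (trans (cong (I +_) (shuffle I B)) (sym (+-assoc I (I + 3) B))) ⟩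
        1 + (I + (I + 3) + B)                     ≡⟨ cong (λ x → suc (x + B)) (trans (sym (+-assoc I I 3)) (+-comm (I + I) 3)) ⟩
        4 + (I + I) + B                           ≡⟨ iterations-suc k L ⟨
        iterations k (suc L)                      ∎
        where
        open ≤-Reasoning
        I = iterations k L
        B = below k (suc L)
        shuffle : ∀ I B → 2 + B + (I + 1) ≡ I + 3 + B
        shuffle I B = trans (cong (2 + B +_) (+-comm I 1)) (trans (+-suc (2 + B) I) (trans (cong (3 +_) (+-comm B I)) (cong (_+ B) (+-comm 3 I))))

    Z₁-ready : ∀ {Z₁} → Trap (p ⁻¹) (Z F) Z₁ → Ready p (record F { Z = Z₁ }) a (suc b) k (suc L)
    Z₁-ready t = record
      { a+b≡L = a+b≡L ; present = present ; l≡p = l≡p ; game = trap-subgame game t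
      ; π≤l = λ v∈ → π≤l (Trap.sub t v∈) ; μ≤k = μ≤k ; δ+l≤d = δ+l≤d ; len = len
      ; marks = λ v∈ → marks (Trap.sub t v∈) ; fresh = fresh ; top = top ; f = f ; S< = S< ; f+L = f+L }

    second : ∀ {j₁} (x : Result p (record F { stk = left F }) j₁ a b k L) →
             Within 80 body (mem (F at p , a , suc b , 0) j) (mem (record F { stk = left F } at p , a , b , 0) j₁) → Goal
    second x e = third x y
        (half p (afterLeft (record F { Z = x.Z′ }) (Middle.Z₂ y)) (Middle.j′ y) a b (Middle.okEnd y)
          (half-ready r₁ (n≤1+n _) (frame< l≤d) (trap-subgame (Ready.game r₁) t₂) (Trap.sub t₂)))
        e
      where
      module x = Result x
      r₁ : Ready p (record F { Z = x.Z′ }) a (suc b) k (suc L)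
      r₁ = Z₁-ready (Approx.trap x.approx)
      y : Middle p (record F { Z = x.Z′ }) x.j′ a b k L
      y = middle x.j′ r₁ lower x.okEnd
      t₂ : Trap (p ⁻¹) x.Z′ (Middle.Z₂ y)
      t₂ = MaxTrap.trap (Middle.rest y)

    first : Goal
    first = case callW-suc p F j a b ok₀ l≤d (room r) l≡p of λ { (j₁ , e) →
      second (half p (record F { stk = left F }) j₁ a b (okW e)
        (half-ready r ≤-refl (2l<K l≤d) game id)) (within-80 e) }

  -- The halves keep the levels and spend precision; the middle call keeps the precisions and gives
  -- up a level.
  call-spec : ∀ k L → CallSpec k L
  call-spec zero    zero    = call-step zero zero (λ _ ()) (λ _ ())
  call-spec zero    (suc L) = call-step zero (suc L)
    (λ L′ eq → subst (CallSpec zero) (suc-injective eq) (call-spec zero L)) (λ _ ())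
  call-spec (suc k) zero    = call-step (suc k) zero
    (λ _ ()) (λ k′ eq → subst (λ k → CallSpec k zero) (suc-injective eq) (call-spec k zero))
  call-spec (suc k) (suc L) = call-step (suc k) (suc L)
    (λ L′ eq → subst (CallSpec (suc k)) (suc-injective eq) (call-spec (suc k) L))
    (λ k′ eq → subst (λ k → CallSpec k (suc L)) (suc-injective eq) (call-spec k (suc L)))

-- Determinism and initialisation

-- Resource bounds speak of every run, whereas the simulation constructs one. Determinism transfers
-- its costs, and lets each bound choose its own `V` and rank.
deterministic : ∀ (G : ParityGame) {P s s₁ s₂} (r₁ : Run G P s s₁) (r₂ : Run G P s s₂) →
                s₁ ≡ s₂ × time G r₁ ≡ time G r₂ × (∀ f → peak G f r₁ ≡ peak G f r₂)
deterministic G skip  skip  = refl , refl , λ _ → refl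
deterministic G instr instr = refl , refl , λ _ → refl
deterministic G (q₁ ⨾ r₁) (q₂ ⨾ r₂) with deterministic G q₁ q₂
... | refl , t , f with deterministic G r₁ r₂
...   | refl , t′ , f′ = refl , cong₂ _+_ t t′ , λ g → cong₂ _⊔_ (f g) (f′ g)
deterministic G (ifTrue _ r₁) (ifTrue _ r₂) with deterministic G r₁ r₂
... | refl , t , f = refl , cong suc t , f
deterministic G (ifFalse _ r₁) (ifFalse _ r₂) with deterministic G r₁ r₂
... | refl , t , f = refl , cong suc t , f
deterministic G (ifTrue c _) (ifFalse c′ _) = case trans (sym c) c′ of λ ()
deterministic G (ifFalse c _) (ifTrue c′ _) = case trans (sym c) c′ of λ ()
deterministic G (stop _) (stop _) = refl , refl , λ _ → refl
deterministic G (stop c) (repeat c′ _ _) = case trans (sym c) c′ of λ ()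
deterministic G (repeat c _ _) (stop c′) = case trans (sym c) c′ of λ ()
deterministic G (repeat _ q₁ r₁) (repeat _ q₂ r₂) with deterministic G q₁ q₂
... | refl , t , f with deterministic G r₁ r₂
...   | refl , t′ , f′ = refl , cong suc (cong₂ _+_ t t′) , λ g → cong₂ _⊔_ (f g) (f′ g)

data Halving : ℕ → ℕ → Set where
  []  : Halving 0 0
  _∷_ : ∀ {t k} → 0 < t → Halving (t / 2) k → Halving t (suc k)

halving : ∀ t → ∃ λ k → Halving t k × t < 2 ^ k × k ≤ 1 + ⌊log₂ t ⌋
halving t = go t (<-wellFounded t)
  where
  go : ∀ t → Acc _<_ t → ∃ λ k → Halving t k × t < 2 ^ k × k ≤ 1 + ⌊log₂ t ⌋
  go zero _ = 0 , [] , s≤s z≤n , z≤n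
  go (suc zero) _ = 1 , s≤s z≤n ∷ [] , s≤s (s≤s z≤n) , s≤s z≤n
  go t@(suc (suc t₀)) (acc rec) with go (t / 2) (rec (m/n<m t 2 (s≤s (s≤s z≤n))))
  ... | k , h , t/2< , k≤ = suc k , s≤s z≤n ∷ h , t< , s≤s (≤-trans k≤ lg≤)
    where
    open ≤-Reasoning
    t< : t < 2 ^ suc k
    t< = begin-strict
      t                     ≡⟨ m≡m%n+[m/n]*n t 2 ⟩
      t % 2 + t / 2 * 2     <⟨ +-monoˡ-< (t / 2 * 2) (m%n<n t 2) ⟩
      suc (t / 2) * 2       ≤⟨ *-monoˡ-≤ 2 t/2< ⟩
      2 ^ k * 2             ≡⟨ *-comm (2 ^ k) 2 ⟩
      2 ^ suc k             ∎
    lg≤ : 1 + ⌊log₂ t / 2 ⌋ ≤ ⌊log₂ t ⌋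
    lg≤ = begin
      1 + ⌊log₂ t / 2 ⌋     ≡⟨ ⌊log₂[2*b]⌋≡1+⌊log₂b⌋ (t / 2) {{>-nonZero (m≥n⇒m/n>0 {t} {2} (s≤s (s≤s z≤n)))}} ⟨
      ⌊log₂ (2 * (t / 2)) ⌋ ≤⟨ ⌊log₂⌋-mono-≤ (≤-trans (≤-reflexive (*-comm 2 (t / 2))) (m/n*n≤m t 2)) ⟩
      ⌊log₂ t ⌋             ∎

write-∅ : ∀ {N} m → write (∅ {N}) m ∅ [] ≡ ∅ ∷ replicate m ∅
write-∅ zero    = refl
write-∅ (suc m) = cong (∅ ∷_) (write-∅ m)

module Initialisation (G : ParityGame) (n d m V a₀ : ℕ)
            (n≤V : n ≤ V) (K≤V : 4 + (d + d) ≤ V) (limit≤V : 8 + m ≤ V) (a₀≤V : a₀ + a₀ ≤ V)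
            (halving-n : Halving n a₀) (halving-d : Halving (1 + d) m) where

  open Execution G V (8 + m)

  start : (S aE aO K lim t : ℕ) → State G
  start S aE aO K lim t =
    ⟨ n ∷ d ∷ 0 ∷ 0 ∷ S ∷ aE ∷ aO ∷ 0 ∷ K ∷ lim ∷ 0 ∷ t ∷ 0
      ∷ 0 ∷ 1 ∷ 2 ∷ 3 ∷ 4 ∷ 5 ∷ 6 ∷ 7 ∷ []
    , [] ⟩

  -- The state is a function `st` of the counter and the remaining value, so that one proof serves
  -- both the precision and the number of mark bits.
  halve-loop : ∀ a (st : ℕ → ℕ → State G) → (∀ x t → evalTest G (st x t) (less c0 value) ≡ does (0 <? t)) →
    (∀ x t → suc x ≤ V → t ≤ V → OK (st x t) →
      Exec (block (assign value (op quotient value c2)) (assign a (op plus c1 a) ∷ [])) (st x t) (st (suc x) (t / 2)) 2) →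
    ∀ {t k x} → Halving t k → k + x ≤ V → t ≤ V → OK (st x t) → Exec (halve a) (st x t) (st (k + x) 0) (1 + k * 3)
  halve-loop a st test step {x = x} [] _ _ ok₀ = exec-stop ok₀ (test x 0)
  halve-loop a st test step {t} {suc k} {x} (t>0 ∷ h) k≤ t≤ ok₀ =
    exec-repeat (trans (test x t) (does⁺ (0 <? t) t>0)) e
      (subst (λ y → Exec (halve a) (st (suc x) (t / 2)) (st y 0) (1 + k * 3)) (+-suc k x)
        (halve-loop a st test step h (≤-trans (≤-reflexive (+-suc k x)) k≤) (≤-trans (m/n≤m t 2) t≤) (ok e)))
    where
    e = step x t (≤-trans (s≤s (m≤n+m x k)) k≤) t≤ ok₀

  ready : State G
  ready = ⟨ n ∷ d ∷ 1 + d ∷ 0 ∷ 2 + (d + d) ∷ a₀ ∷ a₀ ∷ 0 ∷ 4 + (d + d) ∷ 8 + m ∷ 0 ∷ 7 + m ∷ 0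
      ∷ 0 ∷ 1 ∷ 2 ∷ 3 ∷ 4 ∷ 5 ∷ 6 ∷ 7 ∷ []
    , full ∷ ∅ ∷ ∅ ∷ ∅ ∷ ∅ ∷ ∅ ∷ ∅ ∷ ∅ ∷ replicate m ∅ ⟩

  initialised : Exec initialise (initial G n d) ready (8 + ((1 + a₀ * 3) + (3 + ((1 + m * 3) + 7))))
  initialised = e₁ then e₂ then e₃ then e₄ then e₅
    where
    8≤V : 8 ≤ V
    8≤V = ≤-trans (m≤m+n 8 m) limit≤V
    small : ∀ k {k≤8 : T (k ≤ᵇ 8)} → k ≤ V
    small k {k≤8} = ≤-trans (≤ᵇ⇒≤ k 8 k≤8) 8≤V
    2d≤V : ∀ k {k≤4 : T (k ≤ᵇ 4)} → k + (d + d) ≤ V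
    2d≤V k {k≤4} = ≤-trans (+-monoˡ-≤ (d + d) (≤ᵇ⇒≤ k 4 k≤4)) K≤V
    d<V : 1 + d ≤ V
    d<V = ≤-trans (s≤s (m≤m+n d d)) (2d≤V 1)
    d≤V : d ≤ V
    d≤V = ≤-trans (n≤1+n d) d<V
    e₁ : Exec constants (initial G n d) (start 0 0 0 0 0 n) 8
    e₁ = exec-block _ _ (s≤s (s≤s z≤n) , n≤V ∷ d≤V ∷ [] , z≤n)
      ((_ , small 7) , (_ , small 1) , (_ , small 2) , (_ , small 3) , (_ , small 4) , (_ , small 5) , (_ , small 6) , (_ , n≤V))
    e₂ : Exec (halve 5) (start 0 0 0 0 0 n) (start 0 a₀ 0 0 0 0) (1 + a₀ * 3)
    e₂ = subst (λ x → Exec (halve 5) (start 0 0 0 0 0 n) (start 0 x 0 0 0 0) (1 + a₀ * 3)) (+-identityʳ a₀)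
           (halve-loop 5 (λ x → start 0 x 0 0 0) (λ _ _ → refl)
             (λ x t x< t≤ ok₀ → exec-block _ _ {start 0 x 0 0 0 t} ok₀ ((_ , ≤-trans (m/n≤m t 2) t≤) , (_ , x<)))
             halving-n (≤-trans (≤-reflexive (+-identityʳ a₀)) (≤-trans (m≤m+n a₀ a₀) a₀≤V)) n≤V (ok e₁))
    e₃ : Exec (block (assign 6 (copy 5)) (assign limit (lit 8) ∷ assign value (op plus c1 1) ∷ []))
              (start 0 a₀ 0 0 0 0) (start 0 a₀ a₀ 0 8 (1 + d)) 3
    e₃ = exec-block _ _ (ok e₂) ((_ , ≤-trans (m≤m+n a₀ a₀) a₀≤V) , (_ , 8≤V) , (_ , d<V))
    e₄ : Exec (halve limit) (start 0 a₀ a₀ 0 8 (1 + d)) (start 0 a₀ a₀ 0 (8 + m) 0) (1 + m * 3)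
    e₄ = subst (λ x → Exec (halve limit) (start 0 a₀ a₀ 0 8 (1 + d)) (start 0 a₀ a₀ 0 x 0) (1 + m * 3)) (+-comm m 8)
           (halve-loop limit (start 0 a₀ a₀ 0) (λ _ _ → refl)
             (λ x t x< t≤ ok₀ → exec-block _ _ {start 0 a₀ a₀ 0 x t} ok₀ ((_ , ≤-trans (m/n≤m t 2) t≤) , (_ , x<)))
             halving-d (≤-trans (≤-reflexive (+-comm m 8)) limit≤V) d<V (ok e₃))
    allocate : List Instruction
    allocate = assignSet value none ∷ assignSet c0 all
      ∷ assign base (op plus 1 1) ∷ assign stack (op plus c2 base) ∷ assign base (op plus c2 stack)
      ∷ assign level (op plus c1 1) ∷ []
    e₅ : Exec (block (assign value (op monus limit c1)) allocate) (start 0 a₀ a₀ 0 (8 + m) 0) ready 7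
    e₅ = subst (λ bs → Exec (block (assign value (op monus limit c1)) allocate) (start 0 a₀ a₀ 0 (8 + m) 0)
                 ⟨ State.cells ready , full ∷ ∅ ∷ ∅ ∷ ∅ ∷ ∅ ∷ ∅ ∷ ∅ ∷ bs ⟩ 7) (write-∅ m)
           (exec-block _ _ {start 0 a₀ a₀ 0 (8 + m) 0} (ok e₄)
             ((_ , ≤-trans (n≤1+n (7 + m)) limit≤V) , <⇒<ᵇ (n<1+n (7 + m)) , <⇒<ᵇ (s≤s (z≤n {7 + m}))
             , (_ , 2d≤V 0) , (_ , 2d≤V 2) , (_ , 2d≤V 4) , (_ , d<V)))

-- The whole program on one game

module Solution (G : ParityGame) (n d m V a₀ : ℕ) (size≤n : size G ≤ n) (π≤d : ∀ v → π G v ≤ d)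
                (n≤V : n ≤ V) (K≤V : 4 + (d + d) ≤ V) (limit≤V : 8 + m ≤ V)
                (a₀≤V : a₀ + a₀ ≤ V) (stack≤V : (4 + (d + d)) ^ (1 + (a₀ + a₀)) ≤ V)
                (halving-n : Halving n a₀) (halving-d : Halving (1 + d) m)
                (n<2^a₀ : n < 2 ^ a₀) (d<2^m : 1 + d < 2 ^ m) (a₀≤1+n : a₀ ≤ 1 + n)
                (μ : ℕ → ℕ) (μ-mono : ∀ {h h′} → Nonempty (withPriority G h) → h′ < h → μ h′ < μ h)
                (k : ℕ) (μ≤k : ∀ {h} → h ≤ d → μ h ≤ k) where

  open Main G n d m V a₀ size≤n n≤V K≤V limit≤V a₀≤V stack≤V d<2^m μ μ-mono
  open Initialisation G n d m V a₀ n≤V K≤V limit≤V a₀≤V halving-n halving-d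

  initialisedW : Within 26 initialise (initial G n d) ready
  initialisedW = within (weaken bound initialised)
    where
    open ≤-Reasoning
    bound : 8 + ((1 + a₀ * 3) + (3 + ((1 + m * 3) + 7))) ≤ 26 * u
    bound = begin
      8 + ((1 + a₀ * 3) + (3 + ((1 + m * 3) + 7)))
        ≤⟨ +-mono-≤ (units 8 ≤-refl) (+-mono-≤ a₀-bound (+-mono-≤ (units 3 ≤-refl) (+-mono-≤ m-bound (units 7 ≤-refl)))) ⟩
      8 * u + (4 * u + (3 * u + (4 * u + 7 * u)))
        ≡⟨ collect u ⟩
      26 * u ∎
      where
      a₀-bound : 1 + a₀ * 3 ≤ 4 * u
      a₀-bound = ≤-trans (+-mono-≤ (units 1 ≤-refl) (≤-trans (*-monoˡ-≤ 3 (≤-trans a₀≤1+n (s≤s (m≤m+n n (m + d))))) (≤-reflexive (*-comm u 3))))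
                         (≤-reflexive (sym (*-distribʳ-+ u 1 3)))
      m-bound : 1 + m * 3 ≤ 4 * u
      m-bound = linear 3 {1} ≤-refl m≤u
      collect : ∀ u → 8 * u + (4 * u + (3 * u + (4 * u + 7 * u))) ≡ 26 * u
      collect = solve-∀

  F₀ : Frame
  F₀ = record { lvl = 1 + d ; dep = 0 ; stk = 2 + (d + d) ; prec = λ _ → a₀ ; md = 0 ; Z = full ; bits = replicate m ∅ }

  j₀ : Scratch
  j₀ = record { i = 0 ; t = 7 + m ; w = 0 ; x₁ = ∅ ; x₂ = ∅ ; x₃ = ∅ ; x₄ = ∅ ; x₅ = ∅ ; x₆ = ∅ }

  unmarked : ∀ m {v} → Marked v 0 (replicate m ∅)
  unmarked zero    = tt
  unmarked (suc m) = ∉⊥ , unmarked m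

  unmarked-fresh : ∀ {v x} → 0 < x → x ≤ 1 + d → ¬ Marked v x (replicate m ∅)
  unmarked-fresh {v} {x} 0<x x≤ marked =
    <⇒≢ 0<x (mark-unique 0 x (replicate m ∅) (below2^m z≤n) (below2^m x≤) (unmarked m) marked)
    where
    below2^m : ∀ {x} → x ≤ 1 + d → x < 2 ^ length (replicate m (∅ {size G}))
    below2^m x≤ = subst (λ l → _ < 2 ^ l) (sym (length-replicate m)) (≤-<-trans x≤ d<2^m)

  2d<K : 2 + (d + d) < K
  2d<K = s≤s (s≤s (s≤s (n≤1+n (d + d))))

  record Solved (l : ℕ) (P : Program) (s : State G) : Set where
    field
      N      : ℕ
      N≤     : N ≤ 1 + iterations k (a₀ + a₀)
      F      : Frame
      j      : Scratch
      run    : Within (l + N * 81) P s (mem F j)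
      lvl≤V  : lvl F ≤ V
      approx : Approx (parity (lvl F)) a₀ a₀ full (Z F)

  uniform-mem : ∀ p F j md′ → mem (F at p , a₀ , a₀ , md′) j ≡ mem (record F { prec = λ _ → a₀ ; md = md′ }) j
  uniform-mem Even F j md′ = refl
  uniform-mem Odd  F j md′ = refl

  abstract

    explore : ∀ {h} j → Present h → h ≤ d → (∀ v → π G v ≤ h) → OK (mem (record F₀ { lvl = h }) j) →
              Solved 1 (while less mode c2 loop body) (mem (record F₀ { lvl = h }) j)
    explore {h} j present h≤d π≤h ok₀ = finish (call-spec k (a₀ + a₀) p F j a₀ a₀
        (subst OK (sym (uniform-mem p F j 0)) ok₀) record
        { a+b≡L = refl ; present = present ; l≡p = refl ; game = subgame-full ; π≤l = λ {v} _ → π≤h v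
        ; μ≤k = μ≤k h≤d ; δ+l≤d = h≤d ; len = length-replicate m
        ; marks = λ _ → unmarked m ; fresh = unmarked-fresh
        ; top = ≤-trans (+-mono-≤ h≤d h≤d) (≤-trans (m≤n+m (d + d) 2) (≤-reflexive (sym (m<n⇒m%n≡m 2d<K))))
        ; f = 0 ; S< = ≤-trans 2d<K (≤-reflexive (sym (*-identityʳ K))) ; f+L = refl })
      where
      p : Player
      p = parity h
      F : Frame
      F = record F₀ { lvl = h }
      finish : Result p F j a₀ a₀ k (a₀ + a₀) → Solved 1 (while less mode c2 loop body) (mem F j)
      finish r = record
        { N = r.N + 1 ; N≤ = ≤-trans (≤-reflexive (+-comm r.N 1)) (s≤s r.N≤)
        ; F = F₂ ; j = Ret.j₂
        ; run = subst (λ s → Within (1 + (r.N + 1) * 81) (while less mode c2 loop body) s (mem F₂ Ret.j₂)) (uniform-mem p F j 0)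
            (within (weaken bound (run-chain (okW halt) refl (r.chain ⧺ ((refl , within-80 halt) ∷ [])))))
        ; lvl≤V = ≤-trans h≤d d≤V
        ; approx = r.approx }
        where
        module r = Result r
        F₁ : Frame
        F₁ = record F { Z = r.Z′ } at p , a₀ , a₀ , 1
        module Ret = Return p F₁ r.j′ r.okEnd h≤d refl
        F₂ : Frame
        F₂ = record F { Z = r.Z′ ; prec = pair p a₀ a₀ ; md = 2 }
        halt : Within 9 body (mem (record F { Z = r.Z′ } at p , a₀ , a₀ , 1) r.j′) (mem F₂ Ret.j₂)
        halt = Ret.haltW (≤-trans (s≤s (s≤s (+-mono-≤ h≤d h≤d))) (≤-reflexive (sym (m<n⇒m%n≡m 2d<K)))) refl
        bound : 1 + (r.N + 1) * (1 + 80 * u) ≤ (1 + (r.N + 1) * 81) * u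
        bound = +-mono-≤ (s≤s z≤n) (≤-trans (*-monoʳ-≤ (r.N + 1) (+-monoˡ-≤ (80 * u) (s≤s z≤n)))
                  (≤-reflexive (sym (*-assoc (r.N + 1) 81 u))))

    searchW : OK (mem F₀ j₀) → Solved 8 search (mem F₀ j₀)
    searchW ok₀ with nonempty? (full {size G})
    ... | no empty = record
        { N = 0 ; N≤ = z≤n ; F = F₀ ; j = j₀
        ; run = within (weaken (*-monoˡ-≤ u {2} {8} (s≤s (s≤s z≤n)))
            (get (whenTrue (does⁺ (full {size G} ⊆? ∅) λ {v} v∈ → contradiction (v , v∈) empty) (constant (exec-skip ok₀)))))
        ; lvl≤V = d<V
        ; approx = record { trap = trap-refl subgame-full ; keeps = λ x _ → WinsOr.sub x
                          ; drops = λ _ _ {v} _ _ → empty (v , ∈⊤) } }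
    ... | yes (v , _) with search-down {Present} {V} (λ k → nonempty? (withPriority G k)) d
                             (v , ∈-withPriority⁺ {π G v} {v} refl) (π≤d v) d≤V
    ... | h , r , s , present , _ , h≤d , r≤d , absent with ScanDown.scanW F₀ j₀ ok₀ d≤V r≤d s
    ... | j , e , _ = record
        { N = S.N ; N≤ = S.N≤ ; F = S.F ; j = S.j
        ; run = whenFalse (does-no (full {size G} ⊆? ∅) λ ⊆∅ → ∉⊥ (⊆∅ (∈⊤ {x = v}))) (e » S.run)
        ; lvl≤V = S.lvl≤V ; approx = S.approx }
      where
      π≤h : ∀ v → π G v ≤ h
      π≤h v with π G v ≤? h
      ... | yes ≤h = ≤h
      ... | no ≰h = contradiction (v , ∈-withPriority⁺ refl) (absent (≰⇒> ≰h) (π≤d v))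
      module S = Solved (explore j present h≤d π≤h (okW e))

    outputW : ∀ F j p → OK (mem F j) → lvl F ≤ V → parity (lvl F) ≡ p →
      ∃ λ s → Within 7 output (mem F j) s
            × (∀ (Q : Player → VertexSet G → Set) → Q p (Z F) → Q (p ⁻¹) (full ─ Z F) → Q Even (X G s 0) × Q Odd (X G s 1))
    outputW F j p ok₀ l≤V l≡p = go p (okW e) refl
      where
      j₁ : Scratch
      j₁ = record j { x₁ = full ─ Z F }
      e : Within 2 (block (assignSet c1 all) (assignSet c1 (setOp difference c1 c0) ∷ [])) (mem F j) (mem F j₁)
      e = constant (exec-block _ _ {mem F j} ok₀ _)
      j₂ : Scratch
      j₂ = record j₁ { w = lvl F % 2 }
      go : ∀ q → OK (mem F j₁) → p ≡ q →
        ∃ λ s → Within 7 output (mem F j) s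
            × (∀ (Q : Player → VertexSet G → Set) → Q q (Z F) → Q (q ⁻¹) (full ─ Z F) → Q Even (X G s 0) × Q Odd (X G s 1))
      go Even ok₁ p≡ = mem F j₂
        , within (weaken (*-monoˡ-≤ u {5} {7} (m≤m+n 5 2)) (get (e » byParityW orient F j₁ ok₁ l≤V (trans l≡p p≡)
            (constant (exec-skip (parity-ok F j₁ ok₁ l≤V))))))
        , λ Q x y → x , y
      go Odd ok₁ p≡ = _
        , (e » byParityW orient F j₁ ok₁ l≤V (trans l≡p p≡)
            (constant (exec-block (assignSet c2 (setOp union c0 c0))
               (assignSet c0 (setOp union c1 c1) ∷ assignSet c1 (setOp union c2 c2) ∷ []) {mem F j₂} (parity-ok F j₁ ok₁ l≤V) _)))
        , λ Q x y → subst (Q Even) (sym (∪-idem (full ─ Z F))) y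
                  , subst (Q Odd) (sym (trans (cong₂ _∪_ (∪-idem (Z F)) (∪-idem (Z F))) (∪-idem (Z F)))) x

    finish : ∀ {s} → Solved 8 search s →
      ∃ λ s′ → ∃ λ N → N ≤ 1 + iterations k (a₀ + a₀)
      × Within (8 + N * 81 + 7) (search ⨾ output) s s′
      × LargestDominion G Even (X G s′ 0) × LargestDominion G Odd (X G s′ 1)
    finish record { N = N ; N≤ = N≤ ; F = F ; j = j ; run = e ; lvl≤V = l≤V ; approx = approx } =
      case outputW F j (parity (lvl F)) (okW e) l≤V refl of λ { (s′ , e′ , place) →
      case approx⇒largest π≤d (≤-<-trans size≤n n<2^a₀) approx of λ { (largest , largest⁻¹) →
        s′ , N , N≤ , (e » e′) , place (LargestDominion G) largest largest⁻¹ }}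

    solved : ∃ λ s → ∃ λ N → N ≤ 1 + iterations k (a₀ + a₀)
      × Exec solver (initial G n d) s ((26 + (8 + N * 81 + 7)) * u)
      × LargestDominion G Even (X G s 0) × LargestDominion G Odd (X G s 1)
    solved = case finish (searchW (okW initialisedW)) of λ { (s , N , N≤ , e , largest) →
      s , N , N≤ , get (initialisedW » e) , largest }

-- Time and space bounds

-- The potential 2 ^ q * (y + r) at q * y + r is linear on each block of length y and doubles
-- from one block to the next.
module _ (y′ : ℕ) where

  private
    y = suc y′

  -- `A` and `A′` are the potentials before and after giving up one level. Their difference `D` is
  -- at least `A / (2 * y)`, and this loss pays for the doubled term of the recurrence.
  block-step : ∀ A A′ D B → A′ + D ≡ A → A ≤ 2 * (y * D) →
               2 * (3 * A * B) + 3 * A′ * (4 * y * B) ≤ 3 * A * (4 * y * B)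
  block-step A A′ D B refl A≤ = begin
    2 * (3 * A * B) + 3 * A′ * (4 * y * B)                 ≡⟨ cong (_+ 3 * A′ * (4 * y * B)) (regroup A B) ⟩
    6 * B * A + 3 * A′ * (4 * y * B)                       ≤⟨ +-monoˡ-≤ _ (*-monoʳ-≤ (6 * B) A≤) ⟩
    6 * B * (2 * (y * D)) + 3 * A′ * (4 * y * B)           ≡⟨ collect A′ D B y ⟩
    3 * A * (4 * y * B)                                    ∎
    where
    open ≤-Reasoning
    regroup : ∀ A B → 2 * (3 * A * B) ≡ 6 * B * A
    regroup = solve-∀
    collect : ∀ A′ D B y → 6 * B * (2 * (y * D)) + 3 * A′ * (4 * y * B) ≡ 3 * (A′ + D) * (4 * y * B)
    collect = solve-∀

  -- Adding 2 absorbs the constant 4, because `2 + (4 + (I + I) + b)` equals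
  -- `2 * (2 + I) + (2 + b)`. The factor 3 is the value of `2 + iterations k 0`.
  potential : ∀ j L q r → q * y + r ≡ j → r ≤ y →
              (2 + below j L) * y ≤ 3 * (2 ^ q * (y + r)) * (4 * y) ^ L
  potential zero L q r eq r≤ = begin
    2 * y                               ≤⟨ *-mono-≤ (s≤s (s≤s (z≤n {1}))) (y≤ q r) ⟩
    3 * (2 ^ q * (y + r))               ≤⟨ m≤m*n _ ((4 * y) ^ L) {{m^n≢0 (4 * y) L}} ⟩
    3 * (2 ^ q * (y + r)) * (4 * y) ^ L ∎
    where
    open ≤-Reasoning
    y≤ : ∀ q r → y ≤ 2 ^ q * (y + r)
    y≤ q r = ≤-trans (m≤m+n y r) (m≤n*m (y + r) (2 ^ q) {{m^n≢0 2 q}})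
  potential (suc k) zero q r eq r≤ = begin
    (2 + iterations k 0) * y            ≤⟨ *-monoʳ-≤ 3 (≤-trans (m≤m+n y r) (m≤n*m (y + r) (2 ^ q) {{m^n≢0 2 q}})) ⟩
    3 * (2 ^ q * (y + r))               ≡⟨ *-identityʳ _ ⟨
    3 * (2 ^ q * (y + r)) * 1           ∎
    where open ≤-Reasoning
  potential (suc k) (suc L) q r eq r≤ = begin
    (2 + iterations k (suc L)) * y
      ≡⟨ cong (λ x → (2 + x) * y) (iterations-suc k L) ⟩
    (2 + (4 + (I + I) + below k (suc L))) * y
      ≡⟨ regroup I (below k (suc L)) y ⟩
    2 * ((2 + I) * y) + (2 + below k (suc L)) * y
      ≤⟨ +-mono-≤ (*-monoʳ-≤ 2 (potential (suc k) L q r eq r≤)) (previous q r eq r≤) ⟩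
    2 * (3 * A * B) + 3 * A′ q r * (4 * y * B)
      ≤⟨ block-step A (A′ q r) (D q r) B (A′+D q r eq) (A≤ q r eq r≤) ⟩
    3 * A * (4 * y * B) ∎
    where
    open ≤-Reasoning
    I = iterations k L
    A = 2 ^ q * (y + r)
    B = (4 * y) ^ L
    regroup : ∀ I b y → (2 + (4 + (I + I) + b)) * y ≡ 2 * ((2 + I) * y) + (2 + b) * y
    regroup = solve-∀
    A′ : ℕ → ℕ → ℕ
    A′ q       (suc r) = 2 ^ q * (y + r)
    A′ (suc q) zero    = 2 ^ q * (y + y′)
    A′ zero    zero    = 0
    D : ℕ → ℕ → ℕ
    D q       (suc r) = 2 ^ q
    D (suc q) zero    = 2 ^ q
    D zero    zero    = 0
    previous : ∀ q r → q * y + r ≡ suc k → r ≤ y → (2 + below k (suc L)) * y ≤ 3 * A′ q r * (4 * y) ^ suc L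
    previous q       (suc r) eq r≤ = potential k (suc L) q r (suc-injective (trans (sym (+-suc (q * y) r)) eq)) (<⇒≤ r≤)
    previous (suc q) zero    eq r≤ = potential k (suc L) q y′ (suc-injective (trans (shift (q * y) y′) eq)) (n≤1+n y′)
      where
      shift : ∀ a b → suc (a + b) ≡ suc b + a + 0
      shift = solve-∀
    A′+D : ∀ q r → q * y + r ≡ suc k → A′ q r + D q r ≡ 2 ^ q * (y + r)
    A′+D q       (suc r) eq = grow (2 ^ q) y r
      where
      grow : ∀ a y r → a * (y + r) + a ≡ a * (y + suc r)
      grow = solve-∀
    A′+D (suc q) zero    eq = double (2 ^ q) y′
      where
      double : ∀ a y′ → a * (suc y′ + y′) + a ≡ 2 * a * (suc y′ + 0)
      double = solve-∀
    A≤ : ∀ q r → q * y + r ≡ suc k → r ≤ y → 2 ^ q * (y + r) ≤ 2 * (y * D q r)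
    A≤ q (suc r) eq r≤ = ≤-trans (*-monoʳ-≤ (2 ^ q) (+-monoʳ-≤ y r≤)) (≤-reflexive (twice (2 ^ q) y))
      where
      twice : ∀ a y → a * (y + y) ≡ 2 * (y * a)
      twice = solve-∀
    A≤ (suc q) zero eq r≤ = ≤-reflexive (twice (2 ^ q) y)
      where
      twice : ∀ a y → 2 * a * (y + 0) ≡ 2 * (y * a)
      twice = solve-∀

  -- The factor 6 is the earlier 3 times the 2 in `y + r ≤ 2 * y`. A longer block lowers the first
  -- power and raises the second.
  iterations-bound : ∀ k L → iterations k L ≤ 6 * 2 ^ (suc k / y) * (4 * y) ^ L
  iterations-bound k L = *-cancelʳ-≤ _ _ y (begin
    iterations k L * y                       ≤⟨ *-monoˡ-≤ y (m≤n+m (iterations k L) 2) ⟩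
    (2 + iterations k L) * y                 ≤⟨ potential (suc k) L q r eq (<⇒≤ (m%n<n (suc k) y)) ⟩
    3 * (2 ^ q * (y + r)) * (4 * y) ^ L      ≤⟨ *-monoˡ-≤ ((4 * y) ^ L) (*-monoʳ-≤ 3 (*-monoʳ-≤ (2 ^ q) (+-monoʳ-≤ y (<⇒≤ (m%n<n (suc k) y))))) ⟩
    3 * (2 ^ q * (y + y)) * (4 * y) ^ L      ≡⟨ regroup (2 ^ q) y ((4 * y) ^ L) ⟩
    6 * 2 ^ q * (4 * y) ^ L * y              ∎)
    where
    open ≤-Reasoning
    q = suc k / y
    r = suc k % y
    eq : q * y + r ≡ suc k
    eq = trans (+-comm (q * y) r) (sym (m≡m%n+[m/n]*n (suc k) y))
    regroup : ∀ a y b → 3 * (a * (y + y)) * b ≡ 6 * a * b * y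
    regroup = solve-∀

-- Logarithms and powers

2^⌊log₂n⌋≤n : ∀ n → 1 ≤ n → 2 ^ ⌊log₂ n ⌋ ≤ n
2^⌊log₂n⌋≤n n = go n (<-wellFounded n)
  where
  go : ∀ n → Acc _<_ n → 1 ≤ n → 2 ^ ⌊log₂ n ⌋ ≤ n
  go 1 _ _ = s≤s z≤n
  go n@(suc (suc n₀)) (acc rec) _ = begin
    2 ^ ⌊log₂ n ⌋             ≤⟨ ^-monoʳ-≤ 2 (≤-trans (m≤n+m∸n ⌊log₂ n ⌋ 1) (≤-reflexive (cong suc (sym (⌊log₂⌊n/2⌋⌋≡⌊log₂n⌋∸1 n))))) ⟩
    2 * 2 ^ ⌊log₂ ⌊ n /2⌋ ⌋   ≤⟨ *-monoʳ-≤ 2 (go ⌊ n /2⌋ (rec (⌊n/2⌋<n (suc n₀))) (s≤s z≤n)) ⟩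
    2 * ⌊ n /2⌋               ≡⟨ cong (⌊ n /2⌋ +_) (+-identityʳ ⌊ n /2⌋) ⟩
    ⌊ n /2⌋ + ⌊ n /2⌋         ≤⟨ +-monoʳ-≤ ⌊ n /2⌋ (⌊n/2⌋≤⌈n/2⌉ n) ⟩
    ⌊ n /2⌋ + ⌈ n /2⌉         ≡⟨ ⌊n/2⌋+⌈n/2⌉≡n n ⟩
    n                         ∎
    where open ≤-Reasoning

n<2^1+⌊log₂n⌋ : ∀ n → n < 2 ^ (1 + ⌊log₂ n ⌋)
n<2^1+⌊log₂n⌋ n = let k , _ , n< , k≤ = halving n in ≤-trans n< (^-monoʳ-≤ 2 k≤)

1≤⌊log₂n⌋ : ∀ {n} → 2 ≤ n → 1 ≤ ⌊log₂ n ⌋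
1≤⌊log₂n⌋ 2≤n = ⌊log₂⌋-mono-≤ 2≤n

n<2^n : ∀ n → n < 2 ^ n
n<2^n zero    = s≤s z≤n
n<2^n (suc n) = begin-strict
  suc n          ≤⟨ n<2^n n ⟩
  2 ^ n          <⟨ m<m+n (2 ^ n) (m^n>0 2 n) ⟩
  2 ^ n + 2 ^ n  ≡⟨ cong (2 ^ n +_) (+-identityʳ (2 ^ n)) ⟨
  2 ^ suc n      ∎
  where open ≤-Reasoning

⌊log₂n⌋≤n : ∀ n → ⌊log₂ n ⌋ ≤ n
⌊log₂n⌋≤n zero = z≤n
⌊log₂n⌋≤n n@(suc _) = ≤-trans (<⇒≤ (n<2^n ⌊log₂ n ⌋)) (2^⌊log₂n⌋≤n n (s≤s z≤n))

^-merge : ∀ a b → 2 ^ a * 2 ^ b ≡ 2 ^ (a + b)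
^-merge a b = sym (^-distribˡ-+-* 2 a b)

^-merge₅ : ∀ a b c x y → 2 ^ a * (2 ^ b * (2 ^ c * (2 ^ x * 2 ^ y))) ≡ 2 ^ (a + (b + (c + (x + y))))
^-merge₅ a b c x y = trans (cong (λ z → 2 ^ a * (2 ^ b * (2 ^ c * z))) (^-merge x y))
  (trans (cong (λ z → 2 ^ a * (2 ^ b * z)) (^-merge c (x + y)))
  (trans (cong (2 ^ a *_) (^-merge b (c + (x + y)))) (^-merge a (b + (c + (x + y))))))

2^lg*x≤n^x : ∀ {n} x → 1 ≤ n → 2 ^ (lg n * x) ≤ n ^ x
2^lg*x≤n^x {n} x 1≤n = ≤-trans (≤-reflexive (sym (^-*-assoc 2 (lg n) x))) (^-monoˡ-≤ x (2^⌊log₂n⌋≤n n 1≤n))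

-- Running time in the different ranges of `d`

bound : (c n d k L : ℕ) → ℕ
bound c n d k L = c * (iterations k L * (n * (1 + d)))

module _ {c s n d L : ℕ} (c≤2^s : c ≤ 2 ^ s) (2≤n : 2 ≤ n) (L≤ : L ≤ 2 + (lg n + lg n)) where

  private
    l = lg n
    1≤n : 1 ≤ n
    1≤n = ≤-trans (s≤s z≤n) 2≤n
    1≤l : 1 ≤ l
    1≤l = 1≤⌊log₂n⌋ 2≤n
    a≤a*l : ∀ a → a ≤ a * l
    a≤a*l a = m≤m*n a l {{>-nonZero 1≤l}}

  -- With a power of two as block length the whole estimate becomes a sum of exponents.
  iterations-blocks : ∀ k z q → suc k ≤ q * 2 ^ z → iterations k L ≤ 2 ^ 3 * 2 ^ q * 2 ^ ((2 + z) * (2 + (l + l)))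
  iterations-blocks k z q k< with 2 ^ z in eq
  ... | zero = contradiction eq (≢-nonZero⁻¹ (2 ^ z) {{m^n≢0 2 z}})
  ... | suc y′ = begin
    iterations k L                                ≤⟨ iterations-bound y′ k L ⟩
    6 * 2 ^ (suc k / suc y′) * (4 * suc y′) ^ L   ≤⟨ *-mono-≤ (*-mono-≤ (m≤m+n 6 2) (^-monoʳ-≤ 2 blocks)) width ⟩
    2 ^ 3 * 2 ^ q * 2 ^ ((2 + z) * (2 + (l + l))) ∎
    where
    open ≤-Reasoning
    blocks : suc k / suc y′ ≤ q
    blocks = ≤-trans (/-monoˡ-≤ (suc y′) k<) (≤-reflexive (m*n/n≡m q (suc y′)))
    width : (4 * suc y′) ^ L ≤ 2 ^ ((2 + z) * (2 + (l + l)))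
    width = begin
      (4 * suc y′) ^ L               ≤⟨ ^-monoʳ-≤ (4 * suc y′) L≤ ⟩
      (4 * suc y′) ^ (2 + (l + l))   ≡⟨ cong (λ y → (4 * y) ^ (2 + (l + l))) eq ⟨
      (4 * 2 ^ z) ^ (2 + (l + l))    ≡⟨ cong (_^ (2 + (l + l))) (^-merge 2 z) ⟩
      (2 ^ (2 + z)) ^ (2 + (l + l))  ≡⟨ ^-*-assoc 2 (2 + z) (2 + (l + l)) ⟩
      2 ^ ((2 + z) * (2 + (l + l)))  ∎

  -- Blocks of length one: the number of blocks and the factor `1 + d` together contribute
  -- `2 ^ (2 * d)` up to a constant, which is a power of `n` when `d` is logarithmic.
  bound-logarithmic : ∀ C → d ≤ C * lg n → bound c n d (1 + d) L ≤ n ^ (14 + s + 2 * C)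
  bound-logarithmic C d≤ = begin
    c * (iterations (1 + d) L * (n * (1 + d)))
      ≤⟨ *-mono-≤ (c≤2^s) (*-mono-≤ I≤ (*-monoʳ-≤ n (n<2^n d))) ⟩
    2 ^ s * (2 ^ 3 * 2 ^ (2 + d) * 2 ^ (4 + 4 * l) * (n * 2 ^ d))
      ≡⟨ regroup (2 ^ s) (2 ^ 3) (2 ^ (2 + d)) (2 ^ (4 + 4 * l)) n (2 ^ d) ⟩
    n * (2 ^ s * (2 ^ 3 * (2 ^ (2 + d) * (2 ^ (4 + 4 * l) * 2 ^ d))))
      ≡⟨ cong (n *_) (^-merge₅ s 3 (2 + d) (4 + 4 * l) d) ⟩
    n * 2 ^ (s + (3 + ((2 + d) + ((4 + 4 * l) + d))))
      ≤⟨ *-monoʳ-≤ n (≤-trans (^-monoʳ-≤ 2 exponent) (2^lg*x≤n^x (13 + s + 2 * C) 1≤n)) ⟩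
    n * n ^ (13 + s + 2 * C) ∎
    where
    open ≤-Reasoning
    regroup : ∀ a b c e n f → a * (b * c * e * (n * f)) ≡ n * (a * (b * (c * (e * f))))
    regroup = solve-∀
    exponent : s + (3 + ((2 + d) + ((4 + 4 * l) + d))) ≤ l * (13 + s + 2 * C)
    exponent = begin
      s + (3 + ((2 + d) + ((4 + 4 * l) + d)))  ≡⟨ sort s d l ⟩
      9 + s + 4 * l + 2 * d                        ≤⟨ +-mono-≤ (+-monoˡ-≤ (4 * l) (a≤a*l (9 + s))) (*-monoʳ-≤ 2 d≤) ⟩
      (9 + s) * l + 4 * l + 2 * (C * l)         ≡⟨ collect s C l ⟩
      l * (13 + s + 2 * C)                          ∎
      where
      sort : ∀ s d l → s + (3 + ((2 + d) + ((4 + 4 * l) + d))) ≡ 9 + s + 4 * l + 2 * d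
      sort = solve-∀
      collect : ∀ s C l → (9 + s) * l + 4 * l + 2 * (C * l) ≡ l * (13 + s + 2 * C)
      collect = solve-∀
    I≤ : iterations (1 + d) L ≤ 2 ^ 3 * 2 ^ (2 + d) * 2 ^ (4 + 4 * l)
    I≤ = subst (λ x → iterations (1 + d) L ≤ 2 ^ 3 * 2 ^ (2 + d) * 2 ^ x) (double l)
           (iterations-blocks (1 + d) 0 (2 + d) (≤-reflexive (sym (*-identityʳ (2 + d)))))
      where
      double : ∀ l → 2 * (2 + (l + l)) ≡ 4 + 4 * l
      double = solve-∀

  private
    e = lg (d div lg n)

  module _ (l≤d : lg n ≤ d) where

    private
      instance
        l≢0 : NonZero l
        l≢0 = >-nonZero 1≤l

      div≡ : ∀ m k .{{_ : NonZero k}} → m div k ≡ m / k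
      div≡ m (suc k) = refl

      d<l*2^e : 1 + d ≤ l * 2 ^ (1 + e)
      d<l*2^e = begin
        1 + d                     ≡⟨ cong suc (m≡m%n+[m/n]*n d l) ⟩
        suc (d % l) + d / l * l   ≤⟨ +-monoˡ-≤ (d / l * l) (m%n<n d l) ⟩
        suc (d / l) * l           ≡⟨ *-comm (suc (d / l)) l ⟩
        l * suc (d / l)           ≡⟨ cong (λ x → l * suc x) (div≡ d l) ⟨
        l * suc (d div l)         ≤⟨ *-monoʳ-≤ l (n<2^1+⌊log₂n⌋ (d div l)) ⟩
        l * 2 ^ (1 + e)           ∎
        where open ≤-Reasoning

    private
      bound-blocks : ∀ k z q → suc k ≤ q * 2 ^ z →
        s + (3 + (q + ((2 + z) * (2 + (l + l)) + (1 + e)))) ≤ l * (2 * e + (30 + s)) → bound c n d k L ≤ n ^ (2 * e + (32 + s))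
      bound-blocks k z q k< exponent = begin
        c * (iterations k L * (n * (1 + d)))
          ≤⟨ *-mono-≤ c≤2^s (*-mono-≤ (iterations-blocks k z q k<) (*-monoʳ-≤ n (≤-trans d<l*2^e (*-monoˡ-≤ (2 ^ (1 + e)) (⌊log₂n⌋≤n n))))) ⟩
        2 ^ s * (2 ^ 3 * 2 ^ q * 2 ^ x * (n * (n * 2 ^ (1 + e))))
          ≡⟨ regroup (2 ^ s) (2 ^ 3) (2 ^ q) (2 ^ x) n (2 ^ (1 + e)) ⟩
        n * (n * (2 ^ s * (2 ^ 3 * (2 ^ q * (2 ^ x * 2 ^ (1 + e))))))
          ≡⟨ cong (λ x → n * (n * x)) (^-merge₅ s 3 q x (1 + e)) ⟩
        n * (n * 2 ^ (s + (3 + (q + (x + (1 + e))))))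
          ≤⟨ *-monoʳ-≤ n (*-monoʳ-≤ n (≤-trans (^-monoʳ-≤ 2 exponent) (2^lg*x≤n^x (2 * e + (30 + s)) 1≤n))) ⟩
        n * (n * n ^ (2 * e + (30 + s)))
          ≡⟨ cong (n ^_) (sym (trans (+-comm (2 * e) (32 + s)) (cong (2 +_) (+-comm (30 + s) (2 * e))))) ⟩
        n ^ (2 * e + (32 + s)) ∎
        where
        open ≤-Reasoning
        x = (2 + z) * (2 + (l + l))
        regroup : ∀ a b c e n f → a * (b * c * e * (n * (n * f))) ≡ n * (n * (a * (b * (c * (e * f)))))
        regroup = solve-∀

    -- Few priorities per logarithm: blocks of length 2 ^ (1 + e) cover the d + 1 levels.
    bound-moderate : e ≤ 4 * l → bound c n d (1 + d) L ≤ n ^ (2 * e + (32 + s))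
    bound-moderate e≤ = bound-blocks (1 + d) (1 + e) (1 + l) (+-mono-≤ (m^n>0 2 (1 + e)) d<l*2^e) (begin
      s + (3 + ((1 + l) + ((3 + e) * (2 + (l + l)) + (1 + e)))) ≡⟨ sort s e l ⟩
      -- Two of the three single `e` come from the additive 2 in the precisions, one from the factor
      -- `1 + d`. Only `e ≤ 4 * l` turns them into a constant exponent of `n`.
      11 + s + 7 * l + 3 * e + 2 * (e * l)               ≤⟨ +-monoˡ-≤ (2 * (e * l)) (+-mono-≤ (+-monoˡ-≤ (7 * l) (a≤a*l (11 + s))) (*-monoʳ-≤ 3 e≤)) ⟩
      (11 + s) * l + 7 * l + 3 * (4 * l) + 2 * (e * l)   ≡⟨ collect s e l ⟩
      l * (2 * e + (30 + s))                             ∎)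
      where
      open ≤-Reasoning
      sort : ∀ s e l → s + (3 + ((1 + l) + ((3 + e) * (2 + (l + l)) + (1 + e)))) ≡ 11 + s + 7 * l + 3 * e + 2 * (e * l)
      sort = solve-∀
      collect : ∀ s e l → (11 + s) * l + 7 * l + 3 * (4 * l) + 2 * (e * l) ≡ l * (2 * e + (30 + s))
      collect = solve-∀

    -- With this many priorities most levels are empty: one block covers the at most n others.
    bound-sparse : 4 * l ≤ e → bound c n d n L ≤ n ^ (2 * e + (32 + s))
    bound-sparse 4l≤e = bound-blocks n (1 + l) 1 (≤-trans (n<2^1+⌊log₂n⌋ n) (≤-reflexive (sym (*-identityˡ (2 ^ (1 + l)))))) (begin
      s + (3 + (1 + ((3 + l) * (2 + (l + l)) + (1 + e))))  ≡⟨ sort s e l ⟩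
      -- The quadratic term is at most `l * e`, and so is the single `e` contributed by the factor
      -- `1 + d`; together they use up the exponent `2 * e`.
      11 + s + 8 * l + l * (2 * l) + e                     ≤⟨ +-mono-≤ (+-mono-≤ (+-monoˡ-≤ (8 * l) (a≤a*l (11 + s)))
                                                                (*-monoʳ-≤ l (≤-trans (*-monoˡ-≤ l (m≤m+n 2 2)) 4l≤e)))
                                                                (m≤n*m e l) ⟩
      (11 + s) * l + 8 * l + l * e + l * e                 ≤⟨ m≤m+n _ (11 * l) ⟩
      (11 + s) * l + 8 * l + l * e + l * e + 11 * l        ≡⟨ collect s e l ⟩
      l * (2 * e + (30 + s))                               ∎)
      where
      open ≤-Reasoning
      sort : ∀ s e l → s + (3 + (1 + ((3 + l) * (2 + (l + l)) + (1 + e)))) ≡ 11 + s + 8 * l + l * (2 * l) + e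
      sort = solve-∀
      collect : ∀ s e l → (11 + s) * l + 8 * l + l * e + l * e + 11 * l ≡ l * (2 * e + (30 + s))
      collect = solve-∀

-- Choice of parameters and resource bounds

precision₀ : ℕ → ℕ
precision₀ n = proj₁ (halving n)

marks₀ : ℕ → ℕ
marks₀ d = proj₁ (halving (1 + d))

precision₀≤ : ∀ n → precision₀ n ≤ 1 + lg n
precision₀≤ n = proj₂ (proj₂ (proj₂ (halving n)))

marks₀≤ : ∀ d → marks₀ d ≤ 1 + lg (1 + d)
marks₀≤ d = proj₂ (proj₂ (proj₂ (halving (1 + d))))

precisions : ℕ → ℕ
precisions n = precision₀ n + precision₀ n

precisions≤ : ∀ n → precisions n ≤ 2 + (lg n + lg n)
precisions≤ n = ≤-trans (+-mono-≤ (precision₀≤ n) (precision₀≤ n)) (≤-reflexive (cong suc (+-suc (lg n) (lg n))))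

record Room (n d V : ℕ) : Set where
  field
    n≤V     : n ≤ V
    K≤V     : 4 + (d + d) ≤ V
    limit≤V : 8 + marks₀ d ≤ V
    a₀≤V    : precisions n ≤ V
    stack≤V : (4 + (d + d)) ^ (1 + (precisions n)) ≤ V

-- For correctness and time any bound on the cell contents will do; the sharp one is chosen where
-- space is counted.
someRoom : ∀ n d → ∃ (Room n d)
someRoom n d = n + (8 + marks₀ d + (a + power)) , record
  { n≤V = m≤m+n n _
  ; K≤V = ≤-trans (m≤m*n K (K ^ a) {{m^n≢0 K a}}) power≤
  ; limit≤V = ≤-trans (m≤m+n (8 + marks₀ d) _) (m≤n+m _ n)
  ; a₀≤V = ≤-trans (m≤m+n a power) (≤-trans (m≤n+m _ (8 + marks₀ d)) (m≤n+m _ n))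
  ; stack≤V = power≤ }
  where
  K = 4 + (d + d)
  a = precisions n
  power = K ^ (1 + a)
  power≤ : power ≤ n + (8 + marks₀ d + (a + power))
  power≤ = ≤-trans (m≤n+m power a) (≤-trans (m≤n+m _ (8 + marks₀ d)) (m≤n+m _ n))

record Levels (G : ParityGame) (d k : ℕ) : Set where
  field
    μ      : ℕ → ℕ
    μ-mono : ∀ {h h′} → Nonempty (withPriority G h) → h′ < h → μ h′ < μ h
    μ≤k    : ∀ {h} → h ≤ d → μ h ≤ k

by-priority : ∀ G d → Levels G d (1 + d)
by-priority G d = record { μ = suc ; μ-mono = λ _ → s≤s ; μ≤k = s≤s }

-- The rank of a level is the number of vertices of at most that priority. It grows strictly only at
-- non-empty levels, and these are the ones at which a call starts.
by-vertices : ∀ {G n} d → size G ≤ n → Levels G d n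
by-vertices {G} d size≤n = record { μ = λ h → ∣ upTo h ∣ ; μ-mono = mono ; μ≤k = λ _ → ≤-trans (∣p∣≤n (upTo _)) size≤n }
  where
  open Game G
  upTo : ℕ → VertexSet G
  upTo h = comprehension G (λ v → π G v ≤? h)
  ∈-upTo⁺ : ∀ {h v} → π G v ≤ h → v ∈ upTo h
  ∈-upTo⁺ {h} {v} ≤h = ∈-comprehension⁺ (does⁺ (π G v ≤? h) ≤h)
  ∈-upTo⁻ : ∀ {h v} → v ∈ upTo h → π G v ≤ h
  ∈-upTo⁻ {h} {v} v∈ = does⁻ (π G v ≤? h) (∈-comprehension⁻ v∈)
  mono : ∀ {h h′} → Nonempty (withPriority G h) → h′ < h → ∣ upTo h′ ∣ < ∣ upTo h ∣
  mono (v , v∈) h′<h = p⊂q⇒∣p∣<∣q∣ ((λ u∈ → ∈-upTo⁺ (≤-trans (∈-upTo⁻ u∈) (<⇒≤ h′<h)))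
    , v , ∈-upTo⁺ (≤-reflexive (∈-withPriority⁻ v∈)) , λ v∈′ → <⇒≱ h′<h (≤-trans (≤-reflexive (sym (∈-withPriority⁻ v∈))) (∈-upTo⁻ v∈′)))

abstract

  solving : ∀ {n d V k} G → Small n d G → Room n d V → Levels G d k →
    ∃ λ s → ∃ λ N → N ≤ 1 + iterations k (precisions n)
      × Execution.Exec G V (8 + marks₀ d) solver (initial G n d) s ((26 + (8 + N * 81 + 7)) * (1 + (n + (marks₀ d + d))))
      × LargestDominion G Even (X G s 0) × LargestDominion G Odd (X G s 1)
  solving {n} {d} {V} {k} G (size≤n , π≤d) room levels =
    Solution.solved G n d (marks₀ d) V (precision₀ n) size≤n π≤d n≤V K≤V limit≤V a₀≤V stack≤V
      (proj₁ (proj₂ (halving n))) (proj₁ (proj₂ (halving (1 + d))))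
      (proj₁ (proj₂ (proj₂ (halving n)))) (proj₁ (proj₂ (proj₂ (halving (1 + d)))))
      (≤-trans (precision₀≤ n) (s≤s (⌊log₂n⌋≤n n))) μ μ-mono k μ≤k
    where
    open Room room
    open Levels levels

solver-solves : SolvesSmallGames solver
solver-solves n d G small =
  let s , _ , _ , e , even , odd = solving G small (proj₂ (someRoom n d)) (by-priority G d)
  in s , Execution.Exec.run e , even , odd

abstract

  -- An iteration costs 81 units and the fixed part 26 + 8 + 81 + 7 = 122, which gives 203. The 4
  -- compares the unit with `n * (1 + d)`.
  factor : ℕ
  factor = 203 * 4

  factor≤ : factor ≤ 2 ^ 10
  factor≤ = m≤m+n 812 212

  time≤ : ∀ {I N} n d → 1 ≤ n → 1 ≤ I → N ≤ 1 + I →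
          (26 + (8 + N * 81 + 7)) * (1 + (n + (marks₀ d + d))) ≤ factor * (I * (n * (1 + d)))
  time≤ {I} {N} n d 1≤n 1≤I N≤ = begin
    (26 + (8 + N * 81 + 7)) * (1 + (n + (marks₀ d + d))) ≤⟨ *-mono-≤ steps unit ⟩
    203 * I * (4 * (n * (1 + d)))                        ≡⟨ regroup 203 4 I (n * (1 + d)) ⟩
    203 * 4 * (I * (n * (1 + d)))                        ∎
    where
    open ≤-Reasoning
    regroup : ∀ a b x y → a * x * (b * y) ≡ a * b * (x * y)
    regroup = solve-∀
    sort : ∀ y → 26 + (8 + (81 + y) + 7) ≡ 122 + y
    sort y = cong (λ x → 26 + (8 + x)) (+-comm (81 + y) 7)
    steps : 26 + (8 + N * 81 + 7) ≤ 203 * I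
    steps = begin
      26 + (8 + N * 81 + 7)          ≤⟨ +-monoʳ-≤ 26 (+-monoˡ-≤ 7 (+-monoʳ-≤ 8 (*-monoˡ-≤ 81 N≤))) ⟩
      26 + (8 + (81 + I * 81) + 7)   ≡⟨ sort (I * 81) ⟩
      122 + I * 81                   ≤⟨ +-mono-≤ (*-monoʳ-≤ 122 1≤I) (≤-reflexive (*-comm I 81)) ⟩
      122 * I + 81 * I               ≡⟨ *-distribʳ-+ I 122 81 ⟨
      203 * I                        ∎
    unit : 1 + (n + (marks₀ d + d)) ≤ 4 * (n * (1 + d))
    unit = begin
      1 + (n + (marks₀ d + d))       ≤⟨ s≤s (+-monoʳ-≤ n (+-monoˡ-≤ d (≤-trans (marks₀≤ d) (s≤s (⌊log₂n⌋≤n (1 + d)))))) ⟩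
      1 + (n + (2 + d + d))          ≡⟨ expand n d ⟩
      n + (3 + 2 * d)                ≤⟨ +-monoʳ-≤ n (+-mono-≤ (*-monoʳ-≤ 3 1≤n) (≤-trans (*-monoˡ-≤ d (m≤m+n 2 2)) (*-monoʳ-≤ 4 (m≤n*m d n {{>-nonZero 1≤n}})))) ⟩
      n + (3 * n + 4 * (n * d))      ≡⟨ collect n d ⟩
      4 * (n * (1 + d))              ∎
      where
      expand : ∀ n d → 1 + (n + (2 + d + d)) ≡ n + (3 + 2 * d)
      expand = solve-∀
      collect : ∀ n d → n + (3 * n + 4 * (n * d)) ≡ 4 * (n * (1 + d))
      collect = solve-∀

  time-bound : ∀ {n d k} G → 1 ≤ n → Small n d G → Levels G d k →
    ∀ {s} (r : Run G solver (initial G n d) s) → time G r ≤ bound factor n d k (precisions n)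
  time-bound {n} {d} {k} G 1≤n small levels r =
    let _ , N , N≤ , e , _ = solving G small (proj₂ (someRoom n d)) levels
        _ , same , _ = deterministic G r (Execution.Exec.run e)
    in ≤-trans (≤-reflexive same) (≤-trans (Execution.Exec.fast e) (time≤ {iterations k (precisions n)} {N} n d 1≤n (iterations>0 k (precisions n)) N≤))

  peak-bound : ∀ {n d V} G → Small n d G → Room n d V → ∀ f b →
    (∀ s → Execution.OK G V (8 + marks₀ d) s → f s ≤ b) →
    ∀ {s} (r : Run G solver (initial G n d) s) → peak G f r ≤ b
  peak-bound {d = d} G small room f b f≤b r =
    let _ , _ , _ , e , _ = solving G small room (by-priority G d)
        _ , _ , same = deterministic G r (Execution.Exec.run e)
    in ≤-trans (≤-reflexive (same f)) (Execution.Exec.safe e f b f≤b)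

lg[1+d]≤1+lg[d] : ∀ {d} → 1 ≤ d → lg (1 + d) ≤ 1 + lg d
lg[1+d]≤1+lg[d] {d} 1≤d = begin
  lg (1 + d)  ≤⟨ ⌊log₂⌋-mono-≤ (+-mono-≤ 1≤d (m≤m+n d 0)) ⟩
  lg (2 * d)  ≡⟨ ⌊log₂[2*b]⌋≡1+⌊log₂b⌋ d {{>-nonZero 1≤d}} ⟩
  1 + lg d    ∎
  where open ≤-Reasoning

-- There are 8 fixed set variables and at most `2 + lg d` mark bits, and `lg d` is at least 1.
limit≤ : ∀ {d} → 2 ≤ d → 8 + marks₀ d ≤ 11 * lg d
limit≤ {d} 2≤d = begin
  8 + marks₀ d          ≤⟨ +-monoʳ-≤ 8 (≤-trans (marks₀≤ d) (s≤s (lg[1+d]≤1+lg[d] (≤-trans (s≤s z≤n) 2≤d)))) ⟩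
  10 + lg d             ≤⟨ +-monoˡ-≤ (lg d) (*-monoʳ-≤ 10 (1≤⌊log₂n⌋ 2≤d)) ⟩
  10 * lg d + lg d      ≡⟨ +-comm (10 * lg d) (lg d) ⟩
  11 * lg d             ∎
  where open ≤-Reasoning

bits≤ : ∀ {V} xs k → length xs ≤ k → All (_≤ V) xs → sum (map bitLength xs) ≤ k * bitLength V
bits≤ []       k       _         _         = z≤n
bits≤ (x ∷ xs) (suc k) (s≤s len) (x≤ ∷ xs≤) = +-mono-≤ (s≤s (⌊log₂⌋-mono-≤ x≤)) (bits≤ xs k len xs≤)

module _ {n d : ℕ} (2≤n : 2 ≤ n) (2≤d : 2 ≤ d) where

  private
    x = lg d
    y = lg n
    1≤x : 1 ≤ x
    1≤x = 1≤⌊log₂n⌋ 2≤d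
    1≤y : 1 ≤ y
    1≤y = 1≤⌊log₂n⌋ 2≤n
    -- The bit length of the stack: at most `3 + 2 * y` digits of at most `3 + x` bits, that is
    -- `4 * x` times `5 * y`.
    E = 20 * (x * y)
    open ≤-Reasoning

    y≤xy : ∀ a → a * y ≤ a * (x * y)
    y≤xy a = *-monoʳ-≤ a (m≤n*m y x {{>-nonZero 1≤x}})

    x≤xy : ∀ a → a * x ≤ a * (x * y)
    x≤xy a = *-monoʳ-≤ a (m≤m*n x y {{>-nonZero 1≤y}})

    a+by≤ : ∀ a b → a + b ≤ 20 → a + b * y ≤ E
    a+by≤ a b a+b≤ = begin
      a + b * y          ≤⟨ +-monoˡ-≤ (b * y) (m≤m*n a y {{>-nonZero 1≤y}}) ⟩
      a * y + b * y      ≡⟨ *-distribʳ-+ y a b ⟨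
      (a + b) * y        ≤⟨ y≤xy (a + b) ⟩
      (a + b) * (x * y)  ≤⟨ *-monoˡ-≤ (x * y) a+b≤ ⟩
      E                  ∎

    2a₀≤ : precisions n ≤ 2 + 2 * y
    2a₀≤ = ≤-trans (precisions≤ n) (≤-reflexive (cong (λ z → 2 + (y + z)) (sym (+-identityʳ y))))

    K≤ : 4 + (d + d) ≤ 2 ^ (3 + x)
    K≤ = begin
      4 + (d + d)              ≤⟨ +-mono-≤ (^-monoʳ-≤ 2 (m≤m+n 2 x)) (≤-trans (≤-reflexive (cong (d +_) (sym (+-identityʳ d)))) (*-monoʳ-≤ 2 (<⇒≤ (n<2^1+⌊log₂n⌋ d)))) ⟩
      2 ^ (2 + x) + 2 ^ (2 + x) ≡⟨ cong (2 ^ (2 + x) +_) (+-identityʳ _) ⟨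
      2 ^ (3 + x)              ∎

    stack-exponent : (3 + x) * (3 + 2 * y) ≤ E
    stack-exponent = begin
      (3 + x) * (3 + 2 * y)           ≤⟨ *-mono-≤ (+-monoˡ-≤ x (*-monoʳ-≤ 3 1≤x)) (+-monoˡ-≤ (2 * y) (*-monoʳ-≤ 3 1≤y)) ⟩
      (3 * x + x) * (3 * y + 2 * y)   ≡⟨ collect x y ⟩
      E                               ∎
      where
      collect : ∀ x y → (3 * x + x) * (3 * y + 2 * y) ≡ 20 * (x * y)
      collect = solve-∀

    stack≤ : (4 + (d + d)) ^ (1 + (precisions n)) ≤ 2 ^ E
    stack≤ = begin
      (4 + (d + d)) ^ (1 + (precisions n)) ≤⟨ ^-monoˡ-≤ (1 + (precisions n)) K≤ ⟩
      (2 ^ (3 + x)) ^ (1 + (precisions n)) ≡⟨ ^-*-assoc 2 (3 + x) (1 + (precisions n)) ⟩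
      2 ^ ((3 + x) * (1 + (precisions n))) ≤⟨ ^-monoʳ-≤ 2 (≤-trans (*-monoʳ-≤ (3 + x) (s≤s 2a₀≤)) stack-exponent) ⟩
      2 ^ E                                             ∎

    room : Room n d (2 ^ E)
    room = record
      { n≤V = ≤-trans (<⇒≤ (n<2^1+⌊log₂n⌋ n)) (^-monoʳ-≤ 2 (≤-trans (≤-reflexive (cong suc (sym (*-identityˡ y)))) (a+by≤ 1 1 (m≤m+n 2 18))))
      ; K≤V = ≤-trans (m≤m*n (4 + (d + d)) ((4 + (d + d)) ^ (precisions n)) {{m^n≢0 (4 + (d + d)) (precisions n)}}) stack≤
      ; limit≤V = ≤-trans (≤-trans (limit≤ 2≤d) (≤-trans (x≤xy 11) (*-monoˡ-≤ (x * y) (m≤m+n 11 9)))) (<⇒≤ (n<2^n E))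
      ; a₀≤V = ≤-trans (≤-trans 2a₀≤ (a+by≤ 2 2 (m≤m+n 4 16))) (<⇒≤ (n<2^n E))
      ; stack≤V = stack≤ }

  set-bound : Uses[ setVariables ]≤ solver n d (11 * lg d)
  set-bound G small r = peak-bound G small room (λ s → length (State.sets s)) (11 * lg d)
    (λ { _ (_ , _ , len) → ≤-trans len (limit≤ 2≤d) }) r

  space-bound : Uses[ conventionalSpace ]≤ solver n d (441 * (lg d * lg n))
  space-bound G small r = peak-bound G small room (λ s → sum (map bitLength (State.cells s))) (441 * (x * y))
    -- 21 cells of at most `1 + 20 * (x * y)` bits each, hence the constant 21 * 21.
    (λ { s (len , cells≤ , _) → ≤-trans (bits≤ (State.cells s) 21 len cells≤) all-cells }) r
    where
    all-cells : 21 * bitLength (2 ^ E) ≤ 441 * (x * y)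
    all-cells = begin
      21 * bitLength (2 ^ E)          ≡⟨ cong (λ e → 21 * suc e) (⌊log₂[2^n]⌋≡n E) ⟩
      21 * (1 + 20 * (x * y))         ≤⟨ *-monoʳ-≤ 21 (+-monoˡ-≤ (20 * (x * y)) (*-mono-≤ 1≤x 1≤y)) ⟩
      21 * (21 * (x * y))             ≡⟨ *-assoc 21 21 (x * y) ⟨
      441 * (x * y)                   ∎

theorem23 : ∃ λ (P : Program) →
    SolvesSmallGames P
    × (∃ λ c → ∀ n d → 2 ≤ n → 2 ≤ d → Uses[ setVariables ]≤ P n d (c * lg d))
    × (∃ λ c → ∀ n d → 2 ≤ n → 2 ≤ d → Uses[ conventionalSpace ]≤ P n d (c * (lg d * lg n)))
    × (∀ (d : ℕ → ℕ) → d ∈O lg →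
    ∃ λ c → Eventually (λ n → Uses[ time ]≤ P n (d n) (n ^ c)))
    × (∃ λ c → ∀ (d : ℕ → ℕ) → d ∈ω lg →
    Eventually (λ n → Uses[ time ]≤ P n (d n) (n ^ (2 * lg (d n div lg n) + c))))
theorem23 = solver , solver-solves
  , (11 , λ n d 2≤n 2≤d → set-bound 2≤n 2≤d)
  , (441 , λ n d 2≤n 2≤d → space-bound 2≤n 2≤d)
  , polynomial
  -- The 32 of the exponent estimate plus 10 for `factor ≤ 2 ^ 10`; likewise 24 below is 14 plus 10.
  , (42 , quasi-polynomial)
  where
  polynomial : ∀ (d : ℕ → ℕ) → d ∈O lg → ∃ λ c → Eventually (λ n → Uses[ time ]≤ solver n (d n) (n ^ c))
  polynomial d (C , n₀ , d≤) = 24 + 2 * C , n₀ ⊔ 2 , λ n n≥ G small r →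
    let 2≤n = ≤-trans (m≤n⊔m n₀ 2) n≥
    in ≤-trans (time-bound G (≤-trans (n≤1+n 1) 2≤n) small (by-priority G (d n)) r)
         (bound-logarithmic {factor} {10} factor≤ 2≤n (precisions≤ n) C (d≤ n (≤-trans (m≤m⊔n n₀ 2) n≥)))
  quasi-polynomial : ∀ (d : ℕ → ℕ) → d ∈ω lg →
    Eventually (λ n → Uses[ time ]≤ solver n (d n) (n ^ (2 * lg (d n div lg n) + 42)))
  quasi-polynomial d super with super 1
  ... | n₀ , lg<d = n₀ ⊔ 2 , within-bound
    where
    within-bound : ∀ n → n₀ ⊔ 2 ≤ n → Uses[ time ]≤ solver n (d n) (n ^ (2 * lg (d n div lg n) + 42))
    -- Up to the threshold `4 * lg n` levels are counted by priorities. Beyond it, priorities far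
    -- outnumber vertices, and levels are counted by vertices.
    within-bound n n≥ G small r = [ moderate , sparse ]′ (≤-total (lg (d n div lg n)) (4 * lg n))
      where
      2≤n : 2 ≤ n
      2≤n = ≤-trans (m≤n⊔m n₀ 2) n≥
      1≤n : 1 ≤ n
      1≤n = ≤-trans (n≤1+n 1) 2≤n
      lg≤d : lg n ≤ d n
      lg≤d = ≤-trans (≤-reflexive (sym (*-identityˡ (lg n)))) (<⇒≤ (lg<d n (≤-trans (m≤m⊔n n₀ 2) n≥)))
      moderate : lg (d n div lg n) ≤ 4 * lg n → time G r ≤ n ^ (2 * lg (d n div lg n) + 42)
      moderate e≤ = ≤-trans (time-bound G 1≤n small (by-priority G (d n)) r)
        (bound-moderate {factor} {10} factor≤ 2≤n (precisions≤ n) lg≤d e≤)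
      sparse : 4 * lg n ≤ lg (d n div lg n) → time G r ≤ n ^ (2 * lg (d n div lg n) + 42)
      sparse ≤e = ≤-trans (time-bound G 1≤n small (by-vertices (d n) (proj₁ small)) r)
        (bound-sparse {factor} {10} factor≤ 2≤n (precisions≤ n) lg≤d ≤e)
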